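{- Let $U$ be a random-free graphon computable in $d_\square$ (i.e. having a computable $d_\square$-name). Then $U$ is computable in $d_1$ (i.e. has a computable $d_1$-name).
   Context: A graphon is a symmetric measurable function $W\colon[0,1]^2\to[0,1]$; it is random-free if it is $\{0,1\}$-valued almost everywhere with respect to Lebesgue measure. For symmetric measurable $F\colon[0,1]^2\to[-1,1]$, $\|F\|_\square=\sup_{S,T\subseteq[0,1]}\left|\int_{S\times T}F(x,y)\,dx\,dy\right|$ (over measurable $S,T$) and $\|F\|_1=\int|F(x,y)|\,dx\,dy$. For graphons $U,W$: $d_\square(U,W)=\|U-W\|_\square$ and $d_1(U,W)=\|U-W\|_1$. Let $\mathcal{S}=(s_i)_{i\in\mathbb{N}}$ be a (straightforward) computable enumeration of the graphons that are constant with a rational value on each product $p\times q$ of parts $p,q$ of a partition of $[0,1]$ into finitely many equally-sized intervals. For $d\in\{d_1,d_\square\}$, a $d$-name of a graphon $U$ is a sequence $(s_{k_j})_{j\in\mathbb{N}}$ of elements of $\mathcal{S}$ with $d(s_{k_j},s_{k_\ell})\le2^{ -j}$ for all $j<\ell$ and $d(s_{k_j},U)\to0$; it is computable if the sequence $(k_j)_j$ of natural numbers is computable. -}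

module Defs where

open import Axiom.ExcludedMiddle using (ExcludedMiddle)
open import Data.Bool.Base using (if_then_else_)
open import Data.Fin.Base using (Fin; toℕ)
open import Data.Integer.Base using (+_)
open import Data.List.Base using (List; []; _∷_; map; foldr; applyUpTo)
open import Data.List.Relation.Unary.Any using (Any)
open import Data.Nat.Base as ℕ using (ℕ; NonZero)
import Data.Nat.Properties as ℕₚ
open import Data.Product.Base using (∃-syntax; Σ-syntax; _×_; _,_; proj₁)
open import Data.Rational.Base hiding (NonZero; _≃_)
open import Data.Rational.Properties
  using (*-zeroʳ; *-monoʳ-<-pos; *-distribʳ-+; *-identityˡ; +-monoˡ-≤; +-mono-≤; +-inverseʳ;
         ∣p+q∣≤∣p∣+∣q∣; ∣p∣≡p∨∣p∣≡-p; ∣-p∣≡∣p∣; <⇒≤; ≤-trans; module ≤-Reasoning)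
open import Data.Rational.Solver using (module +-*-Solver)
open import Data.Sum.Base using (_⊎_; inj₁; inj₂)
open import Data.Vec.Base as Vec using (Vec; []; _∷_; head)
open import Data.Vec.Relation.Binary.Pointwise.Inductive using (Pointwise; []; _∷_)
open import Level using (Level; 0ℓ)
open import Relation.Binary.PropositionalEquality using (_≡_; refl; sym; trans; cong; subst)
open import Relation.Nullary using (¬_; does)
open import Relation.Unary using (Pred; _∈_; _∪_; _∩_; ∁)
open import Relation.Binary.Definitions using (_Respects_)

-- Codes of partial recursive functions on ℕ.
data Rec : ℕ → Set where
  zeroʳ : Rec 0
  sucʳ  : Rec 1
  projʳ : ∀ {n} → Fin n → Rec n
  compʳ : ∀ {m n} → Rec m → Vec (Rec n) m → Rec n
  precʳ : ∀ {n} → Rec n → Rec (2 ℕ.+ n) → Rec (1 ℕ.+ n)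
  μʳ    : ∀ {n} → Rec (1 ℕ.+ n) → Rec n

mutual

  data _[_]⇓_ : ∀ {n} → Rec n → Vec ℕ n → ℕ → Set where
    ⇓zero  : zeroʳ [ [] ]⇓ 0
    ⇓suc   : ∀ {x} → sucʳ [ x ∷ [] ]⇓ ℕ.suc x
    ⇓proj  : ∀ {n} {xs : Vec ℕ n} i → projʳ i [ xs ]⇓ Vec.lookup xs i
    ⇓comp  : ∀ {m n f xs ys z} {gs : Vec (Rec n) m} →
             gs [ xs ]⇓* ys → f [ ys ]⇓ z → compʳ f gs [ xs ]⇓ z
    ⇓prec₀ : ∀ {n xs z} {f : Rec n} {g} →
             f [ xs ]⇓ z → precʳ f g [ 0 ∷ xs ]⇓ z
    ⇓precₛ : ∀ {n xs k y z} {f : Rec n} {g} →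
             precʳ f g [ k ∷ xs ]⇓ y → g [ k ∷ y ∷ xs ]⇓ z →
             precʳ f g [ ℕ.suc k ∷ xs ]⇓ z
    ⇓μ     : ∀ {n xs k} {f : Rec (1 ℕ.+ n)} →
             f [ k ∷ xs ]⇓ 0 →
             (∀ i → i ℕ.< k → ∃[ y ] f [ i ∷ xs ]⇓ ℕ.suc y) →
             μʳ f [ xs ]⇓ k

  data _[_]⇓*_ {n} : ∀ {m} → Vec (Rec n) m → Vec ℕ n → Vec ℕ m → Set where
    []  : ∀ {xs} → [] [ xs ]⇓* []
    _∷_ : ∀ {m xs y ys} {g : Rec n} {gs : Vec (Rec n) m} →
          g [ xs ]⇓ y → gs [ xs ]⇓* ys → (g ∷ gs) [ xs ]⇓* (y ∷ ys)

Computable : ∀ {n} → (Vec ℕ n → ℕ) → Set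
Computable {n} f = Σ[ c ∈ Rec n ] (∀ xs → c [ xs ]⇓ f xs)

ComputableSeq : (ℕ → ℕ) → Set
ComputableSeq k = Computable {1} (λ xs → k (head xs))

-- Cauchy sequences of rationals; equality of reals is _≃ᵣ_ below.
record ℝ : Set where
  field
    seq    : ℕ → ℚ
    cauchy : ∀ ε → 0ℚ < ε →
             ∃[ N ] (∀ m n → N ℕ.≤ m → N ℕ.≤ n → ∣ seq m - seq n ∣ ≤ ε)
open ℝ public

infix 4 _≃ᵣ_ _≤ᵣ_ _<ᵣ_
infixl 6 _+ᵣ_ _-ᵣ_

_≃ᵣ_ : ℝ → ℝ → Set
x ≃ᵣ y = ∀ ε → 0ℚ < ε → ∃[ N ] (∀ n → N ℕ.≤ n → ∣ seq x n - seq y n ∣ ≤ ε)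

_≤ᵣ_ : ℝ → ℝ → Set
x ≤ᵣ y = ∀ ε → 0ℚ < ε → ∃[ N ] (∀ n → N ℕ.≤ n → seq x n ≤ seq y n + ε)

_<ᵣ_ : ℝ → ℝ → Set
x <ᵣ y = ∃[ ε ] 0ℚ < ε × ∃[ N ] (∀ n → N ℕ.≤ n → seq x n + ε ≤ seq y n)

private

  half-pos : ∀ {ε} → 0ℚ < ε → 0ℚ < ½ * ε
  half-pos {ε} 0<ε = subst (_< ½ * ε) (*-zeroʳ ½) (*-monoʳ-<-pos ½ 0<ε)

  half-sum : ∀ ε → ½ * ε + ½ * ε ≡ ε
  half-sum ε = trans (sym (*-distribʳ-+ ε ½ ½)) (*-identityˡ ε)

  +-interchange : ∀ a b c d → (a + b) - (c + d) ≡ (a - c) + (b - d)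
  +-interchange = solve 4 (λ a b c d →
    (a :+ b) :- (c :+ d) := (a :- c) :+ (b :- d)) refl
    where open +-*-Solver

  neg-difference : ∀ a b → (- a) - (- b) ≡ - (a - b)
  neg-difference = solve 2 (λ a b → (:- a) :- (:- b) := :- (a :- b)) refl
    where open +-*-Solver

  cancel-plus : ∀ a b → (a - b) + b ≡ a
  cancel-plus = solve 2 (λ a b → (a :- b) :+ b := a) refl
    where open +-*-Solver

  cancel-minus : ∀ a b → (a + b) - b ≡ a
  cancel-minus = solve 2 (λ a b → (a :+ b) :- b := a) refl
    where open +-*-Solver

  swap-minus : ∀ a b → b - a ≡ - (a - b)
  swap-minus = solve 2 (λ a b → b :- a := :- (a :- b)) refl
    where open +-*-Solver

  ∣∣-difference : ∀ a b → ∣ a ∣ - ∣ b ∣ ≤ ∣ a - b ∣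
  ∣∣-difference a b = begin
    ∣ a ∣ - ∣ b ∣                  ≡⟨ cong (λ c → ∣ c ∣ - ∣ b ∣) (sym (cancel-plus a b)) ⟩
    ∣ (a - b) + b ∣ - ∣ b ∣        ≤⟨ +-monoˡ-≤ (- ∣ b ∣) (∣p+q∣≤∣p∣+∣q∣ (a - b) b) ⟩
    (∣ a - b ∣ + ∣ b ∣) - ∣ b ∣    ≡⟨ cancel-minus ∣ a - b ∣ ∣ b ∣ ⟩
    ∣ a - b ∣                      ∎
    where open ≤-Reasoning

  reverse-triangle : ∀ a b → ∣ ∣ a ∣ - ∣ b ∣ ∣ ≤ ∣ a - b ∣
  reverse-triangle a b with ∣p∣≡p∨∣p∣≡-p (∣ a ∣ - ∣ b ∣)
  ... | inj₁ eq = subst (_≤ ∣ a - b ∣) (sym eq) (∣∣-difference a b)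
  ... | inj₂ eq = begin
    ∣ ∣ a ∣ - ∣ b ∣ ∣  ≡⟨ eq ⟩
    - (∣ a ∣ - ∣ b ∣)  ≡⟨ sym (swap-minus ∣ a ∣ ∣ b ∣) ⟩
    ∣ b ∣ - ∣ a ∣      ≤⟨ ∣∣-difference b a ⟩
    ∣ b - a ∣          ≡⟨ cong ∣_∣ (swap-minus a b) ⟩
    ∣ - (a - b) ∣      ≡⟨ ∣-p∣≡∣p∣ (a - b) ⟩
    ∣ a - b ∣          ∎
    where open ≤-Reasoning

fromℚ : ℚ → ℝ
fromℚ q .seq    _       = q
fromℚ q .cauchy ε 0<ε = 0 , λ _ _ _ _ →
  subst (λ r → ∣ r ∣ ≤ ε) (sym (+-inverseʳ q)) (<⇒≤ 0<ε)

_+ᵣ_ : ℝ → ℝ → ℝ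
(x +ᵣ y) .seq n = seq x n + seq y n
(x +ᵣ y) .cauchy ε 0<ε
  with M , p ← cauchy x (½ * ε) (half-pos 0<ε)
     | N , q ← cauchy y (½ * ε) (half-pos 0<ε) = M ℕ.⊔ N , λ m n m≥ n≥ → begin
  ∣ (seq x m + seq y m) - (seq x n + seq y n) ∣
    ≡⟨ cong ∣_∣ (+-interchange (seq x m) (seq y m) (seq x n) (seq y n)) ⟩
  ∣ (seq x m - seq x n) + (seq y m - seq y n) ∣
    ≤⟨ ∣p+q∣≤∣p∣+∣q∣ (seq x m - seq x n) (seq y m - seq y n) ⟩
  ∣ seq x m - seq x n ∣ + ∣ seq y m - seq y n ∣
    ≤⟨ +-mono-≤ (p m n (ℕₚ.m⊔n≤o⇒m≤o M N m≥) (ℕₚ.m⊔n≤o⇒m≤o M N n≥))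
                (q m n (ℕₚ.m⊔n≤o⇒n≤o M N m≥) (ℕₚ.m⊔n≤o⇒n≤o M N n≥)) ⟩
  ½ * ε + ½ * ε
    ≡⟨ half-sum ε ⟩
  ε ∎
  where open ≤-Reasoning

-ᵣ_ : ℝ → ℝ
(-ᵣ x) .seq n = - seq x n
(-ᵣ x) .cauchy ε 0<ε with N , p ← cauchy x ε 0<ε = N , λ m n m≥ n≥ →
  subst (_≤ ε)
    (sym (trans (cong ∣_∣ (neg-difference (seq x m) (seq x n)))
                (∣-p∣≡∣p∣ (seq x m - seq x n))))
    (p m n m≥ n≥)

_-ᵣ_ : ℝ → ℝ → ℝ
x -ᵣ y = x +ᵣ (-ᵣ y)

∣_∣ᵣ : ℝ → ℝ
∣ x ∣ᵣ .seq n = ∣ seq x n ∣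
∣ x ∣ᵣ .cauchy ε 0<ε with N , p ← cauchy x ε 0<ε = N , λ m n m≥ n≥ →
  ≤-trans (reverse-triangle (seq x m) (seq x n)) (p m n m≥ n≥)

record I : Set where
  field
    real   : ℝ
    0≤real : fromℚ 0ℚ ≤ᵣ real
    real≤1 : real ≤ᵣ fromℚ 1ℚ
open I public

infix 4 _≃ᴵ_

_≃ᴵ_ : I → I → Set
x ≃ᴵ y = real x ≃ᵣ real y

record Interval : Set where
  field
    lo hi : ℚ
    0≤lo  : 0ℚ ≤ lo
    lo≤hi : lo ≤ hi
    hi≤1  : hi ≤ 1ℚ
open Interval public

Cube : ℕ → Set
Cube n = Vec I n

Box : ℕ → Set
Box n = Vec Interval n

_∈ᴮ_ : ∀ {n} → Cube n → Box n → Set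
x ∈ᴮ B = Pointwise (λ t J → fromℚ (lo J) ≤ᵣ real t × real t ≤ᵣ fromℚ (hi J)) x B

vol : ∀ {n} → Box n → ℚ
vol = Vec.foldr _ (λ J v → (hi J - lo J) * v) 1ℚ

sumℚ : List ℚ → ℚ
sumℚ = foldr _+_ 0ℚ

-- Some sequence of boxes of total volume at most q covers A.  The outer
-- measure of A is the infimum of these q; rational boxes suffice for it.
OuterMeasure≤ : ∀ {n} → Pred (Cube n) 0ℓ → ℚ → Set
OuterMeasure≤ {n} A q = Σ[ B ∈ (ℕ → Box n) ]
  (∀ x → x ∈ A → ∃[ k ] x ∈ᴮ B k) ×
  (∀ K → sumℚ (map vol (applyUpTo B K)) ≤ q)

Null : ∀ {n} → Pred (Cube n) 0ℓ → Set
Null A = ∀ ε → 0ℚ < ε → OuterMeasure≤ A ε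

infix 7 _△_

_△_ : ∀ {n} → Pred (Cube n) 0ℓ → Pred (Cube n) 0ℓ → Pred (Cube n) 0ℓ
A △ B = (A ∩ ∁ B) ∪ (B ∩ ∁ A)

Elementary : ∀ {n} → List (Box n) → Pred (Cube n) 0ℓ
Elementary Bs x = Any (x ∈ᴮ_) Bs

-- Lebesgue measurability in the form of Kolmogorov and Fomin: A can be
-- approximated in outer measure by finite unions of boxes.
Measurable : ∀ {n} → Pred (Cube n) 0ℓ → Set
Measurable {n} A = ∀ ε → 0ℚ < ε →
  Σ[ Bs ∈ List (Box n) ] OuterMeasure≤ (A △ Elementary Bs) ε

MeasurableFunction : ∀ {n} → (Cube n → ℝ) → Set
MeasurableFunction f = ∀ c → Measurable (λ x → f x <ᵣ c)

onSquare : (I → I → ℝ) → Cube 2 → ℝ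
onSquare F (x ∷ y ∷ []) = F x y

record Graphon : Set where
  field
    fun        : I → I → I
    fun-cong   : ∀ {x x′ y y′} → x ≃ᴵ x′ → y ≃ᴵ y′ → fun x y ≃ᴵ fun x′ y′
    symmetric  : ∀ x y → fun x y ≃ᴵ fun y x
    measurable : MeasurableFunction (onSquare (λ x y → real (fun x y)))
open Graphon public

value : Graphon → I → I → ℝ
value U x y = real (fun U x y)

difference : Graphon → Graphon → I → I → ℝ
difference U W x y = value U x y -ᵣ value W x y

RandomFree : Graphon → Set
RandomFree U = Null {2} λ { (x ∷ y ∷ []) →
  ¬ (value U x y ≃ᵣ fromℚ 0ℚ ⊎ value U x y ≃ᵣ fromℚ 1ℚ) }

-- The p-th of the N parts: [p/N , (p+1)/N), with 1 added to the last one.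
InPart : (N : ℕ) .{{_ : NonZero N}} → Fin N → I → Set
InPart N p x =
  fromℚ (+ toℕ p / N) ≤ᵣ real x ×
  (real x <ᵣ fromℚ (+ ℕ.suc (toℕ p) / N) ⊎ ℕ.suc (toℕ p) ≡ N)

StepValues : (N : ℕ) .{{_ : NonZero N}} → (Fin N → Fin N → ℚ) → Graphon → Set
StepValues N v W = ∀ p q x y → InPart N p x → InPart N q y →
  value W x y ≃ᵣ fromℚ (v p q)

-- Computability means that the number of parts of the i-th graphon, and
-- numerators and denominators of its values, are computable from i.
-- Every admissible value matrix is realised by some index, but the
-- enumeration may present that graphon by a different partition.
record StepEnumeration : Set where
  field
    graphon   : ℕ → Graphon
    parts     : ℕ → ℕ
    {{parts≢0}} : ∀ {i} → NonZero (parts i)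
    num den-1 : Vec ℕ 3 → ℕ

  matrix : ∀ i → Fin (parts i) → Fin (parts i) → ℚ
  matrix i p q =
    + num (i ∷ toℕ p ∷ toℕ q ∷ []) / ℕ.suc (den-1 (i ∷ toℕ p ∷ toℕ q ∷ []))

  field
    isStep           : ∀ i → StepValues (parts i) (matrix i) (graphon i)
    computable-parts : ComputableSeq parts
    computable-num   : Computable num
    computable-den-1 : Computable den-1
    complete : ∀ N .{{_ : NonZero N}} (v : Fin N → Fin N → ℚ) →
               (∀ p q → v p q ≡ v q p) →
               (∀ p q → 0ℚ ≤ v p q × v p q ≤ 1ℚ) →
               ∃[ i ] StepValues N v (graphon i)

-- A metric d is represented by the relation "d U W ≤ q".
Distance≤ : (ℓ : Level) → Set (Level.suc ℓ)
Distance≤ ℓ = Graphon → Graphon → ℚ → Set ℓ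

2⁻^_ : ℕ → ℚ
2⁻^ ℕ.zero  = 1ℚ
2⁻^ ℕ.suc j = ½ * 2⁻^ j

module _ (𝒮 : StepEnumeration) where
  open StepEnumeration 𝒮 renaming (graphon to s)

  IsName : ∀ {ℓ} → Distance≤ ℓ → Graphon → (ℕ → ℕ) → Set ℓ
  IsName d U k =
    (∀ j l → j ℕ.< l → d (s (k j)) (s (k l)) (2⁻^ j)) ×
    (∀ ε → 0ℚ < ε → ∃[ J ] (∀ j → J ℕ.≤ j → d (s (k j)) U ε))

  ComputableIn : ∀ {ℓ} → Distance≤ ℓ → Graphon → Set ℓ
  ComputableIn d U = ∃[ k ] ComputableSeq k × IsName d U k

-- Excluded middle makes the indicator of an arbitrary set a function.
module Integration (em : ExcludedMiddle 0ℓ) where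

  -- A list of pairs (c , B) stands for the step function ∑ c · 1_B.
  Step : ℕ → Set
  Step n = List (ℚ × Box n)

  eval : ∀ {n} → Step n → Cube n → ℚ
  eval s x = sumℚ (map (λ (c , B) → if does (em {x ∈ᴮ B}) then c else 0ℚ) s)

  ∫step : ∀ {n} → Step n → ℚ
  ∫step s = sumℚ (map (λ (c , B) → c * vol B) s)

  -- ∣ g ∣ is bounded pointwise by a series ∑ c · 1_B with c ≥ 0 and
  -- ∑ c · vol B ≤ q.  The upper integral of ∣ g ∣ is the infimum of these q.
  UpperIntegral∣_∣≤_ : ∀ {n} → (Cube n → ℝ) → ℚ → Set
  UpperIntegral∣_∣≤_ {n} g q = Σ[ h ∈ (ℕ → ℚ × Box n) ]
    (∀ k → 0ℚ ≤ proj₁ (h k)) ×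
    (∀ x ε → 0ℚ < ε →
       ∃[ K ] ∣ g x ∣ᵣ ≤ᵣ fromℚ (eval (applyUpTo h K) x + ε)) ×
    (∀ K → ∫step (applyUpTo h K) ≤ q)

  -- f is Lebesgue integrable with ∫ f = r (Daniell–Stone): step functions
  -- approximate f in the upper integral and their integrals approximate r.
  ∫_≈_ : ∀ {n} → (Cube n → ℝ) → ℝ → Set
  ∫_≈_ {n} f r = ∀ ε → 0ℚ < ε → Σ[ s ∈ Step n ]
    (UpperIntegral∣ (λ x → f x -ᵣ fromℚ (eval s x)) ∣≤ ε) ×
    (∣ r -ᵣ fromℚ (∫step s) ∣ᵣ ≤ᵣ fromℚ ε)

  restrict : ∀ {n} → Pred (Cube n) 0ℓ → (Cube n → ℝ) → Cube n → ℝ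
  restrict A f x = if does (em {x ∈ A}) then f x else fromℚ 0ℚ

  Rectangle : Pred I 0ℓ → Pred I 0ℓ → Pred (Cube 2) 0ℓ
  Rectangle S T (x ∷ y ∷ []) = x ∈ S × y ∈ T

  record MeasurableSubset (S : Pred I 0ℓ) : Set where
    field
      respects     : S Respects _≃ᴵ_
      isMeasurable : Measurable {1} (λ x → head x ∈ S)

  ‖_‖₁≤_ : (I → I → ℝ) → ℚ → Set
  ‖ F ‖₁≤ q = ∃[ r ] (∫ (λ x → ∣ onSquare F x ∣ᵣ) ≈ r) × r ≤ᵣ fromℚ q

  -- "sup ≤ q" says that q bounds every member of the family.
  ‖_‖□≤_ : (I → I → ℝ) → ℚ → Set₁
  ‖ F ‖□≤ q = ∀ S T → MeasurableSubset S → MeasurableSubset T →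
    ∃[ r ] (∫ restrict (Rectangle S T) (onSquare F) ≈ r) × ∣ r ∣ᵣ ≤ᵣ fromℚ q

  d₁≤ : Distance≤ 0ℓ
  d₁≤ U W q = ‖ difference U W ‖₁≤ q

  d□≤ : Distance≤ (Level.suc 0ℓ)
  d□≤ U W q = ‖ difference U W ‖□≤ q

{-# OPTIONS --safe #-}

-- Let s₀, s₁, … be the given d□-name of U, let W = sⱼ have N parts and V = sₗ.
-- Since U is {0,1}-valued, ∣ W - U ∣ = W + U - 2WU almost everywhere, which is
-- linear in U with coefficients constant on the N² cells of W.  Hence ‖ W - U ‖₁
-- differs by at most N² · 2⁻ˡ from D = ∫ W + V - 2WV, a rational number that is
-- computable from j and l.  With l = j + 2N the error is at most 2⁻ʲ, so one may
-- search for a j with D + 2⁻ʲ ≤ 2⁻ⁿ.  The search ends because ‖ sⱼ - U ‖₁ → 0: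
-- also ∣ V - U ∣ = (1 - 2U)(V - U), where U may be replaced by an L¹-close step
-- function, and integrals of V - U over boxes are bounded by ‖ V - U ‖□.
-- That integrals of step functions are consistent with upper integrals is a
-- compactness argument, carried out in one dimension and lifted by slicing.

module Submission where

open import Defs
open import Axiom.ExcludedMiddle using (ExcludedMiddle)
open import Level using (0ℓ)
open import Data.Bool.Base using (if_then_else_)
open import Data.Fin.Base as Fin using (Fin; fromℕ<)
open import Data.Fin.Patterns using (0F; 1F; 2F)
open import Data.Fin.Properties using (toℕ-fromℕ<)
import Data.Integer.Base as ℤ
import Data.Integer.Properties as ℤₚ
open import Data.List.Base using ([]; _∷_; _++_; map; length; applyUpTo)
open import Data.List.Relation.Unary.Any using (here)
open import Data.Nat.Base as ℕ using (ℕ; NonZero)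
import Data.Nat.DivMod as ℕ
import Data.Nat.Properties as ℕₚ
open import Data.Product.Base using (∃-syntax; Σ-syntax; _×_; _,_; proj₁; proj₂)
open import Data.Rational.Base renaming (NonZero to NonZeroℚ) hiding (_≃_)
open import Data.Rational.Properties
import Data.Rational.Unnormalised.Base as ℚᵘ
import Data.Rational.Unnormalised.Properties as ℚᵘₚ
open import Data.Sum.Base using (_⊎_; inj₁; inj₂)
open import Data.Vec.Base as Vec using (Vec; []; _∷_; head; tail; lookup)
open import Data.Vec.Properties using (tabulate∘lookup)
open import Data.Vec.Relation.Binary.Pointwise.Inductive using ([]; _∷_)
open import Function.Base using (_∘_)
open import Relation.Binary.Definitions using (tri<; tri≈; tri>)
open import Relation.Binary.PropositionalEquality hiding (J)
open import Relation.Nullary using (yes; no; ¬_; contradiction; Dec; does)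
open import Relation.Nullary.Decidable using (dec⇒maybe; decidable-stable; toWitness)
open import Relation.Unary using (Pred; _∈_)
open import Tactic.RingSolver using (solve-∀)
open import Tactic.RingSolver.Core.AlmostCommutativeRing using (AlmostCommutativeRing; fromCommutativeRing)

-- Rational arithmetic and finite sums

-- The two identities for {0,1}-valued U differ in strength. The proof that ‖ sⱼ - U ‖₁ → 0 yields
-- no rate: the L¹-close step function comes without control over its coefficients, and these
-- multiply the box integrals of sⱼ - U. Hence the search: convergence guarantees that some j
-- passes, while the test is effective, because the linear formula sees U only through N² box
-- integrals whose size the name controls. The exponent l = j + 2N comes from N ≤ 2^N, so that N² ·
-- 2^(-2N) ≤ 1. A real is a Cauchy sequence, and U equals 0 or 1 only in the limit. The identities
-- for ∣ V - U ∣ and ∣ W - U ∣ are therefore proved with explicit errors for rationals near 0 or 1,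
-- and crude bounds serve on the exceptional null set. A bound on the cut distance includes the
-- existence of integrals over rectangles; all integrability of U is drawn from there. Comparing D
-- with ‖ sⱼ - U ‖₁ involves different approximating step functions, which is why consistency of
-- integrals is needed.

ringℚ : AlmostCommutativeRing 0ℓ 0ℓ
ringℚ = fromCommutativeRing +-*-commutativeRing (λ x → dec⇒maybe (0ℚ ≟ x))

-- Linear arithmetic: x ≤ y is a sum of hypotheses, and the equation is left to
-- the ring solver.
lin : ∀ {a b x y} → x ≤ y → b - a ≡ y - x → a ≤ b
lin {a} {b} {x} {y} h e = begin
  a            ≡⟨ ring₁ a x ⟩
  (a - x) + x  ≤⟨ +-monoʳ-≤ (a - x) h ⟩
  (a - x) + y  ≡⟨ ring₂ a x y ⟩
  a + (y - x)  ≡⟨ cong (a +_) (sym e) ⟩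
  a + (b - a)  ≡⟨ ring₃ a b ⟩
  b            ∎
  where
  open ≤-Reasoning
  ring₁ : ∀ a x → a ≡ (a - x) + x
  ring₁ = solve-∀ ringℚ
  ring₂ : ∀ a x y → (a - x) + y ≡ a + (y - x)
  ring₂ = solve-∀ ringℚ
  ring₃ : ∀ a b → a + (b - a) ≡ b
  ring₃ = solve-∀ ringℚ

infixl 6 _⊕_
_⊕_ : ∀ {a b x y} → a ≤ b → x ≤ y → a + x ≤ b + y
_⊕_ = +-mono-≤

*-mono : ∀ {c a b} → 0ℚ ≤ c → a ≤ b → c * a ≤ c * b
*-mono {c} 0≤c = *-monoˡ-≤-nonNeg c {{nonNegative 0≤c}}

*-nonneg : ∀ {a b} → 0ℚ ≤ a → 0ℚ ≤ b → 0ℚ ≤ a * b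
*-nonneg {a} {b} 0≤a 0≤b = ≤-trans (≤-reflexive (sym (*-zeroʳ a))) (*-mono 0≤a 0≤b)

+-nonneg : ∀ {a b} → 0ℚ ≤ a → 0ℚ ≤ b → 0ℚ ≤ a + b
+-nonneg 0≤a 0≤b = ≤-trans (≤-reflexive (sym (+-identityˡ 0ℚ))) (0≤a ⊕ 0≤b)

*-positive : ∀ {a b} → 0ℚ < a → 0ℚ < b → 0ℚ < a * b
*-positive {a} {b} 0<a 0<b =
  positive⁻¹ (a * b) {{pos*pos⇒pos a {{positive 0<a}} b {{positive 0<b}}}}

*-cancel : ∀ {c a b} → 0ℚ < c → c * a ≤ c * b → a ≤ b
*-cancel {c} 0<c = *-cancelˡ-≤-pos c {{positive 0<c}}

½-positive : ∀ {ε} → 0ℚ < ε → 0ℚ < ½ * ε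
½-positive = *-positive (positive⁻¹ ½)

0≤1 : 0ℚ ≤ 1ℚ
0≤1 = nonNegative⁻¹ 1ℚ

infixr 7 _⊛_
_⊛_ : ∀ c .{{_ : NonNegative c}} {x y} → x ≤ y → c * x ≤ c * y
c ⊛ h = *-monoˡ-≤-nonNeg c h

∣∣-bound : ∀ {a b} → a ≤ b → - a ≤ b → ∣ a ∣ ≤ b
∣∣-bound {a} a≤b -a≤b with ∣p∣≡p∨∣p∣≡-p a
... | inj₁ e = ≤-trans (≤-reflexive e) a≤b
... | inj₂ e = ≤-trans (≤-reflexive e) -a≤b

a≤∣a∣ : ∀ a → a ≤ ∣ a ∣
a≤∣a∣ a with ≤-total 0ℚ a
... | inj₁ 0≤a = ≤-reflexive (sym (0≤p⇒∣p∣≡p 0≤a))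
... | inj₂ a≤0 = ≤-trans a≤0 (0≤∣p∣ a)

-a≤∣a∣ : ∀ a → - a ≤ ∣ a ∣
-a≤∣a∣ a = ≤-trans (a≤∣a∣ (- a)) (≤-reflexive (∣-p∣≡∣p∣ a))

∣a-b∣≡∣b-a∣ : ∀ a b → ∣ a - b ∣ ≡ ∣ b - a ∣
∣a-b∣≡∣b-a∣ a b = trans (cong ∣_∣ {a - b} { - (b - a)} (ring a b)) (∣-p∣≡∣p∣ (b - a))
  where
  ring : ∀ a b → a - b ≡ - (b - a)
  ring = solve-∀ ringℚ

<⇒0<- : ∀ {a b} → a < b → 0ℚ < b - a
<⇒0<- {a} {b} a<b = <-respˡ-≡ (+-inverseʳ a) (+-monoˡ-< (- a) a<b)

≤-closure : ∀ {a b} → (∀ ε → 0ℚ < ε → a ≤ b + ε) → a ≤ b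
≤-closure {a} {b} h with ≤-total a b
... | inj₁ a≤b = a≤b
... | inj₂ b≤a with a ≟ b
...   | yes e = ≤-reflexive e
-- With ε half of `a - b`, twice the hypothesis reads `2a ≤ 2b + (a - b)`, which is already `a ≤ b`.
...   | no a≢b = lin (½-doubled ⊕ ½-doubled) (ring a b)
  where
  ring : ∀ a b → b - a ≡ ((b + ½ * (a - b)) + (b + ½ * (a - b))) - (a + a)
  ring = solve-∀ ringℚ
  0<d : 0ℚ < a - b
  0<d with <-cmp b a
  ... | tri< b<a _ _ = <⇒0<- b<a
  ... | tri≈ _ e _ = contradiction (sym e) a≢b
  ... | tri> _ _ a<b = contradiction (≤-antisym (<⇒≤ a<b) b≤a) a≢b
  ½-doubled : a ≤ b + ½ * (a - b)
  ½-doubled = h (½ * (a - b)) (½-positive 0<d)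

private
  toℚᵘ-/ : ∀ i n .{{_ : NonZero n}} → toℚᵘ (i / n) ℚᵘ.≃ (i ℚᵘ./ n)
  toℚᵘ-/ i (ℕ.suc n) = toℚᵘ-fromℚᵘ (ℚᵘ.mkℚᵘ i n)

infix 8 ι_

opaque
  -- Opaque, so that rational expressions stay symbolic and are handled through the laws of this
  -- block alone.
  ι_ : ℕ → ℚ
  ι n = ℤ.+ n / 1

  ι-+ : ∀ m n → ι (m ℕ.+ n) ≡ ι m + ι n
  ι-+ m n = toℚᵘ-injective (begin
    toℚᵘ (ι (m ℕ.+ n))             ≈⟨ toℚᵘ-/ _ 1 ⟩
    ℤ.+ (m ℕ.+ n) ℚᵘ./ 1             ≈⟨ ℚᵘ.*≡* (cong (ℤ._* ℤ.+ 1) (cong₂ ℤ._+_ (sym (ℤₚ.*-identityʳ (ℤ.+ m))) (sym (ℤₚ.*-identityʳ (ℤ.+ n))))) ⟩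
    (ℤ.+ m ℚᵘ./ 1) ℚᵘ.+ (ℤ.+ n ℚᵘ./ 1) ≈⟨ ℚᵘₚ.+-cong (toℚᵘ-/ (ℤ.+ m) 1) (toℚᵘ-/ (ℤ.+ n) 1) ⟨
    toℚᵘ (ι m) ℚᵘ.+ toℚᵘ (ι n)     ≈⟨ toℚᵘ-homo-+ (ι m) (ι n) ⟨
    toℚᵘ (ι m + ι n) ∎)
    where open ℚᵘₚ.≃-Reasoning

  ι-* : ∀ m n → ι (m ℕ.* n) ≡ ι m * ι n
  ι-* m n = toℚᵘ-injective (begin
    toℚᵘ (ι (m ℕ.* n))             ≈⟨ toℚᵘ-/ _ 1 ⟩
    ℤ.+ (m ℕ.* n) ℚᵘ./ 1             ≈⟨ ℚᵘ.*≡* (cong (ℤ._* ℤ.+ 1) (ℤₚ.pos-* m n)) ⟩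
    (ℤ.+ m ℚᵘ./ 1) ℚᵘ.* (ℤ.+ n ℚᵘ./ 1) ≈⟨ ℚᵘₚ.*-cong (toℚᵘ-/ (ℤ.+ m) 1) (toℚᵘ-/ (ℤ.+ n) 1) ⟨
    toℚᵘ (ι m) ℚᵘ.* toℚᵘ (ι n)     ≈⟨ toℚᵘ-homo-* (ι m) (ι n) ⟨
    toℚᵘ (ι m * ι n) ∎)
    where open ℚᵘₚ.≃-Reasoning

  -- Fractions are used only through this cross-multiplied equation, which avoids lowest terms.
  /-ι : ∀ m n .{{_ : NonZero n}} → (ℤ.+ m / n) * ι n ≡ ι m
  /-ι m (ℕ.suc n) = toℚᵘ-injective (begin
    toℚᵘ ((ℤ.+ m / ℕ.suc n) * ι (ℕ.suc n))          ≈⟨ toℚᵘ-homo-* (ℤ.+ m / ℕ.suc n) (ι (ℕ.suc n)) ⟩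
    toℚᵘ (ℤ.+ m / ℕ.suc n) ℚᵘ.* toℚᵘ (ι (ℕ.suc n))  ≈⟨ ℚᵘₚ.*-cong (toℚᵘ-/ (ℤ.+ m) (ℕ.suc n)) (toℚᵘ-/ (ℤ.+ ℕ.suc n) 1) ⟩
    (ℤ.+ m ℚᵘ./ ℕ.suc n) ℚᵘ.* (ℤ.+ ℕ.suc n ℚᵘ./ 1)    ≈⟨ ℚᵘ.*≡* (ℤₚ.*-assoc (ℤ.+ m) (ℤ.+ ℕ.suc n) (ℤ.+ 1)) ⟩
    ℤ.+ m ℚᵘ./ 1                                    ≈⟨ toℚᵘ-/ _ 1 ⟨
    toℚᵘ (ι m) ∎)
    where open ℚᵘₚ.≃-Reasoning

  ι-mono : ∀ {m n} → m ℕ.≤ n → ι m ≤ ι n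
  ι-mono {m} {n} m≤n = subst (λ k → ι m ≤ ι k) (ℕₚ.m+[n∸m]≡n m≤n)
    (lin {x = 0ℚ} {y = d} (nonNegative⁻¹ d {{normalize-nonNeg (n ℕ.∸ m) 1}})
      (trans (cong (_- ι m) (ι-+ m (n ℕ.∸ m))) (ring (ι m) d)))
    where
    d : ℚ
    d = ι (n ℕ.∸ m)
    ring : ∀ a b → a + b - a ≡ b - 0ℚ
    ring = solve-∀ ringℚ

  ι-positive : ∀ n .{{_ : NonZero n}} → 0ℚ < ι n
  ι-positive (ℕ.suc n) = positive⁻¹ (ι (ℕ.suc n)) {{normalize-pos (ℕ.suc n) 1}}

  ι-0 : ι 0 ≡ 0ℚ
  ι-0 = refl

  ι-1 : ι 1 ≡ 1ℚ
  ι-1 = refl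

ι-suc : ∀ n → ι (ℕ.suc n) ≡ 1ℚ + ι n
ι-suc n = trans (ι-+ 1 n) (cong (_+ ι n) ι-1)

ι-cancel : ∀ {m n} → ι m ≤ ι n → m ℕ.≤ n
ι-cancel {m} {n} h with ℕₚ.≤-<-connex m n
... | inj₁ m≤n = m≤n
... | inj₂ n<m = contradiction (≤-trans (≤-trans (≤-reflexive (sym (ι-suc n))) (ι-mono n<m)) h)
                   (λ 1+n≤n → <-irrefl refl (<-≤-trans (positive⁻¹ 1ℚ) (lin {1ℚ} {0ℚ} 1+n≤n (ring (ι n)))))
  where
  ring : ∀ a → 0ℚ - 1ℚ ≡ a - (1ℚ + a)
  ring = solve-∀ ringℚ

0≤ι : ∀ n → 0ℚ ≤ ι n
0≤ι n = ≤-trans (≤-reflexive (sym ι-0)) (ι-mono ℕ.z≤n)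

2⁻-positive : ∀ n → 0ℚ < 2⁻^ n
2⁻-positive ℕ.zero    = positive⁻¹ 1ℚ
2⁻-positive (ℕ.suc n) = ½-positive (2⁻-positive n)

2⁻-antitone : ∀ {m n} → m ℕ.≤ n → 2⁻^ n ≤ 2⁻^ m
2⁻-antitone m≤n = go (ℕₚ.≤⇒≤′ m≤n)
  where
  go : ∀ {m n} → m ℕ.≤′ n → 2⁻^ n ≤ 2⁻^ m
  go ℕ.≤′-refl = ≤-refl
  go (ℕ.≤′-step {n} h) = ≤-trans (halve (2⁻^ n) (<⇒≤ (2⁻-positive n))) (go h)
    where
    halve : ∀ a → 0ℚ ≤ a → ½ * a ≤ a
    halve a 0≤a = lin (½ ⊛ 0≤a) (ring a)
      where
      ring : ∀ a → a - ½ * a ≡ ½ * a - ½ * 0ℚ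
      ring = solve-∀ ringℚ

2⁻-+ : ∀ m n → 2⁻^ (m ℕ.+ n) ≡ 2⁻^ m * 2⁻^ n
2⁻-+ ℕ.zero    n = sym (*-identityˡ _)
2⁻-+ (ℕ.suc m) n = trans (cong (½ *_) (2⁻-+ m n)) (sym (*-assoc ½ (2⁻^ m) (2⁻^ n)))

2⁻-2^ : ∀ n → 2⁻^ n * ι (2 ℕ.^ n) ≡ 1ℚ
2⁻-2^ ℕ.zero = trans (*-identityˡ (ι 1)) ι-1
2⁻-2^ (ℕ.suc n) = trans (cong ((½ * 2⁻^ n) *_) (ι-* 2 (2 ℕ.^ n)))
  (trans (trans (cong (λ z → (½ * 2⁻^ n) * (z * ι (2 ℕ.^ n))) ι-2) (ring (2⁻^ n) (ι (2 ℕ.^ n)))) (2⁻-2^ n))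
  where
  ι-2 : ι 2 ≡ 1ℚ + 1ℚ
  ι-2 = trans (ι-suc 1) (cong (1ℚ +_) ι-1)
  ring : ∀ a b → (½ * a) * ((1ℚ + 1ℚ) * b) ≡ a * b
  ring = solve-∀ ringℚ

n≤2^n : ∀ n → n ℕ.≤ 2 ℕ.^ n
n≤2^n ℕ.zero    = ℕ.z≤n
n≤2^n (ℕ.suc n) = ℕₚ.≤-trans (ℕₚ.+-mono-≤ {1} (ℕₚ.m^n>0 2 n) (n≤2^n n))
  (ℕₚ.≤-reflexive (cong (2 ℕ.^ n ℕ.+_) (sym (ℕₚ.+-identityʳ _))))

-- Applied twice, this absorbs the number N² of cells into 2^(-2N).
ι*2⁻≤1 : ∀ n → ι n * 2⁻^ n ≤ 1ℚ
ι*2⁻≤1 n = ≤-trans (≤-reflexive (*-comm (ι n) _))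
  (≤-trans (*-mono (<⇒≤ (2⁻-positive n)) (ι-mono (n≤2^n n))) (≤-reflexive (2⁻-2^ n)))

opaque
  -- The exponent is the denominator d of `ε`: a positive fraction with denominator d is at least
  -- 1/d, and d · 2^(-d) ≤ 1.
  archimedean : ∀ ε → 0ℚ < ε → ∃[ n ] 2⁻^ n ≤ ε
  archimedean ε 0<ε = ↧ₙ ε , *-cancel (ι-positive (↧ₙ ε)) (≤-trans (ι*2⁻≤1 (↧ₙ ε)) (1≤Dε ε (positive 0<ε)))
    where
      1≤Dε : ∀ q → Positive q → 1ℚ ≤ ι (↧ₙ q) * q
      1≤Dε q@(mkℚ (ℤ.+ ℕ.suc m) d _) _ = ≤-trans
        (≤-trans (≤-reflexive (sym ι-1)) (ι-mono {1} {ℕ.suc m} (ℕ.s≤s ℕ.z≤n)))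
        (≤-reflexive (trans (sym (/-ι (ℕ.suc m) (ℕ.suc d)))
          (trans (cong (_* ι (ℕ.suc d)) (↥p/↧p≡p q)) (*-comm q (ι (ℕ.suc d))))))

∑ : ℕ → (ℕ → ℚ) → ℚ
∑ ℕ.zero    f = 0ℚ
∑ (ℕ.suc n) f = f 0 + ∑ n (f ∘ ℕ.suc)

∑-cong : ∀ n {f g} → (∀ i → i ℕ.< n → f i ≡ g i) → ∑ n f ≡ ∑ n g
∑-cong ℕ.zero    h = refl
∑-cong (ℕ.suc n) h = cong₂ _+_ (h 0 (ℕ.s≤s ℕ.z≤n)) (∑-cong n (λ i i<n → h (ℕ.suc i) (ℕ.s≤s i<n)))

∑-mono : ∀ n {f g} → (∀ i → i ℕ.< n → f i ≤ g i) → ∑ n f ≤ ∑ n g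
∑-mono ℕ.zero    h = ≤-refl
∑-mono (ℕ.suc n) h = h 0 (ℕ.s≤s ℕ.z≤n) ⊕ ∑-mono n (λ i i<n → h (ℕ.suc i) (ℕ.s≤s i<n))

∑-+ : ∀ n f g → ∑ n (λ i → f i + g i) ≡ ∑ n f + ∑ n g
∑-+ ℕ.zero    f g = refl
∑-+ (ℕ.suc n) f g = trans (cong ((f 0 + g 0) +_) (∑-+ n (f ∘ ℕ.suc) (g ∘ ℕ.suc)))
  (ring (f 0) (g 0) (∑ n (f ∘ ℕ.suc)) (∑ n (g ∘ ℕ.suc)))
  where
  ring : ∀ a b c d → (a + b) + (c + d) ≡ (a + c) + (b + d)
  ring = solve-∀ ringℚ

∑-* : ∀ n c f → ∑ n (λ i → c * f i) ≡ c * ∑ n f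
∑-* ℕ.zero    c f = sym (*-zeroʳ c)
∑-* (ℕ.suc n) c f = trans (cong (c * f 0 +_) (∑-* n c (f ∘ ℕ.suc))) (sym (*-distribˡ-+ c (f 0) _))

∑-const : ∀ n c → ∑ n (λ _ → c) ≡ ι n * c
∑-const ℕ.zero    c = trans (sym (*-zeroˡ c)) (cong (_* c) (sym ι-0))
∑-const (ℕ.suc n) c = trans (cong (c +_) (∑-const n c))
  (trans (ring c (ι n)) (cong (_* c) (sym (ι-suc n))))
  where
  ring : ∀ c a → c + a * c ≡ (1ℚ + a) * c
  ring = solve-∀ ringℚ

∑-zero : ∀ n {f} → (∀ i → i ℕ.< n → f i ≡ 0ℚ) → ∑ n f ≡ 0ℚ
∑-zero n h = trans (∑-cong n h) (trans (∑-const n 0ℚ) (*-zeroʳ (ι n)))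

∑-nonneg : ∀ n {f} → (∀ i → i ℕ.< n → 0ℚ ≤ f i) → 0ℚ ≤ ∑ n f
∑-nonneg n h = ≤-trans (≤-reflexive (sym (∑-zero n (λ _ _ → refl)))) (∑-mono n h)

∑-extend : ∀ {m n} f → (∀ i → 0ℚ ≤ f i) → m ℕ.≤ n → ∑ m f ≤ ∑ n f
∑-extend {n = n} f 0≤f ℕ.z≤n       = ∑-nonneg n (λ i _ → 0≤f i)
∑-extend         f 0≤f (ℕ.s≤s m≤n) = ≤-refl {f 0} ⊕ ∑-extend (f ∘ ℕ.suc) (0≤f ∘ ℕ.suc) m≤n

∑-last : ∀ n f → ∑ (ℕ.suc n) f ≡ ∑ n f + f n
∑-last ℕ.zero    f = +-comm (f 0) 0ℚ
∑-last (ℕ.suc n) f = trans (cong (f 0 +_) (∑-last n (f ∘ ℕ.suc))) (sym (+-assoc (f 0) _ _))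

∑-single : ∀ n {f} p → p ℕ.< n → (∀ i → i ℕ.< n → i ≢ p → f i ≡ 0ℚ) → ∑ n f ≡ f p
∑-single (ℕ.suc n) {f} ℕ.zero _ h =
  trans (cong (f 0 +_) (∑-zero n (λ i i<n → h (ℕ.suc i) (ℕ.s≤s i<n) (λ ())))) (+-identityʳ (f 0))
∑-single (ℕ.suc n) {f} (ℕ.suc p) (ℕ.s≤s p<n) h =
  trans (cong₂ _+_ (h 0 (ℕ.s≤s ℕ.z≤n) (λ ()))
    (∑-single n p p<n (λ i i<n i≢p → h (ℕ.suc i) (ℕ.s≤s i<n) (i≢p ∘ ℕₚ.suc-injective))))
  (+-identityˡ _)

-- Eventual properties of sequences

Eventually : (ℕ → Set) → Set
Eventually P = ∃[ N ] (∀ n → N ℕ.≤ n → P n)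

always : ∀ {P : ℕ → Set} → (∀ n → P n) → Eventually P
always h = 0 , λ n _ → h n

ev-map : ∀ {P Q : ℕ → Set} → (∀ {n} → P n → Q n) → Eventually P → Eventually Q
ev-map f (N , h) = N , λ n N≤n → f (h n N≤n)

ev-zip : ∀ {P Q R : ℕ → Set} → (∀ {n} → P n → Q n → R n) → Eventually P → Eventually Q → Eventually R
ev-zip f (M , g) (N , h) = M ℕ.⊔ N , λ n n≥ →
  f (g n (ℕₚ.m⊔n≤o⇒m≤o M N n≥)) (h n (ℕₚ.m⊔n≤o⇒n≤o M N n≥))

ev-all : ∀ {P : ℕ → ℕ → Set} → (∀ i → Eventually (P i)) →
         ∀ n → Eventually (λ m → ∀ i → i ℕ.< n → P i m)
ev-all h ℕ.zero    = always λ _ _ ()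
ev-all h (ℕ.suc n) = ev-zip (λ { p q ℕ.zero _ → p ; p q (ℕ.suc i) (ℕ.s≤s i<n) → q i i<n })
  (h 0) (ev-all (h ∘ ℕ.suc) n)

ev-here : ∀ {P : ℕ → Set} → Eventually P → ∃[ n ] P n
ev-here (N , h) = N , h N ℕₚ.≤-refl

opaque
  -- The witness is β / (1 + c); the summand 1 keeps the divisor positive when `c` is 0.
  small-factor : ∀ c β → 0ℚ ≤ c → 0ℚ < β → Σ[ η ∈ ℚ ] 0ℚ < η × c * η ≤ β
  small-factor c β 0≤c 0<β = η , 0<η ,
    lin (<⇒≤ 0<η) (trans (cong (λ z → z - c * η) (sym β≡)) (expand c η))
    where
    expand : ∀ c η → (1ℚ + c) * η - c * η ≡ η - 0ℚ
    expand = solve-∀ ringℚ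
    0<1+c : 0ℚ < 1ℚ + c
    0<1+c = +-mono-<-≤ (positive⁻¹ 1ℚ) 0≤c
    instance
      p : Positive (1ℚ + c)
      p = positive 0<1+c
      nz : NonZeroℚ (1ℚ + c)
      nz = pos⇒nonZero (1ℚ + c)
      p′ : Positive (1/ (1ℚ + c))
      p′ = 1/pos⇒pos (1ℚ + c)
    η : ℚ
    η = β * 1/ (1ℚ + c)
    0<η : 0ℚ < η
    0<η = *-positive 0<β (positive⁻¹ (1/ (1ℚ + c)))
    β≡ : (1ℚ + c) * η ≡ β
    β≡ = trans (ring (1ℚ + c) β (1/ (1ℚ + c))) (trans (cong (β *_) (*-inverseʳ (1ℚ + c))) (*-identityʳ β))
      where
      ring : ∀ a b d → a * (b * d) ≡ b * (a * d)
      ring = solve-∀ ringℚ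

∑-2⁻ : ∀ K → ∑ K (λ k → 2⁻^ (ℕ.suc k)) ≤ 1ℚ
∑-2⁻ K = lin (<⇒≤ (2⁻-positive K)) (trans (cong (λ z → 1ℚ - z) (exact K)) (ring (2⁻^ K)))
  where
  ring : ∀ a → 1ℚ - (1ℚ - a) ≡ a - 0ℚ
  ring = solve-∀ ringℚ
  step : ∀ a → (1ℚ - a) + ½ * a ≡ 1ℚ - ½ * a
  step = solve-∀ ringℚ
  exact : ∀ K → ∑ K (λ k → 2⁻^ (ℕ.suc k)) ≡ 1ℚ - 2⁻^ K
  exact ℕ.zero    = refl
  exact (ℕ.suc K) = trans (∑-last K _) (trans (cong (_+ 2⁻^ (ℕ.suc K)) (exact K)) (step (2⁻^ K)))

-- Lengths of overlaps of intervals

clamp : ℚ → ℚ → ℚ → ℚ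
clamp u v t = (t ⊔ u) ⊓ v

module _ {u v : ℚ} (u≤v : u ≤ v) where

  clamp-below : ∀ {t} → t ≤ u → clamp u v t ≡ u
  clamp-below t≤u = trans (cong (_⊓ v) (p≤q⇒p⊔q≡q t≤u)) (p≤q⇒p⊓q≡p u≤v)

  clamp-above : ∀ {t} → v ≤ t → clamp u v t ≡ v
  clamp-above {t} v≤t = p≥q⇒p⊓q≡q (≤-trans v≤t (p≤p⊔q t u))

  clamp-inside : ∀ {t} → u ≤ t → t ≤ v → clamp u v t ≡ t
  clamp-inside u≤t t≤v = trans (cong (_⊓ v) (p≥q⇒p⊔q≡p u≤t)) (p≤q⇒p⊓q≡p t≤v)

  clamp≤ : ∀ t → clamp u v t ≤ v
  clamp≤ t = p⊓q≤q (t ⊔ u) v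

  ≤clamp : ∀ t → u ≤ clamp u v t
  ≤clamp t = ⊓-glb (p≤q⊔p t u) u≤v

clamp-mono : ∀ u v {s t} → s ≤ t → clamp u v s ≤ clamp u v t
clamp-mono u v s≤t = ⊓-monoˡ-≤ v (⊔-monoˡ-≤ u s≤t)

-- On the side of `m` away from `t` the clamp is stuck at `m`; on the other side it agrees with the
-- clamp to the whole interval.
clamp-split : ∀ {u m v} → u ≤ m → m ≤ v → ∀ t → clamp u m t + clamp m v t ≡ clamp u v t + m
clamp-split {u} {m} {v} u≤m m≤v t with ≤-total t m
... | inj₁ t≤m = cong₂ _+_ (trans (p≤q⇒p⊓q≡p t⊔u≤m) (sym (p≤q⇒p⊓q≡p (≤-trans t⊔u≤m m≤v))))
                           (clamp-below m≤v t≤m)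
  where
  t⊔u≤m : t ⊔ u ≤ m
  t⊔u≤m = ⊔-lub t≤m u≤m
... | inj₂ m≤t = trans (cong₂ _+_ (clamp-above u≤m m≤t)
    (cong (_⊓ v) (trans (p≥q⇒p⊔q≡p m≤t) (sym (p≥q⇒p⊔q≡p (≤-trans u≤m m≤t))))))
  (+-comm m _)

-- For `a ≤ b` and `u ≤ v` this is the length of [a,b] ∩ [u,v]. As an increment of `clamp` it
-- inherits additivity in [u,v] from `clamp-split`.
meet : ℚ → ℚ → ℚ → ℚ → ℚ
meet a b u v = clamp u v b - clamp u v a

meet-split : ∀ {u m v} → u ≤ m → m ≤ v → ∀ a b →
                meet a b u m + meet a b m v ≡ meet a b u v
meet-split {u} {m} {v} u≤m m≤v a b =
  trans (ring₁ (clamp u m b) (clamp u m a) (clamp m v b) (clamp m v a))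
    (trans (cong₂ _-_ (clamp-split u≤m m≤v b) (clamp-split u≤m m≤v a))
      (ring₂ (clamp u v b) (clamp u v a) m))
  where
  ring₁ : ∀ p q r s → (p - q) + (r - s) ≡ (p + r) - (q + s)
  ring₁ = solve-∀ ringℚ
  ring₂ : ∀ p q r → (p + r) - (q + r) ≡ p - q
  ring₂ = solve-∀ ringℚ

meet≤ : ∀ {u v} → u ≤ v → ∀ a b → meet a b u v ≤ v - u
meet≤ {u} {v} u≤v a b = clamp≤ u≤v b ⊕ neg-antimono-≤ (≤clamp u≤v a)

meet-nonneg : ∀ u v {a b} → a ≤ b → 0ℚ ≤ meet a b u v
meet-nonneg u v {a} {b} a≤b = lin (clamp-mono u v a≤b) (ring (clamp u v a) (clamp u v b))
  where
  ring : ∀ p q → (q - p) - 0ℚ ≡ q - p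
  ring = solve-∀ ringℚ

meet-within : ∀ {u v} → u ≤ v → ∀ {a b} → a ≤ u → v ≤ b → meet a b u v ≡ v - u
meet-within u≤v a≤u v≤b = cong₂ _-_ (clamp-above u≤v v≤b) (clamp-below u≤v a≤u)

meet-left : ∀ {u v} → u ≤ v → ∀ {a b} → a ≤ b → b ≤ u → meet a b u v ≡ 0ℚ
meet-left {u} u≤v a≤b b≤u =
  trans (cong₂ _-_ (clamp-below u≤v b≤u) (clamp-below u≤v (≤-trans a≤b b≤u))) (+-inverseʳ u)

meet-right : ∀ {u v} → u ≤ v → ∀ {a b} → a ≤ b → v ≤ a → meet a b u v ≡ 0ℚ
meet-right {v = v} u≤v a≤b v≤a =
  trans (cong₂ _-_ (clamp-above u≤v (≤-trans v≤a a≤b)) (clamp-above u≤v v≤a)) (+-inverseʳ v)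

len : Interval → ℚ
len J = hi J - lo J

len-nonneg : ∀ J → 0ℚ ≤ len J
len-nonneg J = ≤-trans (≤-reflexive (sym (+-inverseʳ (lo J)))) (+-monoˡ-≤ (- lo J) (lo≤hi J))

infix 4 _∈¹_
_∈¹_ : I → Interval → Set
x ∈¹ J = fromℚ (lo J) ≤ᵣ real x × real x ≤ᵣ fromℚ (hi J)

-- Pointwise estimates

∣∣-≤⇒ : ∀ {a b} → ∣ a ∣ ≤ b → a ≤ b × - a ≤ b
∣∣-≤⇒ {a} h = ≤-trans (a≤∣a∣ a) h , ≤-trans (-a≤∣a∣ a) h

∣*∣≤ : ∀ {a b c d} → ∣ a ∣ ≤ b → ∣ c ∣ ≤ d → ∣ a * c ∣ ≤ b * d
∣*∣≤ {a} {b} {c} {d} a≤b c≤d = ≤-trans (≤-reflexive (∣p*q∣≡∣p∣*∣q∣ a c))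
  (lin (*-mono (0≤∣p∣ c) a≤b ⊕ *-mono (≤-trans (0≤∣p∣ a) a≤b) c≤d) (ring (∣ a ∣) b (∣ c ∣) d))
  where
  ring : ∀ a b c d → b * d - a * c ≡ (c * b + b * d) - (c * a + b * c)
  ring = solve-∀ ringℚ

∣+∣≤ : ∀ {a b c d} → ∣ a ∣ ≤ b → ∣ c ∣ ≤ d → ∣ a + c ∣ ≤ b + d
∣+∣≤ {a} {c = c} p q = ≤-trans (∣p+q∣≤∣p∣+∣q∣ a c) (p ⊕ q)

∣-∣≤ : ∀ {a b c d} → ∣ a ∣ ≤ b → ∣ c ∣ ≤ d → ∣ a - c ∣ ≤ b + d
∣-∣≤ {a} {c = c} p q = ≤-trans (∣p-q∣≤∣p∣+∣q∣ a c) (p ⊕ q)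

-- `8ℚ * e` is a common allowance for the errors when `u` is within `e` of 0 or 1; `8ℚ + 8ℚ` bounds
-- the same errors crudely at every point.
2ℚ 8ℚ : ℚ
2ℚ = 1ℚ + 1ℚ
8ℚ = (2ℚ + 2ℚ) + (2ℚ + 2ℚ)

0≤8 : 0ℚ ≤ 8ℚ
0≤8 = nonNegative⁻¹ 8ℚ

-- For u ∈ {0,1} and v ∈ [0,1] one has ∣ v - u ∣ = (1 - 2u)(v - u).
sign-error : ℚ → ℚ → ℚ
sign-error u g = (1ℚ - 2ℚ * u) * g - ∣ g ∣

module _ {u g : ℚ} (g≤2 : ∣ g ∣ ≤ 2ℚ) where

  sign-error-bounded : ∣ u ∣ ≤ 2ℚ → ∣ sign-error u g ∣ ≤ 8ℚ + 8ℚ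
  sign-error-bounded u≤2 = ≤-trans (∣-∣≤ {(1ℚ - 2ℚ * u) * g} {(1ℚ + 2ℚ * 2ℚ) * 2ℚ}
      (∣*∣≤ (∣-∣≤ {1ℚ} ≤-refl (∣*∣≤ {2ℚ} ≤-refl u≤2)) g≤2)
      (≤-trans (≤-reflexive (∣∣p∣∣≡∣p∣ g)) g≤2)) (toWitness {a? = ((1ℚ + 2ℚ * 2ℚ) * 2ℚ + 2ℚ) ≤? (8ℚ + 8ℚ)} _)

  -- Since ∣ g ∣ ≤ 2, the product (1 - 2u)g is within 4e of g, and g ≥ -2e gives ∣ g ∣ ≤ g + 4e.
  sign-error-near-0 : ∀ {e} → 0ℚ ≤ e → ∣ u ∣ ≤ e → - g ≤ 2ℚ * e → ∣ sign-error u g ∣ ≤ 8ℚ * e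
  sign-error-near-0 {e} 0≤e u≤e -g≤2e = ∣∣-bound
    (lin (a≤∣a∣ g ⊕ proj₂ ug ⊕ proj₂ ug ⊕ 0≤e ⊕ 0≤e ⊕ 0≤e ⊕ 0≤e) (ring₁ u g (∣ g ∣) e))
    (lin (g≥ ⊕ proj₁ ug ⊕ proj₁ ug) (ring₂ u g (∣ g ∣) e))
    where
    ug : u * g ≤ e * 2ℚ × - (u * g) ≤ e * 2ℚ
    ug = ∣∣-≤⇒ (∣*∣≤ u≤e g≤2)
    g≥ : ∣ g ∣ ≤ g + (2ℚ * e + 2ℚ * e)
    g≥ = ∣∣-bound (lin (0≤e ⊕ 0≤e ⊕ 0≤e ⊕ 0≤e) (ring₃ g e)) (lin (-g≤2e ⊕ -g≤2e) (ring₄ g e))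
      where
      ring₃ : ∀ g e → (g + (2ℚ * e + 2ℚ * e)) - g ≡ (e + e + e + e) - (0ℚ + 0ℚ + 0ℚ + 0ℚ)
      ring₃ = solve-∀ ringℚ
      ring₄ : ∀ g e → (g + (2ℚ * e + 2ℚ * e)) - (- g) ≡
                      (2ℚ * e + 2ℚ * e) - (- g + - g)
      ring₄ = solve-∀ ringℚ
    ring₁ : ∀ u g a e → 8ℚ * e - ((1ℚ - 2ℚ * u) * g - a) ≡
      (a + e * 2ℚ + e * 2ℚ + e + e + e + e) - (g + - (u * g) + - (u * g) + 0ℚ + 0ℚ + 0ℚ + 0ℚ)
    ring₁ = solve-∀ ringℚ
    ring₂ : ∀ u g a e → 8ℚ * e - (- ((1ℚ - 2ℚ * u) * g - a)) ≡
      (g + (2ℚ * e + 2ℚ * e) + e * 2ℚ + e * 2ℚ) - (a + u * g + u * g)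
    ring₂ = solve-∀ ringℚ

-- Replacing u by 1 - u and g by -g leaves `sign-error` unchanged and leads back to u near 0.
sign-error-near-1 : ∀ {u g e} → ∣ g ∣ ≤ 2ℚ → 0ℚ ≤ e → ∣ u - 1ℚ ∣ ≤ e → g ≤ 2ℚ * e → ∣ sign-error u g ∣ ≤ 8ℚ * e
sign-error-near-1 {u} {g} {e} g≤2 0≤e u≤e g≤2e = subst (λ z → ∣ z ∣ ≤ 8ℚ * e)
  (trans (cong (λ a → (1ℚ - 2ℚ * (1ℚ - u)) * (- g) - a) (∣-p∣≡∣p∣ g)) (ring u g (∣ g ∣)))
  (sign-error-near-0 {1ℚ - u} { - g} (≤-trans (≤-reflexive (∣-p∣≡∣p∣ g)) g≤2) 0≤e
    (≤-trans (≤-reflexive (∣a-b∣≡∣b-a∣ 1ℚ u)) u≤e) (≤-trans (≤-reflexive (neg-neg g)) g≤2e))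
  where
  neg-neg : ∀ g → - (- g) ≡ g
  neg-neg = solve-∀ ringℚ
  ring : ∀ u g a → (1ℚ - 2ℚ * (1ℚ - u)) * (- g) - a ≡ (1ℚ - 2ℚ * u) * g - a
  ring = solve-∀ ringℚ

-- For u ∈ {0,1}, ∣ w - u ∣ = w + u - 2wu = (w + v - 2wv) + (2w - 1)(v - u).
linear-distance : (w v₀ v u : ℚ) → ℚ
linear-distance w v₀ v u = (w + v₀ - 2ℚ * w * v₀) + (2ℚ * w - 1ℚ) * (v - u)

coefficient≤1 : ∀ {w} → 0ℚ ≤ w → w ≤ 1ℚ → ∣ 2ℚ * w - 1ℚ ∣ ≤ 1ℚ
coefficient≤1 {w} 0≤w w≤1 = ∣∣-bound (lin (w≤1 ⊕ w≤1) (ring₁ w)) (lin (0≤w ⊕ 0≤w) (ring₂ w))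
  where
  ring₁ : ∀ w → 1ℚ - (2ℚ * w - 1ℚ) ≡ 2ℚ - (w + w)
  ring₁ = solve-∀ ringℚ
  ring₂ : ∀ w → 1ℚ - (- (2ℚ * w - 1ℚ)) ≡ (w + w) - (0ℚ + 0ℚ)
  ring₂ = solve-∀ ringℚ

module _ {W w v v₀ : ℚ} (0≤w : 0ℚ ≤ w) (w≤1 : w ≤ 1ℚ) where

  private
    c : ℚ
    c = 2ℚ * w - 1ℚ

    -- As v₀ - 2wv₀ = -cv₀, the values of V survive only as the error v - v₀.
    decompose : ∀ u → linear-distance w v₀ v u ≡ w - c * u + c * (v - v₀)
    decompose u = ring w v₀ v u
      where
      ring : ∀ w v₀ v u → (w + v₀ - 2ℚ * w * v₀) + (2ℚ * w - 1ℚ) * (v - u) ≡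
        w - (2ℚ * w - 1ℚ) * u + (2ℚ * w - 1ℚ) * (v - v₀)
      ring = solve-∀ ringℚ

  -- Both compared quantities are within 2e of w: the first because ∣ c ∣ ≤ 1, the second because w
  -- ≥ 0.
  linear-distance-near-0 : ∀ {u e} → 0ℚ ≤ e → ∣ W - w ∣ ≤ e → ∣ v - v₀ ∣ ≤ e → ∣ u ∣ ≤ e →
                           ∣ linear-distance w v₀ v u - ∣ W - u ∣ ∣ ≤ 8ℚ * e
  linear-distance-near-0 {u} {e} 0≤e W≈w v≈v₀ u≈0 = subst (λ z → ∣ z - ∣ W - u ∣ ∣ ≤ 8ℚ * e) (sym (decompose u))
    (∣∣-bound
      (lin (proj₂ cu ⊕ proj₁ cv ⊕ a≤∣a∣ (W - u) ⊕ proj₂ (∣∣-≤⇒ W≈w) ⊕ proj₁ (∣∣-≤⇒ u≈0) ⊕ 0≤4e)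
        (ring₁ w (c * u) (c * (v - v₀)) W u (∣ W - u ∣) e))
      (lin (proj₁ cu ⊕ proj₂ cv ⊕ ≤w ⊕ 0≤4e) (ring₂ w (c * u) (c * (v - v₀)) (∣ W - u ∣) e)))
    where
    0≤4e : 0ℚ ≤ e + e + e + e
    0≤4e = +-nonneg (+-nonneg (+-nonneg 0≤e 0≤e) 0≤e) 0≤e
    cu : c * u ≤ 1ℚ * e × - (c * u) ≤ 1ℚ * e
    cu = ∣∣-≤⇒ (∣*∣≤ (coefficient≤1 0≤w w≤1) u≈0)
    cv : c * (v - v₀) ≤ 1ℚ * e × - (c * (v - v₀)) ≤ 1ℚ * e
    cv = ∣∣-≤⇒ (∣*∣≤ (coefficient≤1 0≤w w≤1) v≈v₀)
    ≤w : ∣ W - u ∣ ≤ w + (e + e)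
    ≤w = ∣∣-bound (lin (proj₁ (∣∣-≤⇒ W≈w) ⊕ proj₂ (∣∣-≤⇒ u≈0)) (ring₃ W w u e))
                  (lin (proj₂ (∣∣-≤⇒ W≈w) ⊕ proj₁ (∣∣-≤⇒ u≈0) ⊕ 0≤w ⊕ 0≤w) (ring₄ W w u e))
      where
      ring₃ : ∀ W w u e → (w + (e + e)) - (W - u) ≡ (e + e) - ((W - w) + - u)
      ring₃ = solve-∀ ringℚ
      ring₄ : ∀ W w u e → (w + (e + e)) - (- (W - u)) ≡ (e + e + w + w) - (- (W - w) + u + 0ℚ + 0ℚ)
      ring₄ = solve-∀ ringℚ
    ring₁ : ∀ w p q W u a e → 8ℚ * e - ((w - p + q) - a) ≡
      (1ℚ * e + 1ℚ * e + a + e + e + (e + e + e + e)) - (- p + q + (W - u) + - (W - w) + u + 0ℚ)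
    ring₁ = solve-∀ ringℚ
    ring₂ : ∀ w p q a e → 8ℚ * e - (- ((w - p + q) - a)) ≡
      (1ℚ * e + 1ℚ * e + (w + (e + e)) + (e + e + e + e)) - (p + - q + a + 0ℚ)
    ring₂ = solve-∀ ringℚ

  linear-distance-bounded : ∀ {u} → ∣ W ∣ ≤ 2ℚ → ∣ u ∣ ≤ 2ℚ → ∣ v - v₀ ∣ ≤ 2ℚ →
                            ∣ linear-distance w v₀ v u - ∣ W - u ∣ ∣ ≤ 8ℚ + 8ℚ
  linear-distance-bounded {u} W≤2 u≤2 v≤2 = subst (λ z → ∣ z - ∣ W - u ∣ ∣ ≤ 8ℚ + 8ℚ) (sym (decompose u))
    (≤-trans (∣-∣≤ (∣+∣≤ (∣-∣≤ (≤-trans (≤-reflexive (0≤p⇒∣p∣≡p 0≤w)) w≤1)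
                              (∣*∣≤ (coefficient≤1 0≤w w≤1) u≤2))
                        (∣*∣≤ (coefficient≤1 0≤w w≤1) v≤2))
                   (≤-trans (≤-reflexive (∣∣p∣∣≡∣p∣ (W - u))) (∣-∣≤ W≤2 u≤2)))
      (toWitness {a? = (((1ℚ + 1ℚ * 2ℚ) + 1ℚ * 2ℚ) + (2ℚ + 2ℚ)) ≤? (8ℚ + 8ℚ)} _))

-- Replacing all five values by their complements to 1 preserves both the linear expression and ∣ W
-- - u ∣.
linear-distance-near-1 : ∀ {W w v v₀ u e} → 0ℚ ≤ w → w ≤ 1ℚ → 0ℚ ≤ e →
  ∣ W - w ∣ ≤ e → ∣ v - v₀ ∣ ≤ e → ∣ u - 1ℚ ∣ ≤ e → ∣ linear-distance w v₀ v u - ∣ W - u ∣ ∣ ≤ 8ℚ * e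
linear-distance-near-1 {W} {w} {v} {v₀} {u} {e} 0≤w w≤1 0≤e W≈w v≈v₀ u≈1 =
  subst₂ (λ a b → ∣ a - b ∣ ≤ 8ℚ * e) (ring w v₀ v u) (trans (cong ∣_∣ (flip W u)) (∣a-b∣≡∣b-a∣ u W))
    (linear-distance-near-0 {1ℚ - W} {1ℚ - w} {1ℚ - v} {1ℚ - v₀}
      (lin w≤1 (ring′ w)) (lin 0≤w (ring″ w)) 0≤e
      (mirror W w W≈w) (mirror v v₀ v≈v₀) (≤-trans (≤-reflexive (∣a-b∣≡∣b-a∣ 1ℚ u)) u≈1))
  where
  ring : ∀ w v₀ v u →
    ((1ℚ - w) + (1ℚ - v₀) - 2ℚ * (1ℚ - w) * (1ℚ - v₀)) + (2ℚ * (1ℚ - w) - 1ℚ) * ((1ℚ - v) - (1ℚ - u)) ≡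
    (w + v₀ - 2ℚ * w * v₀) + (2ℚ * w - 1ℚ) * (v - u)
  ring = solve-∀ ringℚ
  flip : ∀ a b → (1ℚ - a) - (1ℚ - b) ≡ b - a
  flip = solve-∀ ringℚ
  ring′ : ∀ w → (1ℚ - w) - 0ℚ ≡ 1ℚ - w
  ring′ = solve-∀ ringℚ
  ring″ : ∀ w → 1ℚ - (1ℚ - w) ≡ w - 0ℚ
  ring″ = solve-∀ ringℚ
  mirror : ∀ a b → ∣ a - b ∣ ≤ e → ∣ (1ℚ - a) - (1ℚ - b) ∣ ≤ e
  mirror a b h = ≤-trans (≤-reflexive (trans (cong ∣_∣ (flip a b)) (∣a-b∣≡∣b-a∣ b a))) h

-- Partial recursive functions

computable-cong : ∀ {n} {f g : Vec ℕ n → ℕ} → (∀ xs → f xs ≡ g xs) → Computable f → Computable g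
computable-cong f≡g (c , h) = c , λ xs → subst (c [ xs ]⇓_) (f≡g xs) (h xs)

computable-lookup : ∀ {n} (i : Fin n) → Computable (λ xs → lookup xs i)
computable-lookup i = projʳ i , λ xs → ⇓proj i

computable-head : ∀ {n} → Computable {ℕ.suc n} head
computable-head = projʳ 0F , λ { (x ∷ xs) → ⇓proj 0F }

module _ {n} {g : Vec ℕ n → ℕ} (G : Computable g) where

  compose₁ : ∀ {f : Vec ℕ 1 → ℕ} → Computable f → Computable (λ xs → f (g xs ∷ []))
  compose₁ (c , h) = compʳ c (proj₁ G ∷ []) , λ xs → ⇓comp (proj₂ G xs ∷ []) (h _)

  module _ {g′ : Vec ℕ n → ℕ} (G′ : Computable g′) where

    compose₂ : ∀ {f : Vec ℕ 2 → ℕ} → Computable f → Computable (λ xs → f (g xs ∷ g′ xs ∷ []))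
    compose₂ (c , h) = compʳ c (proj₁ G ∷ proj₁ G′ ∷ []) , λ xs → ⇓comp (proj₂ G xs ∷ proj₂ G′ xs ∷ []) (h _)

    compose₃ : ∀ {g″ : Vec ℕ n → ℕ} → Computable g″ → ∀ {f : Vec ℕ 3 → ℕ} → Computable f →
               Computable (λ xs → f (g xs ∷ g′ xs ∷ g″ xs ∷ []))
    compose₃ G″ (c , h) = compʳ c (proj₁ G ∷ proj₁ G′ ∷ proj₁ G″ ∷ []) ,
      λ xs → ⇓comp (proj₂ G xs ∷ proj₂ G′ xs ∷ proj₂ G″ xs ∷ []) (h _)

projections : ∀ {n m} → (Fin m → Fin n) → Vec (Rec n) m
projections f = Vec.tabulate (projʳ ∘ f)

projections⇓ : ∀ {n m} (f : Fin m → Fin n) xs → projections f [ xs ]⇓* Vec.tabulate (lookup xs ∘ f)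
projections⇓ {m = ℕ.zero}  f xs = []
projections⇓ {m = ℕ.suc m} f xs = ⇓proj (f 0F) ∷ projections⇓ (f ∘ Fin.suc) xs

substitute : ∀ {n} {f : Vec ℕ (ℕ.suc n) → ℕ} {g : Vec ℕ n → ℕ} →
             Computable f → Computable g → Computable (λ xs → f (g xs ∷ xs))
substitute (c , h) (d , k) = compʳ c (d ∷ projections (λ i → i)) , λ xs →
  ⇓comp (k xs ∷ subst (projections (λ i → i) [ xs ]⇓*_) (tabulate∘lookup xs) (projections⇓ (λ i → i) xs)) (h _)

primrec : ∀ {n} → (Vec ℕ n → ℕ) → (Vec ℕ (2 ℕ.+ n) → ℕ) → ℕ → Vec ℕ n → ℕ
primrec f g ℕ.zero    xs = f xs
primrec f g (ℕ.suc k) xs = g (k ∷ primrec f g k xs ∷ xs)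

computable-primrec : ∀ {n} {f : Vec ℕ n → ℕ} {g : Vec ℕ (2 ℕ.+ n) → ℕ} → Computable f → Computable g →
                     Computable (λ xs → primrec f g (head xs) (tail xs))
computable-primrec {f = f} {g} (c , h) (d , k) = precʳ c d , λ { (m ∷ xs) → run m xs }
  where
  run : ∀ m xs → precʳ c d [ m ∷ xs ]⇓ primrec f g m xs
  run ℕ.zero    xs = ⇓prec₀ (h xs)
  run (ℕ.suc m) xs = ⇓precₛ (run m xs) (k _)

computable-0 : ∀ {n} → Computable {n} (λ _ → 0)
computable-0 = compʳ zeroʳ [] , λ xs → ⇓comp [] ⇓zero

computable-suc : ∀ {n} {f : Vec ℕ n → ℕ} → Computable f → Computable (λ xs → ℕ.suc (f xs))
computable-suc (c , h) = compʳ sucʳ (c ∷ []) , λ xs → ⇓comp (h xs ∷ []) ⇓suc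

computable-const : ∀ {n} k → Computable {n} (λ _ → k)
computable-const ℕ.zero    = computable-0
computable-const (ℕ.suc k) = computable-suc (computable-const k)

private
  plus : Computable {2} (λ xs → lookup xs 0F ℕ.+ lookup xs 1F)
  plus = computable-cong (λ { (m ∷ n ∷ []) → correct m n })
    (computable-primrec (computable-lookup {1} 0F) (computable-suc (computable-lookup {3} 1F)))
    where
    correct : ∀ m n → primrec {1} (λ xs → lookup xs 0F) (λ xs → ℕ.suc (lookup xs 1F)) m (n ∷ []) ≡ m ℕ.+ n
    correct ℕ.zero    n = refl
    correct (ℕ.suc m) n = cong ℕ.suc (correct m n)

module _ {n} {f g : Vec ℕ n → ℕ} (F : Computable f) (G : Computable g) where

  computable-+ : Computable (λ xs → f xs ℕ.+ g xs)
  computable-+ = compose₂ F G plus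

private
  times : Computable {2} (λ xs → lookup xs 0F ℕ.* lookup xs 1F)
  times = computable-cong (λ { (m ∷ n ∷ []) → correct m n })
    (computable-primrec {1} computable-0 (computable-+ {3} (computable-lookup 2F) (computable-lookup 1F)))
    where
    correct : ∀ m n → primrec {1} (λ _ → 0) (λ xs → lookup xs 2F ℕ.+ lookup xs 1F) m (n ∷ []) ≡ m ℕ.* n
    correct ℕ.zero    n = refl
    correct (ℕ.suc m) n = cong (n ℕ.+_) (correct m n)

  predecessor : Computable {1} (λ xs → ℕ.pred (lookup xs 0F))
  predecessor = computable-cong (λ { (ℕ.zero ∷ []) → refl ; (ℕ.suc m ∷ []) → refl })
    (computable-primrec {0} computable-0 (computable-lookup 0F))

  monus : Computable {2} (λ xs → lookup xs 1F ℕ.∸ lookup xs 0F)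
  monus = computable-cong (λ { (n ∷ m ∷ []) → correct m n })
    (computable-primrec {1} (computable-lookup 0F) (compose₁ {3} (computable-lookup 1F) predecessor))
    where
    correct : ∀ m n → primrec {1} (λ xs → lookup xs 0F) (λ xs → ℕ.pred (lookup xs 1F)) n (m ∷ []) ≡ m ℕ.∸ n
    correct m ℕ.zero    = refl
    correct m (ℕ.suc n) = trans (cong ℕ.pred (correct m n)) (ℕₚ.pred[m∸n]≡m∸[1+n] m n)

module _ {n} {f g : Vec ℕ n → ℕ} (F : Computable f) (G : Computable g) where

  computable-* : Computable (λ xs → f xs ℕ.* g xs)
  computable-* = compose₂ F G times

  computable-∸ : Computable (λ xs → f xs ℕ.∸ g xs)
  computable-∸ = compose₂ G F monus

private
  power : Computable {1} (λ xs → 2 ℕ.^ lookup xs 0F)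
  power = computable-cong (λ { (m ∷ []) → correct m })
    (computable-primrec {0} (computable-const 1) (computable-* {2} (computable-const 2) (computable-lookup 1F)))
    where
    correct : ∀ m → primrec {0} (λ _ → 1) (λ xs → 2 ℕ.* lookup xs 1F) m [] ≡ 2 ℕ.^ m
    correct ℕ.zero    = refl
    correct (ℕ.suc m) = cong (2 ℕ.*_) (correct m)

computable-2^ : ∀ {n} {f : Vec ℕ n → ℕ} → Computable f → Computable (λ xs → 2 ℕ.^ f xs)
computable-2^ F = compose₁ F power

-- The rule `⇓μ` wants a successor at each argument before the root; for a total `f` this is the
-- same as a nonzero value.
computable-μ : ∀ {n} {f : Vec ℕ (ℕ.suc n) → ℕ} {m : Vec ℕ n → ℕ} → Computable f →
  (∀ xs → f (m xs ∷ xs) ≡ 0) → (∀ xs i → i ℕ.< m xs → f (i ∷ xs) ≢ 0) → Computable m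
computable-μ {f = f} {m} (c , h) root least = μʳ c , λ xs →
  ⇓μ (subst (c [ m xs ∷ xs ]⇓_) (root xs) (h _)) λ i i<m → nonroot xs i (f (i ∷ xs)) refl (least xs i i<m)
  where
  nonroot : ∀ xs i k → f (i ∷ xs) ≡ k → f (i ∷ xs) ≢ 0 → ∃[ y ] c [ i ∷ xs ]⇓ ℕ.suc y
  nonroot xs i ℕ.zero    e ≢0 = contradiction e ≢0
  nonroot xs i (ℕ.suc y) e ≢0 = y , subst (c [ i ∷ xs ]⇓_) e (h _)

-- The quotient is the least q with f < (1 + q)g, a condition that truncated subtraction expresses
-- as a zero.
computable-/ : ∀ {n} {f g : Vec ℕ n → ℕ} {{g≢0 : ∀ {xs} → NonZero (g xs)}} →
               Computable f → Computable g → Computable (λ xs → f xs ℕ./ g xs)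
computable-/ {n} {f} {g} F G = computable-μ {f = λ zs → ℕ.suc (f (tail zs)) ℕ.∸ ℕ.suc (head zs) ℕ.* g (tail zs)}
  (computable-∸ (computable-suc (weaken F)) (computable-* (computable-suc computable-head) (weaken G)))
  (λ xs → ℕₚ.m≤n⇒m∸n≡0 (above xs))
  (λ xs i i<q e → ℕₚ.<⇒≱ (ℕₚ.m∸n≡0⇒m≤n e) (ℕₚ.≤-trans (ℕₚ.*-monoˡ-≤ (g xs) i<q) (ℕ.m/n*n≤m (f xs) (g xs))))
  where
  weaken : ∀ {f : Vec ℕ n → ℕ} → Computable f → Computable (λ zs → f (tail zs))
  weaken {f} (c , h) = compʳ c (projections Fin.suc) , λ { (x ∷ xs) →
    ⇓comp (subst (projections Fin.suc [ x ∷ xs ]⇓*_) (tabulate∘lookup xs) (projections⇓ Fin.suc (x ∷ xs))) (h xs) }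
  above : ∀ xs → f xs ℕ.< ℕ.suc (f xs ℕ./ g xs) ℕ.* g xs
  above xs = begin-strict
    f xs                                        ≡⟨ ℕ.m≡m%n+[m/n]*n (f xs) (g xs) ⟩
    f xs ℕ.% g xs ℕ.+ f xs ℕ./ g xs ℕ.* g xs    <⟨ ℕₚ.+-monoˡ-< (f xs ℕ./ g xs ℕ.* g xs) (ℕ.m%n<n (f xs) (g xs)) ⟩
    g xs ℕ.+ f xs ℕ./ g xs ℕ.* g xs             ∎
    where open ℕₚ.≤-Reasoning

-- The sum over k < K of the fractions x k / y k, as numerator and denominator.
module _ {n} (x y : Vec ℕ (ℕ.suc n) → ℕ) where

  denominator : ℕ → Vec ℕ n → ℕ
  denominator ℕ.zero    xs = 1
  denominator (ℕ.suc k) xs = denominator k xs ℕ.* y (k ∷ xs)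

  numerator : ℕ → Vec ℕ n → ℕ
  numerator ℕ.zero    xs = 0
  numerator (ℕ.suc k) xs = numerator k xs ℕ.* y (k ∷ xs) ℕ.+ denominator k xs ℕ.* x (k ∷ xs)

  denominator≢0 : (∀ zs → NonZero (y zs)) → ∀ K xs → NonZero (denominator K xs)
  denominator≢0 y≢0 ℕ.zero    xs = _
  denominator≢0 y≢0 (ℕ.suc k) xs =
    ℕₚ.m*n≢0 (denominator k xs) (y (k ∷ xs)) {{denominator≢0 y≢0 k xs}} {{y≢0 (k ∷ xs)}}

  -- The conclusion has the same cross-multiplied form as the hypothesis on the summands, so double
  -- sums are treated by applying this twice.
  numerator-spec : ∀ (d : ℕ → ℚ) K xs → (∀ k → k ℕ.< K → d k * ι (y (k ∷ xs)) ≡ ι (x (k ∷ xs))) →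
    ∑ K d * ι (denominator K xs) ≡ ι (numerator K xs)
  numerator-spec d ℕ.zero    xs h = trans (*-zeroˡ (ι 1)) (sym ι-0)
  numerator-spec d (ℕ.suc k) xs h = begin
    ∑ (ℕ.suc k) d * ι (Q ℕ.* b)        ≡⟨ cong₂ _*_ (∑-last k d) (ι-* Q b) ⟩
    (∑ k d + d k) * (ι Q * ι b)        ≡⟨ ring (∑ k d) (d k) (ι Q) (ι b) ⟩
    (∑ k d * ι Q) * ι b + ι Q * (d k * ι b)
      ≡⟨ cong₂ (λ s t → s * ι b + ι Q * t) (numerator-spec d k xs (λ i i<k → h i (ℕₚ.m≤n⇒m≤1+n i<k))) (h k ℕₚ.≤-refl) ⟩
    ι P * ι b + ι Q * ι a              ≡⟨ cong₂ _+_ (ι-* P b) (ι-* Q a) ⟨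
    ι (P ℕ.* b) + ι (Q ℕ.* a)          ≡⟨ ι-+ (P ℕ.* b) (Q ℕ.* a) ⟨
    ι (P ℕ.* b ℕ.+ Q ℕ.* a)            ∎
    where
    open ≡-Reasoning
    P = numerator k xs
    Q = denominator k xs
    a = x (k ∷ xs)
    b = y (k ∷ xs)
    ring : ∀ s d q b → (s + d) * (q * b) ≡ (s * q) * b + q * (d * b)
    ring = solve-∀ ringℚ

  module _ (X : Computable x) (Y : Computable y) where

    private
      -- A recursion step receives counter, previous value and parameters; here the previous value
      -- is dropped.
      skip : ∀ {f : Vec ℕ (ℕ.suc n) → ℕ} → Computable f → Computable {2 ℕ.+ n} (λ zs → f (head zs ∷ tail (tail zs)))
      skip {f} (c , h) = compʳ c (projections π) , λ { (k ∷ r ∷ xs) →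
        ⇓comp (⇓proj 0F ∷ subst (projections (Fin.suc ∘ Fin.suc) [ k ∷ r ∷ xs ]⇓*_) (tabulate∘lookup xs)
                 (projections⇓ (Fin.suc ∘ Fin.suc) (k ∷ r ∷ xs))) (h _) }
        where
        π : Fin (ℕ.suc n) → Fin (2 ℕ.+ n)
        π 0F          = 0F
        π (Fin.suc i) = Fin.suc (Fin.suc i)

    computable-denominator : Computable (λ zs → denominator (head zs) (tail zs))
    computable-denominator = computable-cong (λ { (k ∷ xs) → correct k xs })
      (computable-primrec (computable-const 1) (computable-* (computable-lookup 1F) (skip Y)))
      where
      correct : ∀ k xs → primrec (λ _ → 1) (λ zs → lookup zs 1F ℕ.* y (head zs ∷ tail (tail zs))) k xs ≡ denominator k xs
      correct ℕ.zero    xs = refl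
      correct (ℕ.suc k) xs = cong (ℕ._* y (k ∷ xs)) (correct k xs)

    computable-numerator : Computable (λ zs → numerator (head zs) (tail zs))
    computable-numerator = computable-cong (λ { (k ∷ xs) → correct k xs })
      (computable-primrec computable-0 (computable-+ (computable-* (computable-lookup 1F) (skip Y))
        (computable-* (skip computable-denominator) (skip X))))
      where
      correct : ∀ k xs → primrec (λ _ → 0) (λ zs → lookup zs 1F ℕ.* y (head zs ∷ tail (tail zs)) ℕ.+
        denominator (head zs) (tail (tail zs)) ℕ.* x (head zs ∷ tail (tail zs))) k xs ≡ numerator k xs
      correct ℕ.zero    xs = refl
      correct (ℕ.suc k) xs = cong (λ r → r ℕ.* y (k ∷ xs) ℕ.+ denominator k xs ℕ.* x (k ∷ xs)) (correct k xs)

least-zero : ∀ (f : ℕ → ℕ) k → f k ≡ 0 → Σ[ m ∈ ℕ ] f m ≡ 0 × (∀ i → i ℕ.< m → f i ≢ 0)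
least-zero f k e with f 0 ℕₚ.≟ 0
least-zero f k         e | yes f0 = 0 , f0 , λ _ ()
least-zero f ℕ.zero    e | no ¬f0 = contradiction e ¬f0
least-zero f (ℕ.suc k) e | no ¬f0 with least-zero (f ∘ ℕ.suc) k e
... | m , fm , least = ℕ.suc m , fm , λ { ℕ.zero _ → ¬f0 ; (ℕ.suc i) (ℕ.s≤s i<m) → least i i<m }

module _ (em : ExcludedMiddle 0ℓ) where

  open Integration em

  -- Covering by countably many boxes

  by-contradiction : ∀ {P : Set} → ¬ ¬ P → P
  by-contradiction = decidable-stable em

  𝟙 : Set → ℚ
  𝟙 P = if does (em {P}) then 1ℚ else 0ℚ

  𝟙-true : ∀ {P} → P → 𝟙 P ≡ 1ℚ
  𝟙-true {P} p with em {P}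
  ... | yes _ = refl
  ... | no ¬p = contradiction p ¬p

  𝟙-false : ∀ {P} → ¬ P → 𝟙 P ≡ 0ℚ
  𝟙-false {P} ¬p with em {P}
  ... | yes p = contradiction p ¬p
  ... | no _  = refl

  𝟙-cong : ∀ {P Q} → (P → Q) → (Q → P) → 𝟙 P ≡ 𝟙 Q
  𝟙-cong {P} {Q} f g with em {P}
  ... | yes p = sym (𝟙-true (f p))
  ... | no ¬p = sym (𝟙-false (¬p ∘ g))

  𝟙-× : ∀ P Q → 𝟙 (P × Q) ≡ 𝟙 P * 𝟙 Q
  𝟙-× P Q with em {P} | em {Q}
  ... | yes p | yes q = 𝟙-true (p , q)
  ... | yes p | no ¬q = 𝟙-false (¬q ∘ proj₂)
  ... | no ¬p | yes q = 𝟙-false (¬p ∘ proj₁)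
  ... | no ¬p | no _  = 𝟙-false (¬p ∘ proj₁)

  𝟙-nonneg : ∀ P → 0ℚ ≤ 𝟙 P
  𝟙-nonneg P with em {P}
  ... | yes _ = 0≤1
  ... | no _  = ≤-refl

  𝟙≤1 : ∀ P → 𝟙 P ≤ 1ℚ
  𝟙≤1 P with em {P}
  ... | yes _ = ≤-refl
  ... | no _  = 0≤1

  -- Cousin's lemma for dyadic intervals: if [0,1] were bad, repeated bisection
  -- would give nested bad intervals, which shrink to a point.
  module _ (Good : ℕ → ℚ → Set)
           (join : ∀ m u → Good (ℕ.suc m) u → Good (ℕ.suc m) (u + 2⁻^ (ℕ.suc m)) → Good m u)
    where

    private
      record Bad (m : ℕ) : Set where
        field
          left     : ℚ
          0≤left   : 0ℚ ≤ left
          right≤1  : left + 2⁻^ m ≤ 1ℚ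
          notGood  : ¬ Good m left
      open Bad

      whole : ∀ u d → u + d ≡ (u + ½ * d) + ½ * d
      whole = solve-∀ ringℚ

      -- Excluded middle decides the left half; if it is good, `join` shows that the right half
      -- cannot be.
      bisect : ∀ {m} (b : Bad m) → Σ[ b′ ∈ Bad (ℕ.suc m) ]
        left b ≤ left b′ × left b′ + 2⁻^ (ℕ.suc m) ≤ left b + 2⁻^ m
      bisect {m} b with em {Good (ℕ.suc m) (left b)}
      ... | no ¬g = record
          { left = left b ; 0≤left = 0≤left b ; right≤1 = ≤-trans shrink (right≤1 b) ; notGood = ¬g }
          , ≤-refl , shrink
        where
        shrink : left b + 2⁻^ (ℕ.suc m) ≤ left b + 2⁻^ m
        shrink = ≤-refl {left b} ⊕ 2⁻-antitone (ℕₚ.n≤1+n m)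
      ... | yes g = record
          { left = u′ ; 0≤left = ≤-trans (0≤left b) grow
          ; right≤1 = ≤-trans same (right≤1 b)
          ; notGood = notGood b ∘ join m (left b) g }
          , grow , same
        where
        u′ = left b + 2⁻^ (ℕ.suc m)
        grow : left b ≤ u′
        grow = ≤-trans (≤-reflexive (sym (+-identityʳ (left b))))
          (≤-refl {left b} ⊕ <⇒≤ (2⁻-positive (ℕ.suc m)))
        same : u′ + 2⁻^ (ℕ.suc m) ≤ left b + 2⁻^ m
        same = ≤-reflexive (sym (whole (left b) (2⁻^ m)))

      module _ (b₀ : Bad 0) where

        bad : ∀ m → Bad m
        bad ℕ.zero    = b₀
        bad (ℕ.suc m) = proj₁ (bisect (bad m))

        u : ℕ → ℚ
        u m = left (bad m)

        u-nested : ∀ {m n} → m ℕ.≤′ n → u m ≤ u n × u n + 2⁻^ n ≤ u m + 2⁻^ m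
        u-nested ℕ.≤′-refl = ≤-refl , ≤-refl
        u-nested (ℕ.≤′-step {n} h) with u-nested h | bisect (bad n)
        ... | p , q | _ , r , s = ≤-trans p r , ≤-trans s q

        u-close : ∀ {N m n} → N ℕ.≤ m → N ℕ.≤ n → u m - u n ≤ 2⁻^ N
        u-close {N} {m} {n} N≤m N≤n =
          lin (<⇒≤ (2⁻-positive m) ⊕ proj₂ (u-nested (ℕₚ.≤⇒≤′ N≤m)) ⊕ proj₁ (u-nested (ℕₚ.≤⇒≤′ N≤n)))
            (ring (u m) (u n) (u N) (2⁻^ N) (2⁻^ m))
          where
          ring : ∀ a b c d e → d - (a - b) ≡ (e + (c + d) + b) - (0ℚ + (a + e) + c)
          ring = solve-∀ ringℚ

        u-cauchy : ∀ {ε N m n} → 2⁻^ N ≤ ε → N ℕ.≤ m → N ℕ.≤ n → ∣ u m - u n ∣ ≤ ε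
        u-cauchy {m = m} {n} small N≤m N≤n = ∣∣-bound (≤-trans (u-close N≤m N≤n) small)
          (≤-trans (≤-reflexive (flip (u m) (u n))) (≤-trans (u-close N≤n N≤m) small))
          where
          flip : ∀ a b → - (a - b) ≡ b - a
          flip = solve-∀ ringℚ

        0≤u : ∀ {ε} → 0ℚ < ε → ∀ n → 0ℚ ≤ u n + ε
        0≤u 0<ε n = +-nonneg (0≤left (bad n)) (<⇒≤ 0<ε)

        u≤1 : ∀ {ε} → 0ℚ < ε → ∀ n → u n ≤ 1ℚ + ε
        u≤1 {ε} 0<ε n = lin (right≤1 (bad n) ⊕ <⇒≤ (2⁻-positive n) ⊕ <⇒≤ 0<ε) (ring (u n) (2⁻^ n) ε)
          where
          ring : ∀ a d e → (1ℚ + e) - a ≡ (1ℚ + d + e) - (a + d + 0ℚ + 0ℚ)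
          ring = solve-∀ ringℚ

        limit : I
        limit = record
          { real   = record
            { seq    = u
            ; cauchy = λ ε 0<ε → let N , small = archimedean ε 0<ε in
                         N , λ m n → u-cauchy {ε} {N} {m} {n} small
            }
          ; 0≤real = λ ε 0<ε → 0 , λ n _ → 0≤u {ε} 0<ε n
          ; real≤1 = λ ε 0<ε → 0 , λ n _ → u≤1 {ε} 0<ε n
          }

    -- The limit point has the left end points themselves as its Cauchy sequence. So the local
    -- hypothesis may assume monotone end points, and `u m` names the interval of level `m` around
    -- `x`.
    bisection : (∀ x → let u = seq (real x) in
                   (∀ m → u m ≤ u (ℕ.suc m)) →
                   (∀ m → u (ℕ.suc m) + 2⁻^ (ℕ.suc m) ≤ u m + 2⁻^ m) →
                   ∃[ m ] Good m (u m)) →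
                Good 0 0ℚ
    bisection local = by-contradiction λ ¬good → refute record
      { left = 0ℚ ; 0≤left = ≤-refl ; right≤1 = ≤-refl ; notGood = ¬good }
      where
      refute : ¬ Bad 0
      refute b₀ with local (limit b₀)
        (λ m → proj₁ (proj₂ (bisect (bad b₀ m)))) (λ m → proj₂ (proj₂ (bisect (bad b₀ m))))
      ... | m , good = notGood (bad b₀ m) good

  module _ (n : ℕ) (a : ℕ → ℚ) (A : ℕ → Interval) (0≤a : ∀ i → 0ℚ ≤ a i)
           (c : ℕ → ℚ) (J : ℕ → Interval) (0≤c : ∀ k → 0ℚ ≤ c k)
           (covered : ∀ x ε → 0ℚ < ε →
              ∃[ K ] ∑ n (λ i → a i * 𝟙 (x ∈¹ A i)) ≤ ∑ K (λ k → c k * 𝟙 (x ∈¹ J k)) + ε)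
    where

    private
      module _ (δ : ℚ) (0<δ : 0ℚ < δ) where

        -- The covering intervals are widened by ηₖ on both sides, at total cost ≤ δ.
        opaque
          widening : ∀ k → Σ[ η ∈ ℚ ] 0ℚ < η × (c k + c k) * η ≤ δ * 2⁻^ (ℕ.suc k)
          widening k = small-factor (c k + c k) (δ * 2⁻^ (ℕ.suc k)) (+-nonneg (0≤c k) (0≤c k))
            (*-positive 0<δ (2⁻-positive (ℕ.suc k)))

        η : ℕ → ℚ
        η k = proj₁ (widening k)

        0<η : ∀ k → 0ℚ < η k
        0<η k = proj₁ (proj₂ (widening k))

        inner outer : ℕ → ℚ → ℚ → ℚ
        inner i u v = meet (lo (A i)) (hi (A i)) u v
        outer k u v = meet (lo (J k) - η k) (hi (J k) + η k) u v

        widened : ∀ k → lo (J k) - η k ≤ hi (J k) + η k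
        widened k = lin (lo≤hi (J k) ⊕ <⇒≤ (0<η k) ⊕ <⇒≤ (0<η k)) (ring (lo (J k)) (hi (J k)) (η k))
          where
          ring : ∀ l h e → (h + e) - (l - e) ≡ (h + e + e) - (l + 0ℚ + 0ℚ)
          ring = solve-∀ ringℚ

        0≤outer : ∀ u v k → 0ℚ ≤ c k * outer k u v
        0≤outer u v k = *-nonneg (0≤c k) (meet-nonneg u v (widened k))

        -- The comparison of integrals localised to [u, u + 2^(-m)]. The error is proportional to
        -- the length, so that it does not grow when halves are joined.
        Good : ℕ → ℚ → Set
        Good m u = ∃[ K ] ∑ n (λ i → a i * inner i u (u + 2⁻^ m)) ≤
                          ∑ K (λ k → c k * outer k u (u + 2⁻^ m)) + δ * 2⁻^ m

        module _ (m : ℕ) (u : ℚ) where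
          private
            d = 2⁻^ (ℕ.suc m)
            v = u + d
            w = u + 2⁻^ m

            v+d : v + d ≡ w
            v+d = ring u (2⁻^ m)
              where
              ring : ∀ u d → (u + ½ * d) + ½ * d ≡ u + d
              ring = solve-∀ ringℚ

            u≤v : u ≤ v
            u≤v = lin (<⇒≤ (2⁻-positive (ℕ.suc m))) (ring u d)
              where
              ring : ∀ u d → (u + d) - u ≡ d - 0ℚ
              ring = solve-∀ ringℚ

            v≤w : v ≤ w
            v≤w = ≤-refl {u} ⊕ 2⁻-antitone (ℕₚ.n≤1+n m)

            ∑-split : ∀ N (b : ℕ → ℚ) (α β : ℕ → ℚ) →
              ∑ N (λ i → b i * meet (α i) (β i) u v) + ∑ N (λ i → b i * meet (α i) (β i) v w) ≡
              ∑ N (λ i → b i * meet (α i) (β i) u w)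
            ∑-split N b α β = trans (sym (∑-+ N _ _)) (∑-cong N λ i _ →
              trans (sym (*-distribˡ-+ (b i) _ _)) (cong (b i *_) (meet-split u≤v v≤w (α i) (β i))))

          -- Overlaps with the two halves add up, and both partial sums may be extended to the
          -- larger of K and L because their terms are nonnegative.
          join : Good (ℕ.suc m) u → Good (ℕ.suc m) v → Good m u
          join (K , g) (L , h) = N , (begin
            ∑ n (λ i → a i * inner i u w)
              ≡⟨ ∑-split n a (lo ∘ A) (hi ∘ A) ⟨
            ∑ n (λ i → a i * inner i u v) + ∑ n (λ i → a i * inner i v w)
              ≡⟨ cong (λ z → ∑ n (λ i → a i * inner i u v) + ∑ n (λ i → a i * inner i v z)) (sym v+d) ⟩
            ∑ n (λ i → a i * inner i u v) + ∑ n (λ i → a i * inner i v (v + d))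
              ≤⟨ g ⊕ h ⟩
            (∑ K (λ k → c k * outer k u v) + δ * d) + (∑ L (λ k → c k * outer k v (v + d)) + δ * d)
              ≡⟨ cong (λ z → (∑ K (λ k → c k * outer k u v) + δ * d) + (∑ L (λ k → c k * outer k v z) + δ * d)) v+d ⟩
            (∑ K (λ k → c k * outer k u v) + δ * d) + (∑ L (λ k → c k * outer k v w) + δ * d)
              ≤⟨ (∑-extend _ (0≤outer u v) (ℕₚ.m≤m⊔n K L) ⊕ ≤-refl {δ * d})
                 ⊕ (∑-extend _ (0≤outer v w) (ℕₚ.m≤n⊔m K L) ⊕ ≤-refl {δ * d}) ⟩
            (∑ N (λ k → c k * outer k u v) + δ * d) + (∑ N (λ k → c k * outer k v w) + δ * d)
              ≡⟨ ring (∑ N (λ k → c k * outer k u v)) (∑ N (λ k → c k * outer k v w)) δ (2⁻^ m) ⟩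
            (∑ N (λ k → c k * outer k u v) + ∑ N (λ k → c k * outer k v w)) + δ * 2⁻^ m
              ≡⟨ cong (_+ δ * 2⁻^ m) (∑-split N c (λ k → lo (J k) - η k) (λ k → hi (J k) + η k)) ⟩
            ∑ N (λ k → c k * outer k u w) + δ * 2⁻^ m ∎)
            where
            open ≤-Reasoning
            N = K ℕ.⊔ L
            ring : ∀ p q δ d → (p + δ * (½ * d)) + (q + δ * (½ * d)) ≡ (p + q) + δ * d
            ring = solve-∀ ringℚ

        module _ (x : I)
                 (u↑ : ∀ m → seq (real x) m ≤ seq (real x) (ℕ.suc m))
                 (v↓ : ∀ m → seq (real x) (ℕ.suc m) + 2⁻^ (ℕ.suc m) ≤ seq (real x) m + 2⁻^ m) where
          private
            u : ℕ → ℚ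
            u = seq (real x)

            v : ℕ → ℚ
            v m = u m + 2⁻^ m

            u≤v : ∀ m → u m ≤ v m
            u≤v m = ≤-trans (≤-reflexive (sym (+-identityʳ (u m)))) (≤-refl {u m} ⊕ <⇒≤ (2⁻-positive m))

            u-mono : ∀ {m k} → m ℕ.≤′ k → u m ≤ u k
            u-mono ℕ.≤′-refl     = ≤-refl
            u-mono (ℕ.≤′-step h) = ≤-trans (u-mono h) (u↑ _)

            v-antitone : ∀ {m k} → m ℕ.≤′ k → v k ≤ v m
            v-antitone ℕ.≤′-refl     = ≤-refl
            v-antitone (ℕ.≤′-step h) = ≤-trans (v↓ _) (v-antitone h)

            v-u : ∀ m → v m - u m ≡ 2⁻^ m
            v-u m = ring (u m) (2⁻^ m)
              where
              ring : ∀ a d → (a + d) - a ≡ d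
              ring = solve-∀ ringℚ

            ev-2⁻ : ∀ {ε} → 0ℚ < ε → Eventually (λ m → 2⁻^ m ≤ ε)
            ev-2⁻ {ε} 0<ε with archimedean ε 0<ε
            ... | N , h = N , λ m N≤m → ≤-trans (2⁻-antitone N≤m) h

            -- If no right end point fell below t, then t ≤ u m + 2^(-m) for all m, and t ≤ x would
            -- follow.
            outside-left : ∀ t → ¬ (fromℚ t ≤ᵣ real x) → Eventually (λ m → v m ≤ t)
            outside-left t t≰x with em {∃[ m ] v m < t}
            ... | yes (m , v<t) = m , λ k m≤k → ≤-trans (v-antitone (ℕₚ.≤⇒≤′ m≤k)) (<⇒≤ v<t)
            ... | no  none = contradiction (λ ε 0<ε → ev-map
                (λ {m} 2⁻≤ε → ≤-trans (≮⇒≥ (λ v<t → none (m , v<t))) (≤-refl {u m} ⊕ 2⁻≤ε)) (ev-2⁻ 0<ε)) t≰x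

            outside-right : ∀ t → ¬ (real x ≤ᵣ fromℚ t) → Eventually (λ m → t ≤ u m)
            outside-right t x≰t with em {∃[ m ] t < u m}
            ... | yes (m , t<u) = m , λ k m≤k → ≤-trans (<⇒≤ t<u) (u-mono (ℕₚ.≤⇒≤′ m≤k))
            ... | no  none = contradiction (λ ε 0<ε → always λ m → ≤-trans
                (≮⇒≥ (λ t<u → none (m , t<u)))
                (≤-trans (≤-reflexive (sym (+-identityʳ t))) (≤-refl {t} ⊕ <⇒≤ 0<ε))) x≰t

            -- A point outside the closed interval is eventually separated from it up to a common
            -- end point, and then the overlap has length 0.
            inner≤ : ∀ i → Eventually (λ m → inner i (u m) (v m) ≤ 𝟙 (x ∈¹ A i) * 2⁻^ m)
            inner≤ i with em {x ∈¹ A i}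
            ... | yes _ = always λ m → ≤-trans (meet≤ (u≤v m) (lo (A i)) (hi (A i)))
                            (≤-reflexive (trans (v-u m) (sym (*-identityˡ (2⁻^ m)))))
            ... | no x∉A with em {fromℚ (lo (A i)) ≤ᵣ real x}
            ...   | no  lo≰x = ev-map (λ {m} v≤lo → ≤-reflexive (trans
                      (meet-right (u≤v m) (lo≤hi (A i)) v≤lo) (sym (*-zeroˡ (2⁻^ m))))) (outside-left _ lo≰x)
            ...   | yes lo≤x = ev-map (λ {m} hi≤u → ≤-reflexive (trans
                      (meet-left (u≤v m) (lo≤hi (A i)) hi≤u) (sym (*-zeroˡ (2⁻^ m)))))
                      (outside-right _ λ x≤hi → x∉A (lo≤x , x≤hi))

            -- This is what the widening is for: `x` may be an end point of `J k`, but the widened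
            -- interval contains all sufficiently short dyadic intervals around it.
            ≤outer : ∀ k → Eventually (λ m → 𝟙 (x ∈¹ J k) * 2⁻^ m ≤ outer k (u m) (v m))
            ≤outer k with em {x ∈¹ J k}
            ... | no _ = always λ m → ≤-trans (≤-reflexive (*-zeroˡ (2⁻^ m))) (meet-nonneg (u m) (v m) (widened k))
            ... | yes (lo≤x , x≤hi) = ev-zip
                (λ {m} lo≤ (hi≥ , 2⁻≤) → ≤-reflexive (trans (*-identityˡ (2⁻^ m)) (sym (trans
                   (meet-within (u≤v m) {lo (J k) - η k} {hi (J k) + η k}
                     (lin lo≤ (ring₁ (lo (J k)) (u m) (η k)))
                     (lin (hi≥ ⊕ 2⁻≤) (ring₂ (hi (J k)) (u m) (2⁻^ m) (η k)))) (v-u m)))))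
                (lo≤x (η k) (0<η k))
                (ev-zip _,_ (x≤hi (½ * η k) (½-positive (0<η k))) (ev-2⁻ (½-positive (0<η k))))
              where
              ring₁ : ∀ l u e → u - (l - e) ≡ (u + e) - l
              ring₁ = solve-∀ ringℚ
              ring₂ : ∀ h u d e → (h + e) - (u + d) ≡ ((h + ½ * e) + ½ * e) - (u + d)
              ring₂ = solve-∀ ringℚ

          -- Only n + K intervals matter at `x`. Around `x` their overlaps compare with 2^(-m) times
          -- the indicators at `x`, so the pointwise hypothesis with error δ, multiplied by the
          -- length, is `Good`.
          local : ∃[ m ] Good m (u m)
          local with covered x δ 0<δ
          ... | K , cov = ev-here (ev-zip (λ {m} p q → K , (begin
            ∑ n (λ i → a i * inner i (u m) (v m))
              ≤⟨ ∑-mono n (λ i i<n → *-mono (0≤a i) (p i i<n)) ⟩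
            ∑ n (λ i → a i * (𝟙 (x ∈¹ A i) * 2⁻^ m))
              ≡⟨ pull n a (λ i → 𝟙 (x ∈¹ A i)) (2⁻^ m) ⟩
            2⁻^ m * ∑ n (λ i → a i * 𝟙 (x ∈¹ A i))
              ≤⟨ *-mono (<⇒≤ (2⁻-positive m)) cov ⟩
            2⁻^ m * (∑ K (λ k → c k * 𝟙 (x ∈¹ J k)) + δ)
              ≡⟨ ring (2⁻^ m) (∑ K (λ k → c k * 𝟙 (x ∈¹ J k))) δ ⟩
            2⁻^ m * ∑ K (λ k → c k * 𝟙 (x ∈¹ J k)) + δ * 2⁻^ m
              ≡⟨ cong (_+ δ * 2⁻^ m) (pull K c (λ k → 𝟙 (x ∈¹ J k)) (2⁻^ m)) ⟨
            ∑ K (λ k → c k * (𝟙 (x ∈¹ J k) * 2⁻^ m)) + δ * 2⁻^ m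
              ≤⟨ ∑-mono K (λ k k<K → *-mono (0≤c k) (q k k<K)) ⊕ ≤-refl {δ * 2⁻^ m} ⟩
            ∑ K (λ k → c k * outer k (u m) (v m)) + δ * 2⁻^ m ∎))
            (ev-all inner≤ n) (ev-all ≤outer K))
            where
            open ≤-Reasoning
            ring : ∀ d s δ → d * (s + δ) ≡ d * s + δ * d
            ring = solve-∀ ringℚ
            pull : ∀ N b f d → ∑ N (λ i → b i * (f i * d)) ≡ d * ∑ N (λ i → b i * f i)
            pull N b f d = trans (∑-cong N (λ i _ → comm (b i) (f i) d)) (∑-* N d _)
              where
              comm : ∀ b f d → b * (f * d) ≡ d * (b * f)
              comm = solve-∀ ringℚ

        outer≤ : ∀ k → c k * outer k 0ℚ 1ℚ ≤ c k * len (J k) + δ * 2⁻^ (ℕ.suc k)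
        outer≤ k = ≤-trans (*-mono (0≤c k) (≤hi ⊕ neg-antimono-≤ lo≤))
          (lin (proj₂ (proj₂ (widening k))) (ring (c k) (lo (J k)) (hi (J k)) (η k) (δ * 2⁻^ (ℕ.suc k))))
          where
          ≤hi : clamp 0ℚ 1ℚ (hi (J k) + η k) ≤ hi (J k) + η k
          ≤hi = ≤-trans (p⊓q≤p _ 1ℚ) (≤-reflexive (p≥q⇒p⊔q≡p
            (+-nonneg (≤-trans (0≤lo (J k)) (lo≤hi (J k))) (<⇒≤ (0<η k)))))
          lo≤ : lo (J k) - η k ≤ clamp 0ℚ 1ℚ (lo (J k) - η k)
          lo≤ = ⊓-glb (p≤p⊔q (lo (J k) - η k) 0ℚ)
            (lin (lo≤hi (J k) ⊕ hi≤1 (J k) ⊕ <⇒≤ (0<η k)) (ring′ (lo (J k)) (hi (J k)) (η k)))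
            where
            ring′ : ∀ l h e → 1ℚ - (l - e) ≡ (h + 1ℚ + e) - (l + h + 0ℚ)
            ring′ = solve-∀ ringℚ
          ring : ∀ c l h e b → (c * (h - l) + b) - c * ((h + e) - (l - e)) ≡ b - (c + c) * e
          ring = solve-∀ ringℚ

        start : Good 0 0ℚ → ∃[ K ] ∑ n (λ i → a i * inner i 0ℚ 1ℚ) ≤
                                   ∑ K (λ k → c k * outer k 0ℚ 1ℚ) + δ * 1ℚ
        start (K , good) = K , subst
          (λ v → ∑ n (λ i → a i * inner i 0ℚ v) ≤ ∑ K (λ k → c k * outer k 0ℚ v) + δ * 1ℚ)
          (+-identityˡ 1ℚ) good

        len≡inner : ∀ i → len (A i) ≡ inner i 0ℚ 1ℚ
        len≡inner i = sym (cong₂ _-_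
          (clamp-inside 0≤1 (≤-trans (0≤lo (A i)) (lo≤hi (A i))) (hi≤1 (A i)))
          (clamp-inside 0≤1 (0≤lo (A i)) (≤-trans (lo≤hi (A i)) (hi≤1 (A i)))))

        ∑-outer≤ : ∀ K → ∑ K (λ k → c k * outer k 0ℚ 1ℚ) ≤
                   ∑ K (λ k → c k * len (J k)) + δ * ∑ K (λ k → 2⁻^ (ℕ.suc k))
        ∑-outer≤ K = ≤-trans (∑-mono K (λ k _ → outer≤ k)) (≤-reflexive (trans
          (∑-+ K (λ k → c k * len (J k)) (λ k → δ * 2⁻^ (ℕ.suc k)))
          (cong (∑ K (λ k → c k * len (J k)) +_) (∑-* K δ (λ k → 2⁻^ (ℕ.suc k))))))

        -- One δ is the error of `Good` on the unit interval, the other pays for the widening.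
        cover-δ : ∃[ K ] ∑ n (λ i → a i * len (A i)) ≤ ∑ K (λ k → c k * len (J k)) + (δ + δ)
        cover-δ = finish (start (bisection Good join local))
          where
          ring : ∀ s δ t o → (s + (δ + δ)) - (o + δ * 1ℚ) ≡ ((s + δ * t) + δ * 1ℚ) - (o + δ * t)
          ring = solve-∀ ringℚ
          finish : ∃[ K ] ∑ n (λ i → a i * inner i 0ℚ 1ℚ) ≤ ∑ K (λ k → c k * outer k 0ℚ 1ℚ) + δ * 1ℚ →
                   ∃[ K ] ∑ n (λ i → a i * len (A i)) ≤ ∑ K (λ k → c k * len (J k)) + (δ + δ)
          finish (K , good) = K , ≤-trans (≤-trans (≤-reflexive (∑-cong n (λ i _ → cong (a i *_) (len≡inner i)))) good)
              (lin (∑-outer≤ K ⊕ *-mono (<⇒≤ 0<δ) (∑-2⁻ K))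
                (ring (∑ K (λ k → c k * len (J k))) δ (∑ K (λ k → 2⁻^ (ℕ.suc k))) (∑ K (λ k → c k * outer k 0ℚ 1ℚ))))

    interval-cover : ∀ ε → 0ℚ < ε → ∃[ K ] ∑ n (λ i → a i * len (A i)) ≤ ∑ K (λ k → c k * len (J k)) + ε
    interval-cover ε 0<ε = subst
      (λ e → ∃[ K ] ∑ n (λ i → a i * len (A i)) ≤ ∑ K (λ k → c k * len (J k)) + e)
      (ring ε) (cover-δ (½ * ε) (½-positive 0<ε))
      where
      ring : ∀ e → ½ * e + ½ * e ≡ e
      ring = solve-∀ ringℚ

  -- Covers in higher dimensions

  vol-nonneg : ∀ {d} (B : Box d) → 0ℚ ≤ vol B
  vol-nonneg []      = 0≤1
  vol-nonneg (J ∷ B) = *-nonneg (len-nonneg J) (vol-nonneg B)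

  𝟙-∷ : ∀ {d} x (xs : Cube d) (B : Box (ℕ.suc d)) →
        𝟙 ((x ∷ xs) ∈ᴮ B) ≡ 𝟙 (x ∈¹ head B) * 𝟙 (xs ∈ᴮ tail B)
  𝟙-∷ x xs (J ∷ B) = trans (𝟙-cong (λ { (p ∷ ps) → p , ps }) (λ { (p , ps) → p ∷ ps }))
                           (𝟙-× (x ∈¹ J) (xs ∈ᴮ B))

  Term : ℕ → Set
  Term d = ℚ × Box d

  infix 8 _◃_
  _◃_ : ∀ {d} → (Box d → ℚ) → Term d → ℚ
  φ ◃ (c , B) = c * φ B

  χ : ∀ {d} → Cube d → Box d → ℚ
  χ x B = 𝟙 (x ∈ᴮ B)

  χ-nonneg : ∀ {d} (x : Cube d) B → 0ℚ ≤ χ x B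
  χ-nonneg x B = 𝟙-nonneg (x ∈ᴮ B)

  -- Dimension by dimension: for fixed xs the first coordinate is an instance of
  -- interval-cover, whose conclusion is the hypothesis for the remaining ones.
  box-cover : ∀ {d} n (a : ℕ → Term d) → (∀ i → 0ℚ ≤ proj₁ (a i)) →
    (c : ℕ → Term d) → (∀ k → 0ℚ ≤ proj₁ (c k)) →
    (∀ x ε → 0ℚ < ε → ∃[ K ] ∑ n (λ i → χ x ◃ a i) ≤ ∑ K (λ k → χ x ◃ c k) + ε) →
    ∀ ε → 0ℚ < ε → ∃[ K ] ∑ n (λ i → vol ◃ a i) ≤ ∑ K (λ k → vol ◃ c k) + ε
  box-cover {ℕ.zero} n a 0≤a c 0≤c covered ε 0<ε with covered [] ε 0<ε
  ... | K , h = K , subst₂ (λ p q → p ≤ q + ε) (∑-cong n (λ i _ → empty (a i)))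
                                               (∑-cong K (λ k _ → empty (c k))) h
    where
    empty : ∀ (t : Term 0) → χ [] ◃ t ≡ vol ◃ t
    empty (c , []) = cong (c *_) (𝟙-true [])
  box-cover {ℕ.suc d} n a 0≤a c 0≤c covered ε 0<ε =
    transport (box-cover n (tail-term ∘ a) (λ i → tail-nonneg (a i) (0≤a i))
      (tail-term ∘ c) (λ k → tail-nonneg (c k) (0≤c k)) slice ε 0<ε)
    where
    tail-term : Term (ℕ.suc d) → Term d
    tail-term (c , B) = c * len (head B) , tail B

    tail-nonneg : ∀ t → 0ℚ ≤ proj₁ t → 0ℚ ≤ proj₁ (tail-term t)
    tail-nonneg (c , B) 0≤c = *-nonneg 0≤c (len-nonneg (head B))

    vol-tail : ∀ t → vol ◃ tail-term t ≡ vol ◃ t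
    vol-tail (c , J ∷ B) = *-assoc c (len J) (vol B)

    transport : ∃[ K ] ∑ n (λ i → vol ◃ tail-term (a i)) ≤ ∑ K (λ k → vol ◃ tail-term (c k)) + ε →
                ∃[ K ] ∑ n (λ i → vol ◃ a i) ≤ ∑ K (λ k → vol ◃ c k) + ε
    transport (K , h) = K , subst₂ (λ p q → p ≤ q + ε) (∑-cong n (λ i _ → vol-tail (a i)))
                                                       (∑-cong K (λ k _ → vol-tail (c k))) h

    module _ (xs : Cube d) where
      at : Term (ℕ.suc d) → ℚ
      at (c , B) = c * χ xs (tail B)

      side : Term (ℕ.suc d) → Interval
      side (c , B) = head B

      at-nonneg : ∀ t → 0ℚ ≤ proj₁ t → 0ℚ ≤ at t
      at-nonneg (c , B) 0≤c = *-nonneg 0≤c (χ-nonneg xs (tail B))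

      fibre : ∀ x t → χ (x ∷ xs) ◃ t ≡ at t * 𝟙 (x ∈¹ side t)
      fibre x (c , B) = trans (cong (c *_) (𝟙-∷ x xs B)) (ring c (𝟙 (x ∈¹ head B)) (χ xs (tail B)))
        where
        ring : ∀ b p q → b * (p * q) ≡ (b * q) * p
        ring = solve-∀ ringℚ

      swap : ∀ t → at t * len (side t) ≡ χ xs ◃ tail-term t
      swap (c , B) = ring c (χ xs (tail B)) (len (head B))
        where
        ring : ∀ b p q → (b * p) * q ≡ (b * q) * p
        ring = solve-∀ ringℚ

      fixed : ∀ x ε → 0ℚ < ε → ∃[ K ]
        ∑ n (λ i → at (a i) * 𝟙 (x ∈¹ side (a i))) ≤ ∑ K (λ k → at (c k) * 𝟙 (x ∈¹ side (c k))) + ε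
      fixed x ε 0<ε with covered (x ∷ xs) ε 0<ε
      ... | K , h = K , subst₂ (λ p q → p ≤ q + ε) (∑-cong n (λ i _ → fibre x (a i)))
                                                   (∑-cong K (λ k _ → fibre x (c k))) h

      slice : ∀ ε → 0ℚ < ε → ∃[ K ]
        ∑ n (λ i → χ xs ◃ tail-term (a i)) ≤ ∑ K (λ k → χ xs ◃ tail-term (c k)) + ε
      slice ε 0<ε = unswap (interval-cover
        n (λ i → at (a i)) (λ i → side (a i)) (λ i → at-nonneg (a i) (0≤a i))
        (λ k → at (c k)) (λ k → side (c k)) (λ k → at-nonneg (c k) (0≤c k)) fixed ε 0<ε)
        where
        unswap : ∃[ K ] ∑ n (λ i → at (a i) * len (side (a i))) ≤ ∑ K (λ k → at (c k) * len (side (c k))) + ε →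
                 ∃[ K ] ∑ n (λ i → χ xs ◃ tail-term (a i)) ≤ ∑ K (λ k → χ xs ◃ tail-term (c k)) + ε
        unswap (K , h) = K , subst₂ (λ p q → p ≤ q + ε) (∑-cong n (λ i _ → swap (a i)))
                                                        (∑-cong K (λ k _ → swap (c k))) h

  -- Series of boxes and step functions with signed coefficients

  interleave : ∀ {X : Set} → (ℕ → X) → (ℕ → X) → ℕ → X
  interleave f g ℕ.zero    = f 0
  interleave f g (ℕ.suc n) = interleave g (f ∘ ℕ.suc) n

  interleave-all : ∀ {X : Set} {P : X → Set} {f g} → (∀ n → P (f n)) → (∀ n → P (g n)) →
                   ∀ n → P (interleave f g n)
  interleave-all p q ℕ.zero    = p 0
  interleave-all {P = P} p q (ℕ.suc n) = interleave-all {P = P} q (p ∘ ℕ.suc) n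

  ∑-interleave : ∀ {X : Set} (φ : X → ℚ) K f g →
    ∑ (K ℕ.+ K) (φ ∘ interleave f g) ≡ ∑ K (φ ∘ f) + ∑ K (φ ∘ g)
  ∑-interleave φ ℕ.zero    f g = refl
  ∑-interleave φ (ℕ.suc K) f g rewrite ℕₚ.+-suc K K =
    trans (cong (λ z → φ (f 0) + (φ (g 0) + z)) (∑-interleave φ K (f ∘ ℕ.suc) (g ∘ ℕ.suc)))
      (ring (φ (f 0)) (φ (g 0)) (∑ K (φ ∘ f ∘ ℕ.suc)) (∑ K (φ ∘ g ∘ ℕ.suc)))
    where
    ring : ∀ a b c d → a + (b + (c + d)) ≡ (a + c) + (b + d)
    ring = solve-∀ ringℚ

  -- With φ = `χ x` this is `eval`, with φ = `vol` it is `∫step`; algebraic facts are thus proved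
  -- once for both.
  total : ∀ {d} → (Box d → ℚ) → Step d → ℚ
  total φ []      = 0ℚ
  total φ (t ∷ s) = φ ◃ t + total φ s

  total-++ : ∀ {d} (φ : Box d → ℚ) s t → total φ (s ++ t) ≡ total φ s + total φ t
  total-++ φ []      t = sym (+-identityˡ _)
  total-++ φ (x ∷ s) t = trans (cong (φ ◃ x +_) (total-++ φ s t)) (sym (+-assoc (φ ◃ x) _ _))

  total-applyUpTo : ∀ {d} (φ : Box d → ℚ) h K → total φ (applyUpTo h K) ≡ ∑ K (λ k → φ ◃ h k)
  total-applyUpTo φ h ℕ.zero    = refl
  total-applyUpTo φ h (ℕ.suc K) = cong (φ ◃ h 0 +_) (total-applyUpTo φ (h ∘ ℕ.suc) K)

  scale : ∀ {d} → ℚ → Step d → Step d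
  scale a = map (λ (c , B) → a * c , B)

  total-scale : ∀ {d} (φ : Box d → ℚ) a s → total φ (scale a s) ≡ a * total φ s
  total-scale φ a []            = sym (*-zeroʳ a)
  total-scale φ a ((c , B) ∷ s) = trans (cong₂ _+_ (*-assoc a c (φ B)) (total-scale φ a s))
    (sym (*-distribˡ-+ a (c * φ B) _))

  eval≡ : ∀ {d} (s : Step d) x → eval s x ≡ total (χ x) s
  eval≡ []            x = refl
  eval≡ ((c , B) ∷ s) x = cong₂ _+_ term (eval≡ s x)
    where
    term : (if does (em {x ∈ᴮ B}) then c else 0ℚ) ≡ c * χ x B
    term with em {x ∈ᴮ B}
    ... | yes _ = sym (*-identityʳ c)
    ... | no  _ = sym (*-zeroʳ c)

  ∫≡ : ∀ {d} (s : Step d) → ∫step s ≡ total vol s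
  ∫≡ []            = refl
  ∫≡ ((c , B) ∷ s) = cong (c * vol B +_) (∫≡ s)

  unit : Interval
  unit = record { lo = 0ℚ ; hi = 1ℚ ; 0≤lo = ≤-refl ; lo≤hi = 0≤1 ; hi≤1 = ≤-refl }

  -- Terms past the end have coefficient 0, which turns a step function into a series with the same
  -- sum.
  nth : ∀ {d} → Step d → ℕ → Term d
  nth {d} []  _         = 0ℚ , Vec.replicate d unit
  nth (t ∷ s) ℕ.zero    = t
  nth (t ∷ s) (ℕ.suc i) = nth s i

  ∑-nth : ∀ {d} (φ : Box d → ℚ) s → ∑ (length s) (λ i → φ ◃ nth s i) ≡ total φ s
  ∑-nth φ []      = refl
  ∑-nth φ (t ∷ s) = cong (φ ◃ t +_) (∑-nth φ s)

  ∑-nth≤ : ∀ {d} (φ : Term d → ℚ) → (∀ t → 0ℚ ≤ φ t) → (∀ B → φ (0ℚ , B) ≡ 0ℚ) →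
           ∀ s K → ∑ K (λ i → φ (nth s i)) ≤ ∑ (length s) (λ i → φ (nth s i))
  ∑-nth≤ φ 0≤φ φ0 []      K         = ≤-reflexive (∑-zero K (λ i _ → φ0 _))
  ∑-nth≤ φ 0≤φ φ0 (t ∷ s) ℕ.zero    = ∑-nonneg (length (t ∷ s)) (λ i _ → 0≤φ (nth (t ∷ s) i))
  ∑-nth≤ φ 0≤φ φ0 (t ∷ s) (ℕ.suc K) = ≤-refl {φ t} ⊕ ∑-nth≤ φ 0≤φ φ0 s K

  _⁺ _⁻ : ℚ → ℚ
  c ⁺ = c ⊔ 0ℚ
  c ⁻ = (- c) ⊔ 0ℚ

  ⁺-nonneg : ∀ c → 0ℚ ≤ c ⁺
  ⁺-nonneg c = p≤q⊔p c 0ℚ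

  ⁻-nonneg : ∀ c → 0ℚ ≤ c ⁻
  ⁻-nonneg c = p≤q⊔p (- c) 0ℚ

  ⁺≡+⁻ : ∀ c → c ⁺ ≡ c + c ⁻
  ⁺≡+⁻ c with ≤-total 0ℚ c
  ... | inj₁ 0≤c = trans (p≥q⇒p⊔q≡p 0≤c)
    (sym (trans (cong (c +_) (p≤q⇒p⊔q≡q (neg-antimono-≤ 0≤c))) (+-identityʳ c)))
  ... | inj₂ c≤0 = trans (p≤q⇒p⊔q≡q c≤0)
    (sym (trans (cong (c +_) (p≥q⇒p⊔q≡p (neg-antimono-≤ c≤0))) (+-inverseʳ c)))

  module _ {d} (s : Step d) (h : ℕ → Term d) (0≤h : ∀ k → 0ℚ ≤ proj₁ (h k))
           (covered : ∀ x ε → 0ℚ < ε → ∃[ K ] total (χ x) s ≤ ∑ K (λ k → χ x ◃ h k) + ε) where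

    private
      n : ℕ
      n = length s

      neg-part pos-part : Term d → Term d
      neg-part (c , B) = c ⁻ , B
      pos-part (c , B) = c ⁺ , B

      p m g : ℕ → Term d
      p i = pos-part (nth s i)
      m i = neg-part (nth s i)
      g   = interleave m h

      0≤g : ∀ k → 0ℚ ≤ proj₁ (g k)
      0≤g = interleave-all {P = λ t → 0ℚ ≤ proj₁ t} (λ i → ⁻-nonneg (proj₁ (nth s i))) 0≤h

      module _ (φ : Box d → ℚ) (0≤φ : ∀ B → 0ℚ ≤ φ B) where

        parts : ∀ t → φ ◃ pos-part t ≡ φ ◃ t + φ ◃ neg-part t
        parts (c , B) = trans (cong (_* φ B) (⁺≡+⁻ c)) (*-distribʳ-+ (φ B) c (c ⁻))

        split : ∑ n (λ i → φ ◃ p i) ≡ total φ s + ∑ n (λ i → φ ◃ m i)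
        split = trans (∑-cong n (λ i _ → parts (nth s i)))
          (trans (∑-+ n (λ i → φ ◃ nth s i) (λ i → φ ◃ m i))
            (cong (_+ ∑ n (λ i → φ ◃ m i)) (∑-nth φ s)))

        ◃-nonneg : ∀ t → 0ℚ ≤ proj₁ t → 0ℚ ≤ φ ◃ t
        ◃-nonneg (c , B) 0≤c = *-nonneg 0≤c (0≤φ B)

        m-nonneg : ∀ t → 0ℚ ≤ φ ◃ neg-part t
        m-nonneg (c , B) = *-nonneg (⁻-nonneg c) (0≤φ B)

        widen : ∀ K → ∑ n (λ i → φ ◃ m i) + ∑ K (λ k → φ ◃ h k) ≤
                      ∑ ((n ℕ.⊔ K) ℕ.+ (n ℕ.⊔ K)) (λ k → φ ◃ g k)
        widen K = ≤-trans
          (∑-extend (λ i → φ ◃ m i) (λ i → m-nonneg (nth s i)) (ℕₚ.m≤m⊔n n K) ⊕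
           ∑-extend (λ k → φ ◃ h k) (λ k → ◃-nonneg (h k) (0≤h k)) (ℕₚ.m≤n⊔m n K))
          (≤-reflexive (sym (∑-interleave (φ ◃_) (n ℕ.⊔ K) m h)))

        narrow : ∀ K → ∑ K (λ k → φ ◃ g k) ≤ ∑ n (λ i → φ ◃ m i) + ∑ K (λ k → φ ◃ h k)
        narrow K = ≤-trans (∑-extend (λ k → φ ◃ g k) (λ k → ◃-nonneg (g k) (0≤g k)) (ℕₚ.m≤m+n K K))
          (≤-trans (≤-reflexive (∑-interleave (φ ◃_) K m h))
            (∑-nth≤ (λ t → φ ◃ neg-part t) m-nonneg (λ B → *-zeroˡ (φ B)) s K ⊕
             ≤-refl {∑ K (λ k → φ ◃ h k)}))

        to-cover : ∀ {K e} → total φ s ≤ ∑ K (λ k → φ ◃ h k) + e →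
          ∑ n (λ i → φ ◃ p i) ≤ ∑ ((n ℕ.⊔ K) ℕ.+ (n ℕ.⊔ K)) (λ k → φ ◃ g k) + e
        to-cover {K} {e} q = ≤-trans (≤-reflexive split) (lin (q ⊕ widen K) (ring (total φ s)
          (∑ n (λ i → φ ◃ m i)) (∑ K (λ k → φ ◃ h k)) e (∑ ((n ℕ.⊔ K) ℕ.+ (n ℕ.⊔ K)) (λ k → φ ◃ g k))))
          where
          ring : ∀ s m h e w → (w + e) - (s + m) ≡ ((h + e) + w) - (s + (m + h))
          ring = solve-∀ ringℚ

        from-cover : ∀ {K e} → ∑ n (λ i → φ ◃ p i) ≤ ∑ K (λ k → φ ◃ g k) + e →
          total φ s ≤ ∑ K (λ k → φ ◃ h k) + e
        from-cover {K} {e} q = lin (≤-trans (≤-reflexive (sym split)) q ⊕ narrow K) (ring (total φ s)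
          (∑ n (λ i → φ ◃ m i)) (∑ K (λ k → φ ◃ h k)) e (∑ K (λ k → φ ◃ g k)))
          where
          ring : ∀ s m h e w → (h + e) - s ≡ ((w + e) + (m + h)) - ((s + m) + w)
          ring = solve-∀ ringℚ

    -- `box-cover` needs nonnegative coefficients, so the negative parts of `s` are moved to the
    -- other side and interleaved with `h`. In the resulting inequality of volumes they contribute
    -- at most their own finite sum, which cancels.
    step-cover : ∀ ε → 0ℚ < ε → ∃[ K ] total vol s ≤ ∑ K (λ k → vol ◃ h k) + ε
    step-cover ε 0<ε = finish (box-cover n p (λ i → ⁺-nonneg (proj₁ (nth s i))) g 0≤g covered⁺ ε 0<ε)
      where
      covered⁺ : ∀ x ε → 0ℚ < ε → ∃[ K ] ∑ n (λ i → χ x ◃ p i) ≤ ∑ K (λ k → χ x ◃ g k) + ε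
      covered⁺ x ε 0<ε with covered x ε 0<ε
      ... | K , cov = (n ℕ.⊔ K) ℕ.+ (n ℕ.⊔ K) , to-cover (χ x) (χ-nonneg x) {K} {ε} cov
      finish : ∃[ K ] ∑ n (λ i → vol ◃ p i) ≤ ∑ K (λ k → vol ◃ g k) + ε →
               ∃[ K ] total vol s ≤ ∑ K (λ k → vol ◃ h k) + ε
      finish (K , q) = K , from-cover vol vol-nonneg {K} {ε} q

  -- Upper integrals

  -- Real functions are handled through their sequences of approximations: a
  -- statement about values at x is one that eventually holds for g x n.
  Fun : ℕ → Set
  Fun d = Cube d → ℕ → ℚ

  infix 4 _≲_
  _≲_ : ∀ {d} → Fun d → Fun d → Set
  f ≲ g = ∀ x ε → 0ℚ < ε → Eventually (λ n → f x n ≤ g x n + ε)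

  -- The counterpart of `UpperIntegral∣_∣≤_` for sequences that need not be Cauchy, so that products
  -- of functions can be formed termwise.
  record Upper {d} (g : Fun d) (q : ℚ) : Set where
    constructor upper
    field
      cover     : ℕ → Term d
      nonneg    : ∀ k → 0ℚ ≤ proj₁ (cover k)
      dominates : ∀ x ε → 0ℚ < ε → ∃[ K ] Eventually (λ n → ∣ g x n ∣ ≤ ∑ K (λ k → χ x ◃ cover k) + ε)
      bounded   : ∀ K → ∑ K (λ k → vol ◃ cover k) ≤ q
  open Upper

  halves : ∀ ε → ½ * ε + ½ * ε ≡ ε
  halves = solve-∀ ringℚ

  χ◃-nonneg : ∀ {d} (x : Cube d) t → 0ℚ ≤ proj₁ t → 0ℚ ≤ χ x ◃ t
  χ◃-nonneg x (c , B) 0≤c = *-nonneg 0≤c (χ-nonneg x B)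

  vol◃-nonneg : ∀ {d} (t : Term d) → 0ℚ ≤ proj₁ t → 0ℚ ≤ vol ◃ t
  vol◃-nonneg (c , B) 0≤c = *-nonneg 0≤c (vol-nonneg B)

  module _ {d : ℕ} where

    upper-≲ : ∀ {f k : Fun d} {p} → Upper f p → (λ x n → ∣ k x n ∣) ≲ (λ x n → ∣ f x n ∣) → Upper k p
    upper-≲ {f} {k} U h .cover     = cover U
    upper-≲ {f} {k} U h .nonneg    = nonneg U
    upper-≲ {f} {k} U h .bounded   = bounded U
    upper-≲ {f} {k} U h .dominates x ε 0<ε with dominates U x (½ * ε) (½-positive 0<ε)
    ... | K , D = K , ev-zip (λ {n} p q → ≤-trans q
        (lin p (ring ∣ f x n ∣ (∑ K (λ k → χ x ◃ cover U k)) ε)))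
      D (h x (½ * ε) (½-positive 0<ε))
      where
      ring : ∀ f s e → (s + e) - (f + ½ * e) ≡ (s + ½ * e) - f
      ring = solve-∀ ringℚ

    upper-≤ : ∀ {f : Fun d} {p q} → Upper f p → p ≤ q → Upper f q
    upper-≤ U p≤q = upper (cover U) (nonneg U) (dominates U) (λ K → ≤-trans (bounded U K) p≤q)

    upper-+ : ∀ {f g : Fun d} {p q} → Upper f p → Upper g q → Upper (λ x n → ∣ f x n ∣ + ∣ g x n ∣) (p + q)
    upper-+ {f} {g} {p} {q} U V = upper h 0≤h dom bound
      where
      h = interleave (cover U) (cover V)
      0≤h : ∀ k → 0ℚ ≤ proj₁ (h k)
      0≤h = interleave-all {P = λ t → 0ℚ ≤ proj₁ t} (nonneg U) (nonneg V)

      dom : ∀ x ε → 0ℚ < ε →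
        ∃[ K ] Eventually (λ n → ∣ ∣ f x n ∣ + ∣ g x n ∣ ∣ ≤ ∑ K (λ k → χ x ◃ h k) + ε)
      dom x ε 0<ε with dominates U x (½ * ε) (½-positive 0<ε) | dominates V x (½ * ε) (½-positive 0<ε)
      ... | K , D | L , E = N ℕ.+ N , ev-zip (λ {n} a b →
          ≤-trans (≤-reflexive (0≤p⇒∣p∣≡p (+-nonneg (0≤∣p∣ (f x n)) (0≤∣p∣ (g x n)))))
            (lin (a ⊕ b ⊕ merge) (ring ∣ f x n ∣ ∣ g x n ∣ (∑ K (λ k → χ x ◃ cover U k))
              (∑ L (λ k → χ x ◃ cover V k)) (∑ (N ℕ.+ N) (λ k → χ x ◃ h k)) ε))) D E
        where
        N = K ℕ.⊔ L
        merge : ∑ K (λ k → χ x ◃ cover U k) + ∑ L (λ k → χ x ◃ cover V k) ≤ ∑ (N ℕ.+ N) (λ k → χ x ◃ h k)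
        merge = ≤-trans
          (∑-extend (λ k → χ x ◃ cover U k) (λ k → χ◃-nonneg x (cover U k) (nonneg U k)) (ℕₚ.m≤m⊔n K L) ⊕
           ∑-extend (λ k → χ x ◃ cover V k) (λ k → χ◃-nonneg x (cover V k) (nonneg V k)) (ℕₚ.m≤n⊔m K L))
          (≤-reflexive (sym (∑-interleave (χ x ◃_) N (cover U) (cover V))))
        ring : ∀ f g s t h e → (h + e) - (f + g) ≡ ((s + ½ * e) + (t + ½ * e) + h) - (f + g + (s + t))
        ring = solve-∀ ringℚ

      bound : ∀ K → ∑ K (λ k → vol ◃ h k) ≤ p + q
      bound K = ≤-trans (∑-extend (λ k → vol ◃ h k) (λ k → vol◃-nonneg (h k) (0≤h k)) (ℕₚ.m≤m+n K K))
        (≤-trans (≤-reflexive (∑-interleave (vol ◃_) K (cover U) (cover V))) (bounded U K ⊕ bounded V K))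

    upper-* : ∀ c {f : Fun d} {p} → Upper f p → Upper (λ x n → c * f x n) (∣ c ∣ * p)
    upper-* c {f} {p} U = upper h (λ k → *-nonneg (0≤∣p∣ c) (nonneg U k)) dom bound
      where
      h : ℕ → Term d
      h k = ∣ c ∣ * proj₁ (cover U k) , proj₂ (cover U k)

      pull : ∀ (φ : Box d → ℚ) K → ∑ K (λ k → φ ◃ h k) ≡ ∣ c ∣ * ∑ K (λ k → φ ◃ cover U k)
      pull φ K = trans (∑-cong K (λ k _ → *-assoc ∣ c ∣ (proj₁ (cover U k)) (φ (proj₂ (cover U k)))))
        (∑-* K ∣ c ∣ (λ k → φ ◃ cover U k))

      dom : ∀ x ε → 0ℚ < ε → ∃[ K ] Eventually (λ n → ∣ c * f x n ∣ ≤ ∑ K (λ k → χ x ◃ h k) + ε)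
      dom x ε 0<ε with small-factor ∣ c ∣ ε (0≤∣p∣ c) 0<ε
      ... | η , 0<η , cη≤ε with dominates U x η 0<η
      ...   | K , D = K , ev-map (λ {n} a → ≤-trans (≤-reflexive (∣p*q∣≡∣p∣*∣q∣ c (f x n)))
          (lin (*-mono (0≤∣p∣ c) a ⊕ cη≤ε ⊕ ≤-reflexive (sym (pull (χ x) K)))
            (ring ∣ c ∣ ∣ f x n ∣ (∑ K (λ k → χ x ◃ cover U k)) (∑ K (λ k → χ x ◃ h k)) η ε))) D
        where
        ring : ∀ c f s h η e → (h + e) - c * f ≡ (c * (s + η) + e + h) - (c * f + c * η + c * s)
        ring = solve-∀ ringℚ

      bound : ∀ K → ∑ K (λ k → vol ◃ h k) ≤ ∣ c ∣ * p
      bound K = ≤-trans (≤-reflexive (pull vol K)) (*-mono (0≤∣p∣ c) (bounded U K))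

    upper-0 : ∀ {f : Fun d} → (∀ x ε → 0ℚ < ε → Eventually (λ n → ∣ f x n ∣ ≤ ε)) → Upper f 0ℚ
    upper-0 {f} h = upper (λ _ → 0ℚ , Vec.replicate d unit) (λ _ → ≤-refl)
      (λ x ε 0<ε → 0 , ev-map (λ {n} p → ≤-trans p (≤-reflexive (sym (+-identityˡ ε)))) (h x ε 0<ε))
      (λ K → ≤-reflexive (∑-zero K (λ k _ → *-zeroˡ (vol (Vec.replicate d unit)))))

    -- Boxes covering `N` with total volume β, where Cβ ≤ η, all receive the coefficient C.
    upper-null : ∀ (N : Pred (Cube d) 0ℓ) → Null N → ∀ C → 0ℚ ≤ C → ∀ η → 0ℚ < η →
                 Upper (λ x _ → C * 𝟙 (x ∈ N)) η
    upper-null N null C 0≤C η 0<η with small-factor C η 0≤C 0<η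
    ... | β , 0<β , Cβ≤η with null β 0<β
    ...   | B , covers , small = upper (λ k → C , B k) (λ _ → 0≤C) dom bound
      where
      pull : ∀ (φ : Box d → ℚ) K → ∑ K (λ k → C * φ (B k)) ≡ C * ∑ K (φ ∘ B)
      pull φ K = ∑-* K C (φ ∘ B)

      sum-map : ∀ (φ : Box d → ℚ) (B : ℕ → Box d) K → sumℚ (map φ (applyUpTo B K)) ≡ ∑ K (φ ∘ B)
      sum-map φ B ℕ.zero    = refl
      sum-map φ B (ℕ.suc K) = cong (φ (B 0) +_) (sum-map φ (B ∘ ℕ.suc) K)

      bound : ∀ K → ∑ K (λ k → C * vol (B k)) ≤ η
      bound K = ≤-trans (≤-reflexive (pull vol K)) (≤-trans
        (*-mono 0≤C (≤-trans (≤-reflexive (sym (sum-map vol B K))) (small K))) Cβ≤η)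

      once : ∀ x k → x ∈ᴮ B k → 1ℚ ≤ ∑ (ℕ.suc k) (χ x ∘ B)
      once x k x∈B = ≤-trans (≤-reflexive (sym (𝟙-true x∈B)))
        (≤-trans (lin (∑-nonneg k (λ i _ → χ-nonneg x (B i))) (ring (χ x (B k)) (∑ k (χ x ∘ B))))
          (≤-reflexive (sym (∑-last k (χ x ∘ B)))))
        where
        ring : ∀ a s → (s + a) - a ≡ s - 0ℚ
        ring = solve-∀ ringℚ

      dom : ∀ x ε → 0ℚ < ε → ∃[ K ] Eventually (λ n → ∣ C * 𝟙 (x ∈ N) ∣ ≤ ∑ K (λ k → C * χ x (B k)) + ε)
      dom x ε 0<ε = K , always λ n → ≤-trans
        (≤-reflexive (0≤p⇒∣p∣≡p (*-nonneg 0≤C (𝟙-nonneg (x ∈ N)))))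
        (lin (*-mono 0≤C (proj₂ K-bound) ⊕ ≤-reflexive (sym (pull (χ x) K)) ⊕ <⇒≤ 0<ε)
          (ring C (𝟙 (x ∈ N)) (∑ K (χ x ∘ B)) (∑ K (λ k → C * χ x (B k))) ε))
        where
        K-bound : ∃[ K ] 𝟙 (x ∈ N) ≤ ∑ K (χ x ∘ B)
        K-bound with em {x ∈ N}
        ... | no  _ = 0 , ≤-refl
        ... | yes x∈N with covers x x∈N
        ...   | k , x∈B = ℕ.suc k , once x k x∈B
        K = proj₁ K-bound
        ring : ∀ C i s t e → (t + e) - C * i ≡ (C * s + t + e) - (C * i + C * s + 0ℚ)
        ring = solve-∀ ringℚ

    from-UpperIntegral : ∀ {g : Cube d → ℝ} {q} → UpperIntegral∣ g ∣≤ q → Upper (λ x → seq (g x)) q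
    from-UpperIntegral {g} (h , 0≤h , dom , bound) = upper h 0≤h dom′
      (λ K → ≤-trans (≤-reflexive (sym (trans (∫≡ (applyUpTo h K)) (total-applyUpTo vol h K)))) (bound K))
      where
      dom′ : ∀ x ε → 0ℚ < ε → ∃[ K ] Eventually (λ n → ∣ seq (g x) n ∣ ≤ ∑ K (λ k → χ x ◃ h k) + ε)
      dom′ x ε 0<ε with dom x (½ * ε) (½-positive 0<ε)
      ... | K , p = K , ev-map (λ {n} q → lin
          (q ⊕ ≤-reflexive (trans (eval≡ (applyUpTo h K) x) (total-applyUpTo (χ x) h K)))
          (ring ∣ seq (g x) n ∣ (eval (applyUpTo h K) x) (∑ K (λ k → χ x ◃ h k)) ε)) (p (½ * ε) (½-positive 0<ε))
        where
        ring : ∀ a s t e → (t + e) - a ≡ ((s + ½ * e) + ½ * e + t) - (a + s)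
        ring = solve-∀ ringℚ

    to-UpperIntegral : ∀ {g : Cube d → ℝ} {q} → Upper (λ x → seq (g x)) q → UpperIntegral∣ g ∣≤ q
    to-UpperIntegral {g} {q} U = cover U , nonneg U , dom ,
      λ K → ≤-trans (≤-reflexive (trans (∫≡ (applyUpTo (cover U) K)) (total-applyUpTo vol (cover U) K))) (bounded U K)
      where
      dom : ∀ x ε → 0ℚ < ε → ∃[ K ] ∣ g x ∣ᵣ ≤ᵣ fromℚ (eval (applyUpTo (cover U) K) x + ε)
      dom x ε 0<ε with dominates U x ε 0<ε
      ... | K , D = K , λ ε′ 0<ε′ → ev-map (λ {n} a → lin
          (a ⊕ ≤-reflexive (sym (trans (eval≡ (applyUpTo (cover U) K) x) (total-applyUpTo (χ x) (cover U) K))) ⊕ <⇒≤ 0<ε′)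
          (ring ∣ seq (g x) n ∣ (eval (applyUpTo (cover U) K) x) (∑ K (λ k → χ x ◃ cover U k)) ε ε′)) D
        where
        ring : ∀ a s t e e′ → ((s + e) + e′) - a ≡ ((t + e) + s + e′) - (a + t + 0ℚ)
        ring = solve-∀ ringℚ

    upper-box : ∀ (B : Box d) → Upper (λ x _ → χ x B) (vol B)
    upper-box B = upper h 0≤h
      (λ x ε 0<ε → 1 , always λ _ → ≤-trans (≤-reflexive (0≤p⇒∣p∣≡p (χ-nonneg x B)))
        (lin (<⇒≤ 0<ε) (ring (χ x B) ε))) small
      where
      h : ℕ → Term d
      h ℕ.zero    = 1ℚ , B
      h (ℕ.suc _) = 0ℚ , B
      0≤h : ∀ k → 0ℚ ≤ proj₁ (h k)
      0≤h ℕ.zero    = 0≤1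
      0≤h (ℕ.suc _) = ≤-refl
      ring : ∀ a e → ((1ℚ * a + 0ℚ) + e) - a ≡ e - 0ℚ
      ring = solve-∀ ringℚ
      small : ∀ K → ∑ K (λ k → vol ◃ h k) ≤ vol B
      small ℕ.zero    = vol-nonneg B
      small (ℕ.suc K) = ≤-reflexive (trans
        (cong (1ℚ * vol B +_) (∑-zero K (λ k _ → *-zeroˡ (vol B))))
        (trans (+-identityʳ (1ℚ * vol B)) (*-identityˡ (vol B))))

  -- Approximate integrals

  -- ∣ ∫ f - i ∣ ≤ e, in the sense of the upper integral.
  record Approx {d} (f : Fun d) (i e : ℚ) : Set where
    constructor approx
    field
      step  : Step d
      close : Upper (λ x n → f x n - total (χ x) step) e
      integral : total vol step ≡ i
  open Approx

  module _ {d : ℕ} where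

    ≲-refl-≤ : ∀ {f g : Fun d} → (∀ x n → f x n ≤ g x n) → f ≲ g
    ≲-refl-≤ {f} {g} h x ε 0<ε = always λ n → lin (h x n ⊕ <⇒≤ 0<ε) (ring (f x n) (g x n) ε)
      where
      ring : ∀ a b e → (b + e) - a ≡ (b + e) - (a + 0ℚ)
      ring = solve-∀ ringℚ

    approx-+ : ∀ {f g : Fun d} {i j e δ} → Approx f i e → Approx g j δ → Approx (λ x n → f x n + g x n) (i + j) (e + δ)
    approx-+ {f} {g} (approx s S refl) (approx t T refl) = approx (s ++ t)
      (upper-≲ (upper-+ S T) (≲-refl-≤ λ x n → ≤-trans
        (≤-reflexive (cong ∣_∣ (trans (cong (λ z → (f x n + g x n) - z) (total-++ (χ x) s t))
          (ring (f x n) (g x n) (total (χ x) s) (total (χ x) t)))))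
        (≤-trans (∣p+q∣≤∣p∣+∣q∣ (f x n - total (χ x) s) (g x n - total (χ x) t))
          (a≤∣a∣ (∣ f x n - total (χ x) s ∣ + ∣ g x n - total (χ x) t ∣)))))
      (total-++ vol s t)
      where
      ring : ∀ a b c d → (a + b) - (c + d) ≡ (a - c) + (b - d)
      ring = solve-∀ ringℚ

    approx-* : ∀ c {f : Fun d} {i e} → Approx f i e → Approx (λ x n → c * f x n) (c * i) (∣ c ∣ * e)
    approx-* c {f} (approx s S refl) = approx (scale c s)
      (upper-≲ (upper-* c S) (≲-refl-≤ λ x n → ≤-reflexive (cong ∣_∣
        (trans (cong (λ z → c * f x n - z) (total-scale (χ x) c s)) (ring c (f x n) (total (χ x) s))))))
      (total-scale vol c s)
      where
      ring : ∀ a b c → a * b - a * c ≡ a * (b - c)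
      ring = solve-∀ ringℚ

    approx-≈ : ∀ {f g : Fun d} {i e δ} → Upper (λ x n → f x n - g x n) δ → Approx f i e → Approx g i (e + δ)
    approx-≈ {f} {g} D (approx s S v) = approx s
      (upper-≲ (upper-+ S D) (≲-refl-≤ λ x n → ≤-trans
        (≤-reflexive (cong ∣_∣ (ring (f x n) (g x n) (total (χ x) s))))
        (≤-trans (∣p-q∣≤∣p∣+∣q∣ (f x n - total (χ x) s) (f x n - g x n))
          (a≤∣a∣ (∣ f x n - total (χ x) s ∣ + ∣ f x n - g x n ∣)))))
      v
      where
      ring : ∀ a b c → b - c ≡ (a - c) - (a - b)
      ring = solve-∀ ringℚ

    approx-≡ : ∀ {f g : Fun d} {i j e} → (∀ x n → f x n ≡ g x n) → i ≡ j → Approx f i e → Approx g j e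
    approx-≡ {f} {g} h refl (approx s S v) = approx s
      (upper-≲ S (≲-refl-≤ λ x n → ≤-reflexive (cong (λ z → ∣ z - total (χ x) s ∣) (sym (h x n))))) v

    approx-weaken : ∀ {f : Fun d} {i e δ} → e ≤ δ → Approx f i e → Approx f i δ
    approx-weaken e≤δ (approx s S v) = approx s (upper-≤ S e≤δ) v

    approx-0 : Approx {d} (λ _ _ → 0ℚ) 0ℚ 0ℚ
    approx-0 = approx [] (upper-0 λ x ε 0<ε → always λ _ → <⇒≤ 0<ε) refl

    approx-∑ : ∀ N {f : ℕ → Fun d} {i e : ℕ → ℚ} → (∀ k → k ℕ.< N → Approx (f k) (i k) (e k)) →
               Approx (λ x n → ∑ N (λ k → f k x n)) (∑ N i) (∑ N e)
    approx-∑ ℕ.zero    h = approx-0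
    approx-∑ (ℕ.suc N) h = approx-+ (h 0 (ℕ.s≤s ℕ.z≤n)) (approx-∑ N (λ k k<N → h (ℕ.suc k) (ℕ.s≤s k<N)))

    module _ {f g : Fun d} (f≲g : f ≲ g) (s t : Step d) {q : ℚ}
             (U : Upper (λ x n → ∣ f x n - total (χ x) s ∣ + ∣ g x n - total (χ x) t ∣) q) where

      private
        u : Step d
        u = s ++ scale (- 1ℚ) t

        total-u : ∀ (φ : Box d → ℚ) → total φ u ≡ total φ s - total φ t
        total-u φ = trans (total-++ φ s (scale (- 1ℚ) t))
          (trans (cong (total φ s +_) (total-scale φ (- 1ℚ) t)) (ring (total φ s) (total φ t)))
          where
          ring : ∀ a b → a + (- 1ℚ) * b ≡ a - b
          ring = solve-∀ ringℚ

        covered : ∀ x ε → 0ℚ < ε → ∃[ K ] total (χ x) u ≤ ∑ K (λ k → χ x ◃ Upper.cover U k) + ε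
        covered x ε 0<ε with Upper.dominates U x (½ * ε) (½-positive 0<ε)
        -- The inequality obtained is between rationals independent of `n`, so one late index
        -- suffices.
        ... | K , D = K , proj₂ (ev-here (ev-zip (λ {n} a b → ≤-trans (≤-reflexive (total-u (χ x)))
            (lin (a ⊕ b ⊕ a≤∣a∣ (∣ f x n - total (χ x) s ∣ + ∣ g x n - total (χ x) t ∣)
                    ⊕ -a≤∣a∣ (f x n - total (χ x) s) ⊕ a≤∣a∣ (g x n - total (χ x) t))
              (ring (f x n) (g x n) (total (χ x) s) (total (χ x) t)
                (∣ f x n - total (χ x) s ∣) (∣ g x n - total (χ x) t ∣)
                (∣ ∣ f x n - total (χ x) s ∣ + ∣ g x n - total (χ x) t ∣ ∣)
                (∑ K (λ k → χ x ◃ Upper.cover U k)) ε))) D (f≲g x (½ * ε) (½-positive 0<ε))))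
          where
          ring : ∀ f g s t p q r h e → (h + e) - (s - t) ≡
            ((h + ½ * e) + (g + ½ * e) + r + p + q) - (r + f + (p + q) + - (f - s) + (g - t))
          ring = solve-∀ ringℚ

      -- From f ≤ g, the step function s - t is pointwise at most ∣ f - s ∣ + ∣ g - t ∣;
      -- `step-cover` turns the series for that sum into a bound on the integral of s - t.
      ∫-mono : ∀ ε → 0ℚ < ε → total vol s ≤ (total vol t + q) + ε
      ∫-mono ε 0<ε = finish (step-cover u (Upper.cover U) (Upper.nonneg U) covered ε 0<ε)
        where
        finish : ∃[ K ] total vol u ≤ ∑ K (λ k → vol ◃ Upper.cover U k) + ε →
                 total vol s ≤ (total vol t + q) + ε
        finish (K , h) = lin (≤-trans (≤-reflexive (sym (total-u vol))) h ⊕ Upper.bounded U K)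
          (ring (total vol s) (total vol t) (∑ K (λ k → vol ◃ Upper.cover U k)) q ε)
          where
          ring : ∀ s t k q e → ((t + q) + e) - s ≡ ((k + e) + q) - ((s - t) + k)
          ring = solve-∀ ringℚ

    approx-mono : ∀ {f g : Fun d} {i j e δ} → f ≲ g → Approx f i e → Approx g j δ → i ≤ j + (e + δ)
    approx-mono {f} {g} f≲g (approx s S refl) (approx t T refl) = ≤-closure (∫-mono {f} {g} f≲g s t (upper-+ S T))

    approx-unique : ∀ {f : Fun d} {i j e δ} → Approx f i e → Approx f j δ → ∣ i - j ∣ ≤ e + δ
    approx-unique {f} {i} {j} {e} {δ} A B = ∣∣-bound
      (lin (approx-mono {f} {f} f≲f A B) (ring₁ i j e δ)) (lin (approx-mono {f} {f} f≲f B A) (ring₂ i j e δ))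
      where
      f≲f : f ≲ f
      f≲f = ≲-refl-≤ λ x n → ≤-refl
      ring₁ : ∀ i j e d → (e + d) - (i - j) ≡ (j + (e + d)) - i
      ring₁ = solve-∀ ringℚ
      ring₂ : ∀ i j e d → (e + d) - (- (i - j)) ≡ (i + (d + e)) - j
      ring₂ = solve-∀ ringℚ

  Integral≤ : ∀ {d} → Fun d → ℚ → ℚ → Set
  Integral≤ f b e = Σ[ i ∈ ℚ ] ∣ i ∣ ≤ b × Approx f i e

  square : (I → I → ℝ) → Fun 2
  square F x = seq (onSquare F x)

  ∈¹-measurable : ∀ J → MeasurableSubset (_∈¹ J)
  ∈¹-measurable J = record
    { respects     = λ { {x} {y} x≃y (lo≤x , x≤hi) →
        (λ ε 0<ε → ev-zip (λ {n} p q → lin (p ⊕ q ⊕ a≤∣a∣ (seq (real x) n - seq (real y) n))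
            (ring₁ (lo J) (seq (real x) n) (seq (real y) n) _ ε))
          (lo≤x (½ * ε) (½-positive 0<ε)) (x≃y (½ * ε) (½-positive 0<ε))) ,
        (λ ε 0<ε → ev-zip (λ {n} p q → lin (p ⊕ q ⊕ -a≤∣a∣ (seq (real x) n - seq (real y) n))
            (ring₂ (hi J) (seq (real x) n) (seq (real y) n) _ ε))
          (x≤hi (½ * ε) (½-positive 0<ε)) (x≃y (½ * ε) (½-positive 0<ε))) }
    -- The interval is itself elementary, so the symmetric difference is empty and degenerate boxes
    -- cover it.
    ; isMeasurable = λ ε 0<ε → (J ∷ []) ∷ [] , (λ _ → point) ,
        (λ { (x ∷ []) (inj₁ (x∈J , x∉J)) → contradiction (here (x∈J ∷ [])) x∉J
           ; (x ∷ []) (inj₂ (here (x∈J ∷ []) , x∉J)) → contradiction x∈J x∉J }) ,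
        (λ K → ≤-trans (≤-reflexive (no-volume K)) (<⇒≤ 0<ε))
    }
    where
    ring₁ : ∀ l x y a e → (y + e) - l ≡ ((x + ½ * e) + ½ * e + a) - (l + a + (x - y))
    ring₁ = solve-∀ ringℚ
    ring₂ : ∀ h x y a e → (h + e) - y ≡ ((h + ½ * e) + ½ * e + a) - (x + a + - (x - y))
    ring₂ = solve-∀ ringℚ
    point : Box 1
    point = record { lo = 0ℚ ; hi = 0ℚ ; 0≤lo = ≤-refl ; lo≤hi = ≤-refl ; hi≤1 = 0≤1 } ∷ []
    no-volume : ∀ K → sumℚ (map vol (applyUpTo (λ _ → point) K)) ≡ 0ℚ
    no-volume ℕ.zero    = refl
    no-volume (ℕ.suc K) = trans (cong (0ℚ +_) (no-volume K)) refl

  -- A box is a rectangle with measurable sides, so the cut norm provides its integral together with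
  -- the bound; η accounts for passing from the real integral to that of a step function.
  box-integral : ∀ F {δ} → ‖ F ‖□≤ δ → ∀ (B : Box 2) η → 0ℚ < η →
    Integral≤ (λ x n → χ x B * square F x n) (δ + η) η
  box-integral F {δ} F≤δ B@(J ∷ L ∷ []) η 0<η = read (F≤δ (_∈¹ J) (_∈¹ L) (∈¹-measurable J) (∈¹-measurable L))
    where
    G : Cube 2 → ℝ
    G = restrict (Rectangle (_∈¹ J) (_∈¹ L)) (onSquare F)

    same : ∀ x n → seq (G x) n ≡ χ x B * square F x n
    same x@(x₁ ∷ x₂ ∷ []) n = trans pick (cong (_* square F x n) (𝟙-cong {x ∈ Rectangle (_∈¹ J) (_∈¹ L)}
        (λ { (p , q) → p ∷ q ∷ [] }) (λ { (p ∷ q ∷ []) → p , q })))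
      where
      pick : seq (G x) n ≡ 𝟙 (x ∈ Rectangle (_∈¹ J) (_∈¹ L)) * square F x n
      pick with em {x ∈ Rectangle (_∈¹ J) (_∈¹ L)}
      ... | yes _ = sym (*-identityˡ _)
      ... | no  _ = sym (*-zeroˡ (square F x n))

    read : ∃[ r ] (∫ G ≈ r) × ∣ r ∣ᵣ ≤ᵣ fromℚ δ →
           Integral≤ (λ x n → χ x B * square F x n) (δ + η) η
    read (r , ∫G , r≤δ) with ∫G (½ * η) (½-positive 0<η)
    ... | s , U , r-s = total vol s , small , approx s
        (upper-≤ (upper-≲ (from-UpperIntegral {g = λ x → G x -ᵣ fromℚ (eval s x)} U) (≲-refl-≤ λ x n → ≤-reflexive (cong ∣_∣
          (cong₂ _-_ (sym (same x n)) (sym (eval≡ s x)))))) (halve≤)) refl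
      where
      halve≤ : ½ * η ≤ η
      halve≤ = lin (½ ⊛ <⇒≤ 0<η) (ring₀ η)
        where
        ring₀ : ∀ e → e - ½ * e ≡ ½ * e - ½ * 0ℚ
        ring₀ = solve-∀ ringℚ
      quarter = ½ * (½ * η)
      0<quarter : 0ℚ < quarter
      0<quarter = ½-positive (½-positive 0<η)
      small : ∣ total vol s ∣ ≤ δ + η
      small = proj₂ (ev-here (ev-zip (λ {n} p q → lin
          (p ⊕ q ⊕ ∣p-q∣≤∣p∣+∣q∣ (seq r n) (seq r n - ∫step s) ⊕ ≤-reflexive (cong ∣_∣
            (trans (sym (∫≡ s)) (back (seq r n) (∫step s)))))
          (ring (∣ seq r n ∣) (∣ seq r n - ∫step s ∣) (∣ seq r n - (seq r n - ∫step s) ∣) (∣ total vol s ∣) δ η))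
        (r≤δ quarter 0<quarter) (r-s quarter 0<quarter)))
        where
        back : ∀ a b → b ≡ a - (a - b)
        back = solve-∀ ringℚ
        ring : ∀ a b c t d e → (d + e) - t ≡
          ((d + ½ * (½ * e)) + (½ * e + ½ * (½ * e)) + (a + b) + c) - (a + b + c + t)
        ring = solve-∀ ringℚ

  -- The rational values at precision 2^(-m) form a Cauchy sequence by `approx-unique`, and their
  -- limit is the integral.
  to-‖‖₁ : ∀ F {q} → (∀ η → 0ℚ < η → Σ[ i ∈ ℚ ] i ≤ q + η × Approx (λ x n → ∣ square F x n ∣) i η) → ‖ F ‖₁≤ q
  to-‖‖₁ F {q} h = r , ∫≈r , bound
    where
    at : ∀ m → Σ[ i ∈ ℚ ] i ≤ q + 2⁻^ m × Approx (λ x n → ∣ square F x n ∣) i (2⁻^ m)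
    at m = h (2⁻^ m) (2⁻-positive m)
    i : ℕ → ℚ
    i m = proj₁ (at m)
    ap : ∀ m → Approx (λ x n → ∣ square F x n ∣) (i m) (2⁻^ m)
    ap m = proj₂ (proj₂ (at m))

    double : ∀ N → 2⁻^ (ℕ.suc N) + 2⁻^ (ℕ.suc N) ≡ 2⁻^ N
    double N = halves (2⁻^ N)

    near : ∀ N m n → ℕ.suc N ℕ.≤ m → ℕ.suc N ℕ.≤ n → ∣ i m - i n ∣ ≤ 2⁻^ N
    near N m n N<m N<n = ≤-trans (approx-unique (ap m) (ap n))
      (≤-trans (2⁻-antitone N<m ⊕ 2⁻-antitone N<n) (≤-reflexive (double N)))

    converges : ∀ ε → 0ℚ < ε → ∃[ N ] (∀ m n → N ℕ.≤ m → N ℕ.≤ n → ∣ i m - i n ∣ ≤ ε)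
    converges ε 0<ε = let N , small = archimedean ε 0<ε in
      ℕ.suc N , λ m n N<m N<n → ≤-trans (near N m n N<m N<n) small

    r : ℝ
    r = record { seq = i ; cauchy = converges }

    bound : r ≤ᵣ fromℚ q
    bound ε 0<ε = let N , small = archimedean ε 0<ε in
      N , λ n N≤n → ≤-trans (proj₁ (proj₂ (at n))) (≤-refl {q} ⊕ ≤-trans (2⁻-antitone N≤n) small)

    ∫≈r : ∫ (λ x → ∣ onSquare F x ∣ᵣ) ≈ r
    ∫≈r ε 0<ε = from (archimedean ε 0<ε)
      where
      from : ∃[ N ] 2⁻^ N ≤ ε → Σ[ s ∈ Step 2 ]
        (UpperIntegral∣ (λ x → ∣ onSquare F x ∣ᵣ -ᵣ fromℚ (eval s x)) ∣≤ ε) × (∣ r -ᵣ fromℚ (∫step s) ∣ᵣ ≤ᵣ fromℚ ε)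
      from (N , small) = s ,
        to-UpperIntegral {g = λ x → ∣ onSquare F x ∣ᵣ -ᵣ fromℚ (eval s x)} (upper-≤ (upper-≲ (close (ap M)) (≲-refl-≤ λ x n → ≤-reflexive
          (cong (λ z → ∣ ∣ square F x n ∣ - z ∣) (eval≡ s x)))) (≤-trans (2⁻-antitone (ℕₚ.n≤1+n N)) small)) ,
        λ ε′ 0<ε′ → M , λ n M≤n → ≤-trans
          (≤-reflexive (cong (λ z → ∣ i n - z ∣) (trans (∫≡ s) (integral (ap M)))))
          (≤-trans (near N n M M≤n ℕₚ.≤-refl) (lin (small ⊕ <⇒≤ 0<ε′) (ring (2⁻^ N) ε ε′)))
        where
        M = ℕ.suc N
        s : Step 2
        s = step (ap M)
        ring : ∀ a e e′ → (e + e′) - a ≡ (e + e′) - (a + 0ℚ)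
        ring = solve-∀ ringℚ

  -- Grids and step graphons

  frac-≤ : ∀ a b m n .{{_ : NonZero m}} .{{_ : NonZero n}} → a ℕ.* n ℕ.≤ b ℕ.* m → ℤ.+ a / m ≤ ℤ.+ b / n
  frac-≤ a b m n h = *-cancel (*-positive (ι-positive m) (ι-positive n)) (begin
    (ι m * ι n) * (ℤ.+ a / m)  ≡⟨ ring₁ (ι m) (ι n) (ℤ.+ a / m) ⟩
    ((ℤ.+ a / m) * ι m) * ι n  ≡⟨ cong (_* ι n) (/-ι a m) ⟩
    ι a * ι n                  ≡⟨ ι-* a n ⟨
    ι (a ℕ.* n)                ≤⟨ ι-mono h ⟩
    ι (b ℕ.* m)                ≡⟨ ι-* b m ⟩
    ι b * ι m                  ≡⟨ cong (_* ι m) (/-ι b n) ⟨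
    ((ℤ.+ b / n) * ι n) * ι m  ≡⟨ ring₂ (ι m) (ι n) (ℤ.+ b / n) ⟩
    (ι m * ι n) * (ℤ.+ b / n)  ∎)
    where
    open ≤-Reasoning
    ring₁ : ∀ m n a → (m * n) * a ≡ (a * m) * n
    ring₁ = solve-∀ ringℚ
    ring₂ : ∀ m n a → (a * n) * m ≡ (m * n) * a
    ring₂ = solve-∀ ringℚ

  frac-diff : ∀ p N .{{_ : NonZero N}} → (ℤ.+ ℕ.suc p / N) - (ℤ.+ p / N) ≡ ℤ.+ 1 / N
  frac-diff p N = trans (trans (sym (*-identityʳ _)) (trans (cong (((ℤ.+ ℕ.suc p / N) - (ℤ.+ p / N)) *_) (sym inv))
      (trans (expand (ℤ.+ ℕ.suc p / N) (ℤ.+ p / N) (ι N) (ℤ.+ 1 / N)) (cong (_* (ℤ.+ 1 / N)) numerators))))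
    (*-identityˡ (ℤ.+ 1 / N))
    where
    inv : ι N * (ℤ.+ 1 / N) ≡ 1ℚ
    inv = trans (*-comm (ι N) (ℤ.+ 1 / N)) (trans (/-ι 1 N) ι-1)
    expand : ∀ a b n e → (a - b) * (n * e) ≡ (a * n - b * n) * e
    expand = solve-∀ ringℚ
    cancel : ∀ a → (1ℚ + a) - a ≡ 1ℚ
    cancel = solve-∀ ringℚ
    numerators : (ℤ.+ ℕ.suc p / N) * ι N - (ℤ.+ p / N) * ι N ≡ 1ℚ
    numerators = trans (cong₂ _-_ (trans (/-ι (ℕ.suc p) N) (ι-suc p)) (/-ι p N)) (cancel (ι p))

  -- If some late term were below c - ε, the Cauchy property would keep all later ones below c -
  -- ε/2, which is x < c.
  ≤ᵣ⊎<ᵣ : ∀ x c → fromℚ c ≤ᵣ x ⊎ x <ᵣ fromℚ c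
  ≤ᵣ⊎<ᵣ x c with em {fromℚ c ≤ᵣ x}
  ... | yes c≤x = inj₁ c≤x
  ... | no  c≰x = inj₂ (by-contradiction λ x≮c → c≰x λ ε 0<ε → from x≮c ε 0<ε (cauchy x (½ * ε) (½-positive 0<ε)))
    where
    from : ¬ (x <ᵣ fromℚ c) → ∀ ε → 0ℚ < ε →
      ∃[ N ] (∀ m n → N ℕ.≤ m → N ℕ.≤ n → ∣ seq x m - seq x n ∣ ≤ ½ * ε) →
      Eventually (λ n → c ≤ seq x n + ε)
    from x≮c ε 0<ε (N , close) = N , λ m N≤m → ≮⇒≥ λ x+ε<c → x≮c (½ * ε , ½-positive 0<ε , N , λ n N≤n →
      lin (<⇒≤ x+ε<c ⊕ close m n N≤m N≤n ⊕ -a≤∣a∣ (seq x m - seq x n))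
        (ring (seq x m) (seq x n) (∣ seq x m - seq x n ∣) ε c))
      where
      ring : ∀ a b d e c → c - (b + ½ * e) ≡ (c + ½ * e + d) - ((a + e) + d + - (a - b))
      ring = solve-∀ ringℚ

  <ᵣ-≤ᵣ-contradiction : ∀ {x c c′} → x <ᵣ fromℚ c → c ≤ c′ → ¬ (fromℚ c′ ≤ᵣ x)
  <ᵣ-≤ᵣ-contradiction {x} {c} {c′} (ε , 0<ε , x<c) c≤c′ c′≤x =
    <-irrefl refl (<-≤-trans 0<ε (proj₂ (ev-here (ev-zip
      (λ {n} p q → lin (p ⊕ q ⊕ c≤c′ ⊕ p ⊕ q ⊕ c≤c′) (ring (seq x n) c c′ ε))
      x<c (c′≤x (½ * ε) (½-positive 0<ε))))))
    where
    ring : ∀ x c c′ e → 0ℚ - e ≡ (c + (x + ½ * e) + c′ + c + (x + ½ * e) + c′) -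
                                 ((x + e) + c′ + c + (x + e) + c′ + c)
    ring = solve-∀ ringℚ

  -- `InPart` with a natural number as index, to which finite sums and division of indices apply.
  Part : (N : ℕ) .{{_ : NonZero N}} → ℕ → I → Set
  Part N p x = fromℚ (ℤ.+ p / N) ≤ᵣ real x × (real x <ᵣ fromℚ (ℤ.+ ℕ.suc p / N) ⊎ ℕ.suc p ≡ N)

  module _ (N : ℕ) .{{_ : NonZero N}} where

    Part⇒InPart : ∀ {p} (p<N : p ℕ.< N) {x} → Part N p x → InPart N (fromℕ< p<N) x
    Part⇒InPart {p} p<N {x} = subst (λ k → Part N k x) (sym (toℕ-fromℕ< p<N))

    -- Left end points are scanned upwards; the countdown reaches 0 exactly at the last part, which
    -- has no upper condition.
    part-exists : ∀ x → ∃[ p ] p ℕ.< N × Part N p x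
    part-exists x = search (ℕ.pred N) 0 (trans (cong ℕ.suc (ℕₚ.+-identityʳ (ℕ.pred N))) (ℕₚ.suc-pred N)) zero≤x
      where
      zero≤x : fromℚ (ℤ.+ 0 / N) ≤ᵣ real x
      zero≤x = subst (λ z → fromℚ z ≤ᵣ real x) (sym (0/n≡0 N)) (0≤real x)
      search : ∀ k p → ℕ.suc (k ℕ.+ p) ≡ N → fromℚ (ℤ.+ p / N) ≤ᵣ real x → ∃[ p ] p ℕ.< N × Part N p x
      search ℕ.zero    p e p≤x = p , ℕₚ.≤-reflexive e , p≤x , inj₂ e
      search (ℕ.suc k) p e p≤x with ≤ᵣ⊎<ᵣ (real x) (ℤ.+ ℕ.suc p / N)
      ... | inj₁ 1+p≤x = search k (ℕ.suc p) (trans (cong ℕ.suc (ℕₚ.+-suc k p)) e) 1+p≤x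
      ... | inj₂ x<1+p = p , subst (p ℕ.<_) e (ℕ.s≤s (ℕₚ.m≤n+m p (ℕ.suc k))) , p≤x , inj₁ x<1+p

    private
      disjoint : ∀ {p q x} → p ℕ.< q → q ℕ.< N → Part N p x → ¬ Part N q x
      disjoint {p} {q} {x} p<q q<N (_ , inj₁ x<1+p) (q≤x , _) = <ᵣ-≤ᵣ-contradiction {real x} x<1+p
        (frac-≤ (ℕ.suc p) q N N (ℕₚ.*-monoˡ-≤ N p<q)) q≤x
      disjoint p<q q<N (_ , inj₂ 1+p≡N) _ = contradiction (ℕₚ.<-≤-trans q<N (ℕₚ.≤-reflexive (sym 1+p≡N)))
        (ℕₚ.<⇒≱ (ℕ.s≤s p<q))

    part-unique : ∀ {p q x} → p ℕ.< N → q ℕ.< N → Part N p x → Part N q x → p ≡ q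
    part-unique {p} {q} {x} p<N q<N P Q with ℕₚ.<-cmp p q
    ... | tri< p<q _ _ = contradiction Q (disjoint {x = x} p<q q<N P)
    ... | tri≈ _ p≡q _ = p≡q
    ... | tri> _ _ q<p = contradiction P (disjoint {x = x} q<p p<N Q)

    Cell : ℕ → ℕ → Cube 2 → Set
    Cell p q (x ∷ y ∷ []) = Part N p x × Part N q y

    grid : (ℕ → ℕ → ℚ) → Cube 2 → ℚ
    grid w x = ∑ N (λ a → ∑ N (λ b → w a b * 𝟙 (Cell a b x)))

    cell-exists : ∀ x → ∃[ p ] ∃[ q ] p ℕ.< N × q ℕ.< N × Cell p q x
    cell-exists (x ∷ y ∷ []) with part-exists x | part-exists y
    ... | p , p<N , P | q , q<N , Q = p , q , p<N , q<N , P , Q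

    grid-at : ∀ w x {p q} → p ℕ.< N → q ℕ.< N → Cell p q x → grid w x ≡ w p q
    grid-at w (x ∷ y ∷ []) {p} {q} p<N q<N (P , Q) =
        trans (∑-single N p p<N λ a a<N a≢p → ∑-zero N λ b b<N → off (w a b)
                λ (A , B) → a≢p (part-unique {x = x} a<N p<N A P))
          (trans (∑-single N q q<N λ b b<N b≢q → off (w p b)
                λ (A , B) → b≢q (part-unique {x = y} b<N q<N B Q))
            (trans (cong (w p q *_) (𝟙-true (P , Q))) (*-identityʳ (w p q))))
      where
      off : ∀ c {P : Set} → ¬ P → c * 𝟙 P ≡ 0ℚ
      off c ¬P = trans (cong (c *_) (𝟙-false ¬P)) (*-zeroʳ c)

    interval : ∀ {p} → p ℕ.< N → Interval
    interval {p} p<N = record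
      { lo = ℤ.+ p / N ; hi = ℤ.+ ℕ.suc p / N
      ; 0≤lo  = ≤-trans (≤-reflexive (sym (0/n≡0 N))) (frac-≤ 0 p N N ℕ.z≤n)
      ; lo≤hi = frac-≤ p (ℕ.suc p) N N (ℕₚ.*-monoˡ-≤ N (ℕₚ.n≤1+n p))
      ; hi≤1  = frac-≤ (ℕ.suc p) 1 N 1 (ℕₚ.≤-trans (ℕₚ.≤-reflexive (ℕₚ.*-identityʳ (ℕ.suc p)))
                  (ℕₚ.≤-trans p<N (ℕₚ.≤-reflexive (sym (ℕₚ.+-identityʳ N)))))
      }

    cellBox : ∀ {p q} → p ℕ.< N → q ℕ.< N → Box 2
    cellBox p<N q<N = interval p<N ∷ interval q<N ∷ []

    private
      -- The right end point as a degenerate interval: only there can the closed interval leave its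
      -- half-open part.
      end : Interval → Interval
      end J = record { lo = hi J ; hi = hi J ; 0≤lo = ≤-trans (0≤lo J) (lo≤hi J) ; lo≤hi = ≤-refl ; hi≤1 = hi≤1 J }

      part⇒∈ : ∀ {p} (p<N : p ℕ.< N) x → Part N p x → x ∈¹ interval p<N
      part⇒∈ {p} p<N x (p≤x , inj₁ (δ , 0<δ , x<1+p)) = p≤x , λ ε 0<ε →
        ev-map (λ {n} h → lin (h ⊕ <⇒≤ 0<δ ⊕ <⇒≤ 0<ε) (ring (seq (real x) n) (ℤ.+ ℕ.suc p / N) δ ε)) x<1+p
        where
        ring : ∀ x p d e → (p + e) - x ≡ (p + d + e) - ((x + d) + 0ℚ + 0ℚ)
        ring = solve-∀ ringℚ
      part⇒∈ {p} p<N x (p≤x , inj₂ 1+p≡N) = p≤x , subst (λ z → real x ≤ᵣ fromℚ z)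
        (≤-antisym (frac-≤ 1 (ℕ.suc p) 1 N (ℕₚ.≤-reflexive (trans (ℕₚ.*-identityˡ N) (trans (sym 1+p≡N) (sym (ℕₚ.*-identityʳ (ℕ.suc p)))))))
                   (frac-≤ (ℕ.suc p) 1 N 1 (ℕₚ.≤-reflexive (trans (ℕₚ.*-identityʳ (ℕ.suc p)) (trans 1+p≡N (sym (ℕₚ.*-identityˡ N)))))))
        (real≤1 x)

      ∈⇒part⊎end : ∀ {p} (p<N : p ℕ.< N) x → x ∈¹ interval p<N → Part N p x ⊎ x ∈¹ end (interval p<N)
      ∈⇒part⊎end {p} p<N x (p≤x , x≤1+p) with ≤ᵣ⊎<ᵣ (real x) (ℤ.+ ℕ.suc p / N)
      ... | inj₁ 1+p≤x = inj₂ (1+p≤x , x≤1+p)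
      ... | inj₂ x<1+p = inj₁ (p≤x , inj₁ x<1+p)

      ∈unit : ∀ x → x ∈¹ unit
      ∈unit x = 0≤real x , real≤1 x

    -- A cell and its closure differ on two degenerate boxes.
    cell-closure : ∀ {p q} (p<N : p ℕ.< N) (q<N : q ℕ.< N) →
      Upper (λ x _ → χ x (cellBox p<N q<N) - 𝟙 (Cell p q x)) 0ℚ
    cell-closure {p} {q} p<N q<N =
      upper-≤ (upper-≲ (upper-+ (upper-box E₁) (upper-box E₂)) (≲-refl-≤ λ x _ → bound x)) no-volume
      where
      E₁ E₂ : Box 2
      E₁ = end (interval p<N) ∷ unit ∷ []
      E₂ = unit ∷ end (interval q<N) ∷ []

      no-volume : vol E₁ + vol E₂ ≤ 0ℚ
      no-volume = ≤-reflexive (trans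
        (cong₂ (λ a b → a * ((1ℚ - 0ℚ) * 1ℚ) + (1ℚ - 0ℚ) * (b * 1ℚ))
          (+-inverseʳ (ℤ.+ ℕ.suc p / N)) (+-inverseʳ (ℤ.+ ℕ.suc q / N))) refl)

      one : ∀ {a b : ℚ} → 1ℚ ≤ a → 0ℚ ≤ b → 1ℚ ≤ ∣ a ∣ + ∣ b ∣
      one {a} {b} 1≤a 0≤b = lin (1≤a ⊕ a≤∣a∣ a ⊕ 0≤∣p∣ b) (ring a (∣ a ∣) (∣ b ∣))
        where
        ring : ∀ a c d → (c + d) - 1ℚ ≡ (a + c + d) - (1ℚ + a + 0ℚ)
        ring = solve-∀ ringℚ

      abs≤1 : ∀ {a b : ℚ} {c} → 0ℚ ≤ a → a ≤ 1ℚ → 0ℚ ≤ b → b ≤ 1ℚ → 1ℚ ≤ c → ∣ a - b ∣ ≤ ∣ c ∣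
      abs≤1 {a} {b} {c} 0≤a a≤1 0≤b b≤1 1≤c = ∣∣-bound
        (lin (a≤1 ⊕ 0≤b ⊕ 1≤c ⊕ a≤∣a∣ c) (ring₁ a b c (∣ c ∣)))
        (lin (b≤1 ⊕ 0≤a ⊕ 1≤c ⊕ a≤∣a∣ c) (ring₂ a b c (∣ c ∣)))
        where
        ring₁ : ∀ a b c d → d - (a - b) ≡ (1ℚ + b + c + d) - (a + 0ℚ + 1ℚ + c)
        ring₁ = solve-∀ ringℚ
        ring₂ : ∀ a b c d → d - (- (a - b)) ≡ (1ℚ + a + c + d) - (b + 0ℚ + 1ℚ + c)
        ring₂ = solve-∀ ringℚ

      same : ∀ {a b : ℚ} c → a ≡ b → ∣ a - b ∣ ≤ ∣ c ∣
      same {a} c refl = ≤-trans (≤-reflexive (cong ∣_∣ (+-inverseʳ a))) (0≤∣p∣ c)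

      bound : ∀ x → ∣ χ x (cellBox p<N q<N) - 𝟙 (Cell p q x) ∣ ≤ ∣ ∣ χ x E₁ ∣ + ∣ χ x E₂ ∣ ∣
      bound z@(x ∷ y ∷ []) = cases em em
        where
        Goal = ∣ χ z (cellBox p<N q<N) - 𝟙 (Cell p q z) ∣ ≤ ∣ ∣ χ z E₁ ∣ + ∣ χ z E₂ ∣ ∣
        cases : Dec (Cell p q z) → Dec (z ∈ᴮ cellBox p<N q<N) → Goal
        cases (yes (P , Q)) _ = same _ (trans (𝟙-true (part⇒∈ p<N x P ∷ part⇒∈ q<N y Q ∷ [])) (sym (𝟙-true (P , Q))))
        cases (no ∉) (no ∉′) = same _ (trans (𝟙-false ∉′) (sym (𝟙-false ∉)))
        cases (no ∉) (yes (x∈ ∷ y∈ ∷ [])) = abs≤1 (χ-nonneg z (cellBox p<N q<N)) (𝟙≤1 _) (𝟙-nonneg _) (𝟙≤1 _)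
            (on-edge (∈⇒part⊎end p<N x x∈) (∈⇒part⊎end q<N y y∈))
          where
          on-edge : Part N p x ⊎ x ∈¹ end (interval p<N) → Part N q y ⊎ y ∈¹ end (interval q<N) →
                    1ℚ ≤ ∣ χ z E₁ ∣ + ∣ χ z E₂ ∣
          on-edge (inj₂ e) _ = one (≤-reflexive (sym (𝟙-true (e ∷ ∈unit y ∷ [])))) (χ-nonneg z E₂)
          on-edge _ (inj₂ e) = ≤-trans (one (≤-reflexive (sym (𝟙-true (∈unit x ∷ e ∷ [])))) (χ-nonneg z E₁))
            (≤-reflexive (+-comm (∣ χ z E₂ ∣) (∣ χ z E₁ ∣)))
          on-edge (inj₁ P) (inj₁ Q) = contradiction (P , Q) ∉

  approx-∑-bounded : ∀ N {d} {f : ℕ → Fun d} {b e : ℚ} →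
    (∀ k → k ℕ.< N → Integral≤ (f k) b e) →
    Integral≤ (λ x n → ∑ N (λ k → f k x n)) (ι N * b) (ι N * e)
  approx-∑-bounded ℕ.zero {b = b} {e} h = 0ℚ , ≤-reflexive (zero b) ,
    approx-weaken (≤-reflexive (zero e)) approx-0
    where
    zero : ∀ b → 0ℚ ≡ ι 0 * b
    zero b = sym (trans (cong (_* b) ι-0) (*-zeroˡ b))
  approx-∑-bounded (ℕ.suc N) {b = b} {e} h with h 0 (ℕ.s≤s ℕ.z≤n) | approx-∑-bounded N (λ k k<N → h (ℕ.suc k) (ℕ.s≤s k<N))
  ... | i , i≤b , A | j , j≤Nb , B = i + j ,
    ≤-trans (≤-trans (∣p+q∣≤∣p∣+∣q∣ i j) (i≤b ⊕ j≤Nb)) (≤-reflexive (sucN b)) ,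
    approx-weaken (≤-reflexive (sucN e)) (approx-+ A B)
    where
    ring : ∀ n b → b + n * b ≡ (1ℚ + n) * b
    ring = solve-∀ ringℚ
    sucN : ∀ b → b + ι N * b ≡ ι (ℕ.suc N) * b
    sucN b = trans (ring (ι N) b) (cong (_* b) (sym (ι-suc N)))

  module _ (N : ℕ) .{{_ : NonZero N}} where

    private
      side : ℚ
      side = ℤ.+ 1 / N

    vol-cell : ∀ {p q} (p<N : p ℕ.< N) (q<N : q ℕ.< N) → vol (cellBox N p<N q<N) ≡ side * side
    vol-cell {p} {q} p<N q<N = cong₂ _*_ (frac-diff p N) (trans (cong (_* 1ℚ) (frac-diff q N)) (*-identityʳ side))

    cell-integral : ∀ {p q} → p ℕ.< N → q ℕ.< N → Approx (λ x _ → 𝟙 (Cell N p q x)) (side * side) 0ℚ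
    cell-integral p<N q<N = approx ((1ℚ , cellBox N p<N q<N) ∷ [])
      (upper-≲ (cell-closure N p<N q<N) (≲-refl-≤ λ x n → ≤-reflexive
        (trans (∣a-b∣≡∣b-a∣ (𝟙 (Cell N _ _ x)) _) (cong (λ z → ∣ z - 𝟙 (Cell N _ _ x) ∣)
          (ring (χ x (cellBox N p<N q<N)))))))
      (trans (ring (vol (cellBox N p<N q<N))) (vol-cell p<N q<N))
      where
      ring : ∀ a → 1ℚ * a + 0ℚ ≡ a
      ring = solve-∀ ringℚ

    grid-integral : ∀ w → Approx (λ x _ → grid N w x) (∑ N (λ a → ∑ N (λ b → w a b)) * (side * side)) 0ℚ
    grid-integral w = approx-weaken (≤-reflexive zero) (approx-≡ (λ _ _ → refl) pull
      (approx-∑ N λ a a<N → approx-∑ N λ b b<N → approx-* (w a b) (cell-integral a<N b<N)))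
      where
      zero : ∑ N (λ a → ∑ N (λ b → ∣ w a b ∣ * 0ℚ)) ≡ 0ℚ
      zero = ∑-zero N λ a _ → ∑-zero N λ b _ → *-zeroʳ (∣ w a b ∣)
      pull : ∑ N (λ a → ∑ N (λ b → w a b * (side * side))) ≡ ∑ N (λ a → ∑ N (λ b → w a b)) * (side * side)
      pull = trans (∑-cong N λ a _ → trans (∑-cong N λ b _ → *-comm (w a b) (side * side)) (∑-* N (side * side) (w a)))
        (trans (∑-* N (side * side) (λ a → ∑ N (w a))) (*-comm (side * side) _))

    module _ {G : Fun 2} (G≤1 : (λ x n → ∣ G x n ∣) ≲ (λ _ _ → 1ℚ)) where

      -- A bounded factor keeps the boundary negligible. The 2 is the bound that ∣ G ∣ ≲ 1 gives for
      -- the terms of the sequence with tolerance 1.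
      cell-restriction : ∀ {p q i e} (p<N : p ℕ.< N) (q<N : q ℕ.< N) →
        Approx (λ x n → χ x (cellBox N p<N q<N) * G x n) i e → Approx (λ x n → 𝟙 (Cell N p q x) * G x n) i e
      cell-restriction {p} {q} {i} {e} p<N q<N A = approx-weaken (≤-reflexive (zero e))
        (approx-≈ (upper-≲ (upper-* 2ℚ (cell-closure N p<N q<N)) small) A)
        where
        zero : ∀ e → e + ∣ 2ℚ ∣ * 0ℚ ≡ e
        zero e = trans (cong (e +_) (*-zeroʳ (∣ 2ℚ ∣))) (+-identityʳ e)
        small : (λ x n → ∣ χ x (cellBox N p<N q<N) * G x n - 𝟙 (Cell N p q x) * G x n ∣) ≲
                (λ x n → ∣ 2ℚ * (χ x (cellBox N p<N q<N) - 𝟙 (Cell N p q x)) ∣)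
        small x ε 0<ε = ev-map (λ {n} g → bound (χ x (cellBox N p<N q<N)) (𝟙 (Cell N p q x)) (G x n) g)
            (G≤1 x 1ℚ (positive⁻¹ 1ℚ))
          where
          bound : ∀ a b g → ∣ g ∣ ≤ 1ℚ + 1ℚ → ∣ a * g - b * g ∣ ≤ ∣ 2ℚ * (a - b) ∣ + ε
          bound a b g g≤2 = ≤-trans (≤-reflexive (trans (cong ∣_∣ (ring a b g)) (∣p*q∣≡∣p∣*∣q∣ (a - b) g)))
            (≤-trans (*-mono (0≤∣p∣ (a - b)) g≤2)
              (lin (≤-reflexive (sym (∣p*q∣≡∣p∣*∣q∣ 2ℚ (a - b))) ⊕ <⇒≤ 0<ε) (ring′ (∣ a - b ∣) (∣ 2ℚ * (a - b) ∣) ε)))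
            where
            ring : ∀ a b g → a * g - b * g ≡ (a - b) * g
            ring = solve-∀ ringℚ
            ring′ : ∀ c d e → (d + e) - c * 2ℚ ≡ (d + e) - (2ℚ * c + 0ℚ)
            ring′ = solve-∀ ringℚ

      weighted-integral : ∀ {b e} → 0ℚ ≤ b → 0ℚ ≤ e →
        (∀ B → Integral≤ (λ x n → χ x B * G x n) b e) →
        ∀ w → (∀ p q → p ℕ.< N → q ℕ.< N → ∣ w p q ∣ ≤ 1ℚ) →
        Integral≤ (λ x n → grid N w x * G x n) (ι N * (ι N * b)) (ι N * (ι N * e))
      weighted-integral {b} {e} 0≤b 0≤e h w w≤1 = finish (approx-∑-bounded N λ p p<N → approx-∑-bounded N λ q q<N →
          weigh p q p<N q<N (h (cellBox N p<N q<N)))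
        where
        shrink : ∀ c a b → ∣ c ∣ ≤ 1ℚ → 0ℚ ≤ a → a ≤ b → ∣ c ∣ * a ≤ b
        shrink c a b c≤1 0≤a a≤b = ≤-trans (lin (*-mono 0≤a c≤1) (ring (∣ c ∣) a)) a≤b
          where
          ring : ∀ c a → a - c * a ≡ a * 1ℚ - a * c
          ring = solve-∀ ringℚ
        weigh : ∀ p q (p<N : p ℕ.< N) (q<N : q ℕ.< N) →
          Integral≤ (λ x n → χ x (cellBox N p<N q<N) * G x n) b e →
          Integral≤ (λ x n → w p q * (𝟙 (Cell N p q x) * G x n)) b e
        weigh p q p<N q<N (i , i≤b , A) = w p q * i ,
          ≤-trans (≤-reflexive (∣p*q∣≡∣p∣*∣q∣ (w p q) i)) (shrink (w p q) (∣ i ∣) b (w≤1 p q p<N q<N) (0≤∣p∣ i) i≤b) ,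
          approx-weaken (shrink (w p q) e e (w≤1 p q p<N q<N) 0≤e ≤-refl) (approx-* (w p q) (cell-restriction p<N q<N A))
        pull : ∀ x n → ∑ N (λ p → ∑ N (λ q → w p q * (𝟙 (Cell N p q x) * G x n))) ≡ grid N w x * G x n
        pull x n = trans (∑-cong N λ p _ → trans (∑-cong N λ q _ → ring (w p q) (𝟙 (Cell N p q x)) (G x n))
            (∑-* N (G x n) (λ q → w p q * 𝟙 (Cell N p q x))))
          (trans (∑-* N (G x n) (λ p → ∑ N (λ q → w p q * 𝟙 (Cell N p q x)))) (*-comm (G x n) (grid N w x)))
          where
          ring : ∀ a b g → a * (b * g) ≡ g * (a * b)
          ring = solve-∀ ringℚ
        finish : Integral≤ (λ x n → ∑ N (λ p → ∑ N (λ q → w p q * (𝟙 (Cell N p q x) * G x n)))) (ι N * (ι N * b)) (ι N * (ι N * e)) →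
          Integral≤ (λ x n → grid N w x * G x n) (ι N * (ι N * b)) (ι N * (ι N * e))
        finish (i , i≤ , A) = i , i≤ , approx-≡ pull refl A

  -- Refinements of partitions and values of graphons

  module _ {M N L : ℕ} .{{_ : NonZero M}} .{{_ : NonZero N}} .{{_ : NonZero L}} (M≡NL : M ≡ N ℕ.* L) where

    private
      <next : ∀ a → a ℕ.< ℕ.suc (a ℕ./ L) ℕ.* L
      <next a = begin-strict
        a                        ≡⟨ ℕ.m≡m%n+[m/n]*n a L ⟩
        a ℕ.% L ℕ.+ a ℕ./ L ℕ.* L  <⟨ ℕₚ.+-monoˡ-< (a ℕ./ L ℕ.* L) (ℕ.m%n<n a L) ⟩
        L ℕ.+ a ℕ./ L ℕ.* L        ∎
        where open ℕₚ.≤-Reasoning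

      rearrange : ∀ k → k ℕ.* M ≡ (k ℕ.* L) ℕ.* N
      rearrange k = trans (cong (k ℕ.*_) (trans M≡NL (ℕₚ.*-comm N L))) (sym (ℕₚ.*-assoc k L N))

    coarse< : ∀ {a} → a ℕ.< M → a ℕ./ L ℕ.< N
    coarse< {a} a<M = ℕ.m<n*o⇒m/o<n (subst (a ℕ.<_) M≡NL a<M)

    -- With q = a/L one has qL ≤ a < (q+1)L, which compares the end points. If a is the last fine
    -- index, then NL = 1 + a ≤ (q+1)L makes q the last coarse one, so the point 1 is not lost.
    coarsen : ∀ {a x} → a ℕ.< M → Part M a x → Part N (a ℕ./ L) x
    coarsen {a} {x} a<M (a≤x , x<1+a) = lower , upper′ x<1+a
      where
      lower : fromℚ (ℤ.+ (a ℕ./ L) / N) ≤ᵣ real x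
      lower ε 0<ε = ev-map (≤-trans (frac-≤ (a ℕ./ L) a N M
        (ℕₚ.≤-trans (ℕₚ.≤-reflexive (rearrange (a ℕ./ L))) (ℕₚ.*-monoˡ-≤ N (ℕ.m/n*n≤m a L))))) (a≤x ε 0<ε)
      upper′ : real x <ᵣ fromℚ (ℤ.+ ℕ.suc a / M) ⊎ ℕ.suc a ≡ M →
               real x <ᵣ fromℚ (ℤ.+ ℕ.suc (a ℕ./ L) / N) ⊎ ℕ.suc (a ℕ./ L) ≡ N
      upper′ (inj₁ (δ , 0<δ , h)) = inj₁ (δ , 0<δ , ev-map (λ p → ≤-trans p (frac-≤ (ℕ.suc a) (ℕ.suc (a ℕ./ L)) M N
        (ℕₚ.≤-trans (ℕₚ.*-monoˡ-≤ N (<next a)) (ℕₚ.≤-reflexive (sym (rearrange (ℕ.suc (a ℕ./ L)))))))) h)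
      upper′ (inj₂ 1+a≡M) = inj₂ (ℕₚ.≤-antisym (coarse< a<M) (ℕₚ.*-cancelʳ-≤ N (ℕ.suc (a ℕ./ L)) L
        (ℕₚ.≤-trans (ℕₚ.≤-reflexive (trans (sym M≡NL) (sym 1+a≡M))) (<next a))))

  ∥_∥ : Graphon → Fun 2
  ∥ W ∥ = square (value W)

  gap : Graphon → Graphon → Fun 2
  gap V U = square (difference V U)

  gap≡ : ∀ V U x n → gap V U x n ≡ ∥ V ∥ x n - ∥ U ∥ x n
  gap≡ V U (x ∷ y ∷ []) n = refl

  graphon-bounds : ∀ W x ε → 0ℚ < ε → Eventually (λ n → 0ℚ ≤ ∥ W ∥ x n + ε × ∥ W ∥ x n ≤ 1ℚ + ε)
  graphon-bounds W (x ∷ y ∷ []) ε 0<ε = ev-zip _,_ (0≤real (fun W x y) ε 0<ε) (real≤1 (fun W x y) ε 0<ε)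

  graphon≤2 : ∀ W x → Eventually (λ n → ∣ ∥ W ∥ x n ∣ ≤ 2ℚ)
  graphon≤2 W x = ev-map (λ {n} (l , u) → ∣∣-bound u (lin (l ⊕ 0≤1) (ring (∥ W ∥ x n))))
    (graphon-bounds W x 1ℚ (positive⁻¹ 1ℚ))
    where
    ring : ∀ w → 2ℚ - (- w) ≡ ((w + 1ℚ) + 1ℚ) - (0ℚ + 0ℚ)
    ring = solve-∀ ringℚ

  gap≤1 : ∀ V U → (λ x n → ∣ gap V U x n ∣) ≲ (λ _ _ → 1ℚ)
  gap≤1 V U x ε 0<ε = ev-zip (λ {n} (l , u) (l′ , u′) → subst (λ z → ∣ z ∣ ≤ 1ℚ + ε) (sym (gap≡ V U x n))
      (∣∣-bound (lin (u ⊕ l′) (ring₁ (∥ V ∥ x n) (∥ U ∥ x n) ε)) (lin (l ⊕ u′) (ring₂ (∥ V ∥ x n) (∥ U ∥ x n) ε))))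
    (graphon-bounds V x (½ * ε) (½-positive 0<ε)) (graphon-bounds U x (½ * ε) (½-positive 0<ε))
    where
    ring₁ : ∀ v u e → (1ℚ + e) - (v - u) ≡ ((1ℚ + ½ * e) + (u + ½ * e)) - (v + 0ℚ)
    ring₁ = solve-∀ ringℚ
    ring₂ : ∀ v u e → (1ℚ + e) - (- (v - u)) ≡ ((v + ½ * e) + (1ℚ + ½ * e)) - (0ℚ + u)
    ring₂ = solve-∀ ringℚ

  limit-bounds : ∀ {v : ℕ → ℚ} {m} →
    (∀ ε → 0ℚ < ε → Eventually (λ n → 0ℚ ≤ v n + ε × v n ≤ 1ℚ + ε)) →
    (∀ ε → 0ℚ < ε → Eventually (λ n → ∣ v n - m ∣ ≤ ε)) → 0ℚ ≤ m × m ≤ 1ℚ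
  limit-bounds {v} {m} bounds near = ≤-closure (λ ε 0<ε → proj₁ (both ε 0<ε)) , ≤-closure (λ ε 0<ε → proj₂ (both ε 0<ε))
    where
    both : ∀ ε → 0ℚ < ε → 0ℚ ≤ m + ε × m ≤ 1ℚ + ε
    both ε 0<ε = proj₂ (ev-here (ev-zip
      (λ {n} (l , u) c → lin (l ⊕ proj₁ (∣∣-≤⇒ c)) (ring₁ (v n) m ε) , lin (u ⊕ proj₂ (∣∣-≤⇒ c)) (ring₂ (v n) m ε))
      (bounds (½ * ε) (½-positive 0<ε)) (near (½ * ε) (½-positive 0<ε))))
      where
      ring₁ : ∀ v m e → (m + e) - 0ℚ ≡ ((v + ½ * e) + ½ * e) - (0ℚ + (v - m))
      ring₁ = solve-∀ ringℚ
      ring₂ : ∀ v m e → (1ℚ + e) - m ≡ ((1ℚ + ½ * e) + ½ * e) - (v + - (v - m))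
      ring₂ = solve-∀ ringℚ

  module Matrices (𝒮 : StepEnumeration) where
    open StepEnumeration 𝒮 public

    opaque
      -- `matrix` extended to all natural indices; the sums over refined cells run over natural
      -- numbers.
      entry : ℕ → ℕ → ℕ → ℚ
      entry i p q = ℤ.+ num (i ∷ p ∷ q ∷ []) / ℕ.suc (den-1 (i ∷ p ∷ q ∷ []))

      entry-ι : ∀ i p q → entry i p q * ι (ℕ.suc (den-1 (i ∷ p ∷ q ∷ []))) ≡ ι (num (i ∷ p ∷ q ∷ []))
      entry-ι i p q = /-ι (num (i ∷ p ∷ q ∷ [])) (ℕ.suc (den-1 (i ∷ p ∷ q ∷ [])))

      entry-value : ∀ i x {p q} → p ℕ.< parts i → q ℕ.< parts i → Cell (parts i) p q x →
        ∀ ε → 0ℚ < ε → Eventually (λ n → ∣ ∥ graphon i ∥ x n - entry i p q ∣ ≤ ε)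
      entry-value i (x ∷ y ∷ []) p<N q<N (P , Q) =
        subst₂ (λ a b → value (graphon i) x y ≃ᵣ fromℚ (entry i a b)) (toℕ-fromℕ< p<N) (toℕ-fromℕ< q<N)
          (isStep i (fromℕ< p<N) (fromℕ< q<N) x y (Part⇒InPart (parts i) p<N {x} P) (Part⇒InPart (parts i) q<N {y} Q))

    opaque
      corner : ∀ N .{{_ : NonZero N}} {p} → p ℕ.< N → Σ[ x ∈ I ] Part N p x
      corner N {p} p<N = record
        { real   = fromℚ (ℤ.+ p / N)
        ; 0≤real = λ ε 0<ε → always λ _ → +-nonneg (0≤lo (interval N p<N)) (<⇒≤ 0<ε)
        ; real≤1 = λ ε 0<ε → always λ _ → lin (lo≤hi (interval N p<N) ⊕ hi≤1 (interval N p<N) ⊕ <⇒≤ 0<ε)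
                     (ring (ℤ.+ p / N) (ℤ.+ ℕ.suc p / N) ε)
        } , (λ ε 0<ε → always λ _ → lin (<⇒≤ 0<ε) (ring′ (ℤ.+ p / N) ε)) ,
        inj₁ (ℤ.+ 1 / N , 0<side , always λ _ → ≤-reflexive (trans (cong ((ℤ.+ p / N) +_) (sym (frac-diff p N)))
          (ring″ (ℤ.+ p / N) (ℤ.+ ℕ.suc p / N))))
        where
        0<side : 0ℚ < ℤ.+ 1 / N
        0<side = positive⁻¹ (ℤ.+ 1 / N) {{normalize-pos 1 N}}
        ring : ∀ a b e → (1ℚ + e) - a ≡ (b + 1ℚ + e) - (a + b + 0ℚ)
        ring = solve-∀ ringℚ
        ring′ : ∀ a e → (a + e) - a ≡ e - 0ℚ
        ring′ = solve-∀ ringℚ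
        ring″ : ∀ a b → a + (b - a) ≡ b
        ring″ = solve-∀ ringℚ

    -- Each cell contains its lower left corner, where the graphon takes the value of the entry; the
    -- bounds are inherited from the graphon.
    entry-bounds : ∀ i {p q} → p ℕ.< parts i → q ℕ.< parts i → 0ℚ ≤ entry i p q × entry i p q ≤ 1ℚ
    entry-bounds i {p} {q} p<N q<N = in-unit (corner (parts i) p<N) (corner (parts i) q<N)
      where
      in-unit : Σ[ x ∈ I ] Part (parts i) p x → Σ[ y ∈ I ] Part (parts i) q y → 0ℚ ≤ entry i p q × entry i p q ≤ 1ℚ
      in-unit (x , P) (y , Q) = limit-bounds {∥ graphon i ∥ (x ∷ y ∷ [])} {entry i p q}
        (graphon-bounds (graphon i) (x ∷ y ∷ [])) (entry-value i (x ∷ y ∷ []) p<N q<N (P , Q))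

    module Refined (i j : ℕ) where

      -- Cutting every part of one partition into as many pieces as the other has parts gives a
      -- common refinement in which coarse indices are quotients.
      M : ℕ
      M = parts i ℕ.* parts j

      instance
        M≢0 : NonZero M
        M≢0 = ℕₚ.m*n≢0 (parts i) (parts j)

      M≡ : M ≡ parts j ℕ.* parts i
      M≡ = ℕₚ.*-comm (parts i) (parts j)

      entry₁ entry₂ : ℕ → ℕ → ℚ
      entry₁ a b = entry i (a ℕ./ parts j) (b ℕ./ parts j)
      entry₂ a b = entry j (a ℕ./ parts i) (b ℕ./ parts i)

      refined-cell₁ : ∀ x {a b} → a ℕ.< M → b ℕ.< M → Cell M a b x → Cell (parts i) (a ℕ./ parts j) (b ℕ./ parts j) x
      refined-cell₁ (x ∷ y ∷ []) a<M b<M (P , Q) = coarsen {N = parts i} refl {x = x} a<M P , coarsen {N = parts i} refl {x = y} b<M Q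

      refined-cell₂ : ∀ x {a b} → a ℕ.< M → b ℕ.< M → Cell M a b x → Cell (parts j) (a ℕ./ parts i) (b ℕ./ parts i) x
      refined-cell₂ (x ∷ y ∷ []) a<M b<M (P , Q) = coarsen {N = parts j} M≡ {x = x} a<M P , coarsen {N = parts j} M≡ {x = y} b<M Q

      coarse₁ : ∀ {a} → a ℕ.< M → a ℕ./ parts j ℕ.< parts i
      coarse₁ = coarse< {N = parts i} refl

      coarse₂ : ∀ {a} → a ℕ.< M → a ℕ./ parts i ℕ.< parts j
      coarse₂ = coarse< {N = parts j} M≡

      mixed : ℕ → ℕ → ℚ
      mixed a b = entry₁ a b + entry₂ a b - 2ℚ * entry₁ a b * entry₂ a b

      -- ∫ W + V - 2WV for the i-th and j-th step graphons W and V.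
      distance : ℚ
      distance = ∑ M (λ a → ∑ M (λ b → mixed a b)) * ((ℤ.+ 1 / M) * (ℤ.+ 1 / M))

    -- The L¹ distance of two terms of a name must exist as an integral before the triangle
    -- inequality can bound it. On refined cells the integrand is constant, so the error is 0.
    step-distance : ∀ i j → Σ[ r ∈ ℚ ] Approx (λ x n → ∣ gap (graphon i) (graphon j) x n ∣) r 0ℚ
    step-distance i j = _ , approx-weaken (≤-reflexive (+-identityʳ 0ℚ)) (approx-≈ (upper-0 exact) (grid-integral M w))
      where
      open Refined i j
      w : ℕ → ℕ → ℚ
      w a b = ∣ entry₁ a b - entry₂ a b ∣
      exact : ∀ x ε → 0ℚ < ε → Eventually (λ n → ∣ grid M w x - ∣ gap (graphon i) (graphon j) x n ∣ ∣ ≤ ε)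
      exact x ε 0<ε = at (cell-exists M x)
        where
        bound : ∀ {a b v u} → ∣ v - a ∣ ≤ ½ * ε → ∣ u - b ∣ ≤ ½ * ε → ∣ ∣ a - b ∣ - ∣ v - u ∣ ∣ ≤ ε
        bound {a} {b} {v} {u} p q = ∣∣-bound
          (lin (≤-trans (≤-reflexive (cong ∣_∣ (ring₁ a b v u))) (∣-∣≤ {v - u} ≤-refl (∣-∣≤ p q)))
            (ring₂ (∣ a - b ∣) (∣ v - u ∣) ε))
          (lin (≤-trans (≤-reflexive (cong ∣_∣ (ring₃ a b v u))) (∣+∣≤ {a - b} ≤-refl (∣-∣≤ p q)))
            (ring₄ (∣ a - b ∣) (∣ v - u ∣) ε))
          where
          ring₁ : ∀ a b v u → a - b ≡ (v - u) - ((v - a) - (u - b))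
          ring₁ = solve-∀ ringℚ
          ring₂ : ∀ p q e → e - (p - q) ≡ (q + (½ * e + ½ * e)) - p
          ring₂ = solve-∀ ringℚ
          ring₃ : ∀ a b v u → v - u ≡ (a - b) + ((v - a) - (u - b))
          ring₃ = solve-∀ ringℚ
          ring₄ : ∀ p q e → e - (- (p - q)) ≡ (p + (½ * e + ½ * e)) - q
          ring₄ = solve-∀ ringℚ
        at : ∃[ a ] ∃[ b ] a ℕ.< M × b ℕ.< M × Cell M a b x →
             Eventually (λ n → ∣ grid M w x - ∣ gap (graphon i) (graphon j) x n ∣ ∣ ≤ ε)
        at (a , b , a<M , b<M , C) = ev-zip
          (λ {n} p q → subst₂ (λ s t → ∣ s - ∣ t ∣ ∣ ≤ ε) (sym (grid-at M w x a<M b<M C)) (sym (gap≡ (graphon i) (graphon j) x n)) (bound {entry₁ a b} {entry₂ a b} {∥ graphon i ∥ x n} {∥ graphon j ∥ x n} p q))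
          (entry-value i x (coarse₁ a<M) (coarse₁ b<M) (refined-cell₁ x a<M b<M C) (½ * ε) (½-positive 0<ε))
          (entry-value j x (coarse₂ a<M) (coarse₂ b<M) (refined-cell₂ x a<M b<M C) (½ * ε) (½-positive 0<ε))

    step-distance′ : ∀ i j {V W} → graphon i ≡ V → graphon j ≡ W → Σ[ r ∈ ℚ ] Approx (λ x n → ∣ gap V W x n ∣) r 0ℚ
    step-distance′ i j refl refl = step-distance i j

    step-integrable : ∀ i {V} → graphon i ≡ V → Σ[ r ∈ ℚ ] Approx ∥ V ∥ r 0ℚ
    step-integrable i refl = _ , approx-weaken (≤-reflexive (+-identityʳ 0ℚ)) (approx-≈ (upper-0 exact) (grid-integral (parts i) (entry i)))
      where
      exact : ∀ x ε → 0ℚ < ε → Eventually (λ n → ∣ grid (parts i) (entry i) x - ∥ graphon i ∥ x n ∣ ≤ ε)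
      exact x ε 0<ε = at (cell-exists (parts i) x)
        where
        at : ∃[ p ] ∃[ q ] p ℕ.< parts i × q ℕ.< parts i × Cell (parts i) p q x →
             Eventually (λ n → ∣ grid (parts i) (entry i) x - ∥ graphon i ∥ x n ∣ ≤ ε)
        at (p , q , p<N , q<N , C) = ev-map
          (λ {n} h → ≤-trans (≤-reflexive (trans
            (cong (λ z → ∣ z - ∥ graphon i ∥ x n ∣) (grid-at (parts i) (entry i) x p<N q<N C))
            (∣a-b∣≡∣b-a∣ (entry i p q) (∥ graphon i ∥ x n)))) h)
          (entry-value i x p<N q<N C ε 0<ε)

  -- Estimates of L¹ distances

  mass : ∀ {d} → Step d → ℚ
  mass []            = 0ℚ
  mass ((c , B) ∷ s) = ∣ c ∣ + mass s

  mass-nonneg : ∀ {d} (s : Step d) → 0ℚ ≤ mass s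
  mass-nonneg []            = ≤-refl
  mass-nonneg ((c , B) ∷ s) = +-nonneg (0≤∣p∣ c) (mass-nonneg s)

  step-integral : ∀ {d} {G : Fun d} {b e} →
    (∀ B → Integral≤ (λ x n → χ x B * G x n) b e) →
    ∀ s → Integral≤ (λ x n → total (χ x) s * G x n) (mass s * b) (mass s * e)
  step-integral {G = G} {b} {e} h [] = 0ℚ , ≤-reflexive (sym (*-zeroˡ b)) ,
    approx-weaken (≤-reflexive (sym (*-zeroˡ e))) (approx-≡ (λ x n → sym (*-zeroˡ (G x n))) refl approx-0)
  step-integral {G = G} {b} {e} h ((c , B) ∷ s) = add (h B) (step-integral h s)
    where
    add : Integral≤ (λ x n → χ x B * G x n) b e →
      Integral≤ (λ x n → total (χ x) s * G x n) (mass s * b) (mass s * e) →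
      Integral≤ (λ x n → (c * χ x B + total (χ x) s) * G x n) ((∣ c ∣ + mass s) * b) ((∣ c ∣ + mass s) * e)
    add (i , i≤b , A) (j , j≤ , A′) = c * i + j ,
      ≤-trans (∣+∣≤ (≤-trans (≤-reflexive (∣p*q∣≡∣p∣*∣q∣ c i)) (*-mono (0≤∣p∣ c) i≤b)) j≤)
        (≤-reflexive (sym (*-distribʳ-+ b (∣ c ∣) (mass s)))) ,
      approx-weaken (≤-reflexive (sym (*-distribʳ-+ e (∣ c ∣) (mass s))))
        (approx-≡ (λ x n → ring c (χ x B) (total (χ x) s) (G x n)) refl (approx-+ (approx-* c A) A′))
      where
      ring : ∀ c a t g → c * (a * g) + t * g ≡ (c * a + t) * g
      ring = solve-∀ ringℚ

  whole : Box 2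
  whole = unit ∷ unit ∷ []

  χ-whole : ∀ x → χ x whole ≡ 1ℚ
  χ-whole (x ∷ y ∷ []) = 𝟙-true ((0≤real x , real≤1 x) ∷ (0≤real y , real≤1 y) ∷ [])

  gap-box-integral : ∀ V U δ → d□≤ V U δ → ∀ (B : Box 2) η → 0ℚ < η →
    Integral≤ (λ x n → χ x B * gap V U x n) (δ + η) η
  gap-box-integral V U δ = box-integral (difference V U) {δ}

  telescope : ∀ c a b d g₁ g₂ g → g₁ ≡ a - b → g₂ ≡ b - d → g ≡ a - d → c * g₁ + c * g₂ ≡ c * g
  telescope c a b d _ _ _ refl refl refl = ring c a b d
    where
    ring : ∀ c a b d → c * (a - b) + c * (b - d) ≡ c * (a - d)
    ring = solve-∀ ringℚ

  gap-box-+ : ∀ U V W (B : Box 2) b₁ b₂ e₁ e₂ b e → b₁ + b₂ ≤ b → e₁ + e₂ ≤ e →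
    Integral≤ (λ x n → χ x B * gap U V x n) b₁ e₁ →
    Integral≤ (λ x n → χ x B * gap V W x n) b₂ e₂ →
    Integral≤ (λ x n → χ x B * gap U W x n) b e
  gap-box-+ U V W B b₁ b₂ e₁ e₂ b e b≤ e≤ (r₁ , r₁≤ , A₁) (r₂ , r₂≤ , A₂) = r₁ + r₂ ,
    ≤-trans (∣+∣≤ {r₁} {b₁} {r₂} {b₂} r₁≤ r₂≤) b≤ , approx-weaken e≤ (approx-≡ pointwise refl (approx-+ A₁ A₂))
    where
    pointwise : ∀ x n → χ x B * gap U V x n + χ x B * gap V W x n ≡ χ x B * gap U W x n
    pointwise x n = telescope (χ x B) (∥ U ∥ x n) (∥ V ∥ x n) (∥ W ∥ x n)
      (gap U V x n) (gap V W x n) (gap U W x n) (gap≡ U V x n) (gap≡ V W x n) (gap≡ U W x n)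

  recover : ∀ c v u g → c ≡ 1ℚ → g ≡ v - u → v + (- 1ℚ) * (c * g) ≡ u
  recover _ v u _ refl refl = ring v u
    where
    ring : ∀ v u → v + (- 1ℚ) * (1ℚ * (v - u)) ≡ u
    ring = solve-∀ ringℚ

  -- An integral of V - U over the whole square comes with a step function close to V - U in L¹;
  -- subtracting it from one for V leaves one for U.
  subtract : ∀ V U p {b} → Σ[ r ∈ ℚ ] Approx ∥ V ∥ r 0ℚ →
    Integral≤ (λ x n → χ x whole * gap V U x n) b p →
    Σ[ t ∈ Step 2 ] Upper (λ x n → ∥ U ∥ x n - total (χ x) t) p
  subtract V U p (r , B) (r′ , _ , A) = Approx.step C , Approx.close C
    where
    pointwise : ∀ x n → ∥ V ∥ x n + (- 1ℚ) * (χ x whole * gap V U x n) ≡ ∥ U ∥ x n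
    pointwise x n = recover (χ x whole) (∥ V ∥ x n) (∥ U ∥ x n) (gap V U x n) (χ-whole x) (gap≡ V U x n)
    error : 0ℚ + ∣ - 1ℚ ∣ * p ≤ p
    error = ≤-reflexive (trans (+-identityˡ (1ℚ * p)) (*-identityˡ p))
    C : Approx ∥ U ∥ (r + (- 1ℚ) * r′) p
    C = approx-weaken error (approx-≡ pointwise refl (approx-+ B (approx-* (- 1ℚ) A)))

  gap-distance : ∀ V U q → (∀ η → 0ℚ < η → Σ[ i ∈ ℚ ] i ≤ q + η × Approx (λ x n → ∣ gap V U x n ∣) i η) → d₁≤ V U q
  gap-distance V U q = to-‖‖₁ (difference V U) {q}

  -- 1 - 2t, close to the sign of V - U when t is close to U.
  signs : Step 2 → Step 2
  signs t = (1ℚ , whole) ∷ scale (- 2ℚ) t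

  module _ (U : Graphon) (Ex : Pred (Cube 2) 0ℓ) (null : Null Ex)
           (dichotomy : ∀ x → ¬ (x ∈ Ex) →
              (∀ ε → 0ℚ < ε → Eventually (λ n → ∣ ∥ U ∥ x n ∣ ≤ ε)) ⊎
              (∀ ε → 0ℚ < ε → Eventually (λ n → ∣ ∥ U ∥ x n - 1ℚ ∣ ≤ ε)))
    where

    -- On the exceptional set the excess of ∣ k ∣ over ∣ f ∣ is at most C, and C times a null set
    -- costs at most η.
    upper-ae : ∀ {f k : Fun 2} {p} C → 0ℚ ≤ C → Upper f p →
      (∀ x → ¬ (x ∈ Ex) → ∀ ε → 0ℚ < ε → Eventually (λ n → ∣ k x n ∣ ≤ ∣ f x n ∣ + ε)) →
      (∀ x → Eventually (λ n → ∣ k x n ∣ ≤ ∣ f x n ∣ + C)) →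
      ∀ η → 0ℚ < η → Upper k (p + η)
    upper-ae {f} {k} C 0≤C F off everywhere η 0<η =
      upper-≲ (upper-+ F (upper-null Ex null C 0≤C η 0<η)) λ x ε 0<ε → cases x ε 0<ε em
      where
      cases : ∀ x ε → 0ℚ < ε → Dec (x ∈ Ex) →
        Eventually (λ n → ∣ k x n ∣ ≤ ∣ ∣ f x n ∣ + ∣ C * 𝟙 (x ∈ Ex) ∣ ∣ + ε)
      cases x ε 0<ε (yes x∈) = ev-map (λ {n} h → lin
          (h ⊕ a≤∣a∣ (∣ f x n ∣ + ∣ C * 𝟙 (x ∈ Ex) ∣) ⊕ a≤∣a∣ (C * 𝟙 (x ∈ Ex)) ⊕
           ≤-reflexive (sym (trans (cong (C *_) (𝟙-true x∈)) (*-identityʳ C))) ⊕ <⇒≤ 0<ε)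
          (ring (∣ k x n ∣) (∣ f x n ∣) (C * 𝟙 (x ∈ Ex)) (∣ C * 𝟙 (x ∈ Ex) ∣)
            (∣ ∣ f x n ∣ + ∣ C * 𝟙 (x ∈ Ex) ∣ ∣) C ε)) (everywhere x)
        where
        ring : ∀ k f i a s c e → (s + e) - k ≡ ((f + c) + s + a + i + e) - (k + (f + a) + i + c + 0ℚ)
        ring = solve-∀ ringℚ
      cases x ε 0<ε (no x∉) = ev-map (λ {n} h → lin
          (h ⊕ a≤∣a∣ (∣ f x n ∣ + ∣ C * 𝟙 (x ∈ Ex) ∣) ⊕ 0≤∣p∣ (C * 𝟙 (x ∈ Ex)))
          (ring (∣ k x n ∣) (∣ f x n ∣) (∣ C * 𝟙 (x ∈ Ex) ∣) (∣ ∣ f x n ∣ + ∣ C * 𝟙 (x ∈ Ex) ∣ ∣) ε)) (off x x∉ ε 0<ε)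
        where
        ring : ∀ k f a s e → (s + e) - k ≡ ((f + e) + s + a) - (k + (f + a) + 0ℚ)
        ring = solve-∀ ringℚ

    0≤16 : 0ℚ ≤ 8ℚ + 8ℚ
    0≤16 = nonNegative⁻¹ (8ℚ + 8ℚ)

    module _ (V : Graphon) where

      gap≤2 : ∀ x → Eventually (λ n → ∣ gap V U x n ∣ ≤ 2ℚ)
      gap≤2 x = gap≤1 V U x 1ℚ (positive⁻¹ 1ℚ)

      sign-error-everywhere : ∀ x → Eventually (λ n → ∣ sign-error (∥ U ∥ x n) (gap V U x n) ∣ ≤ 8ℚ + 8ℚ)
      sign-error-everywhere x = ev-zip (λ {n} u≤2 g≤2 → sign-error-bounded {∥ U ∥ x n} {gap V U x n} g≤2 u≤2)
        (graphon≤2 U x) (gap≤2 x)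

      sign-error-off : ∀ x → ¬ (x ∈ Ex) → ∀ ε → 0ℚ < ε →
        Eventually (λ n → ∣ sign-error (∥ U ∥ x n) (gap V U x n) ∣ ≤ ε)
      sign-error-off x x∉ ε 0<ε = from (small-factor 8ℚ ε 0≤8 0<ε)
        where
        cases : ∀ e → 0ℚ < e → 8ℚ * e ≤ ε →
          (∀ ε → 0ℚ < ε → Eventually (λ n → ∣ ∥ U ∥ x n ∣ ≤ ε)) ⊎
          (∀ ε → 0ℚ < ε → Eventually (λ n → ∣ ∥ U ∥ x n - 1ℚ ∣ ≤ ε)) →
          Eventually (λ n → ∣ sign-error (∥ U ∥ x n) (gap V U x n) ∣ ≤ ε)
        cases e 0<e 8e≤ε (inj₁ u≈0) = ev-zip (λ {n} (u≈0 , g≤2) (0≤v , _) → ≤-trans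
                (sign-error-near-0 {∥ U ∥ x n} {gap V U x n} g≤2 {e} (<⇒≤ 0<e) u≈0
                  (subst (λ z → - z ≤ 2ℚ * e) (sym (gap≡ V U x n))
                    (lin (0≤v ⊕ proj₁ (∣∣-≤⇒ u≈0)) (ring (∥ V ∥ x n) (∥ U ∥ x n) e)))) 8e≤ε)
              (ev-zip _,_ (u≈0 e 0<e) (gap≤2 x)) (graphon-bounds V x e 0<e)
          where
          ring : ∀ v u e → 2ℚ * e - (- (v - u)) ≡ ((v + e) + e) - (0ℚ + u)
          ring = solve-∀ ringℚ
        cases e 0<e 8e≤ε (inj₂ u≈1) = ev-zip (λ {n} (u≈1 , g≤2) (_ , v≤1) → ≤-trans
                (sign-error-near-1 {∥ U ∥ x n} {gap V U x n} {e} g≤2 (<⇒≤ 0<e) u≈1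
                  (subst (λ z → z ≤ 2ℚ * e) (sym (gap≡ V U x n))
                    (lin (v≤1 ⊕ proj₂ (∣∣-≤⇒ u≈1)) (ring (∥ V ∥ x n) (∥ U ∥ x n) e)))) 8e≤ε)
              (ev-zip _,_ (u≈1 e 0<e) (gap≤2 x)) (graphon-bounds V x e 0<e)
          where
          ring : ∀ v u e → 2ℚ * e - (v - u) ≡ ((1ℚ + e) + e) - (v + - (u - 1ℚ))
          ring = solve-∀ ringℚ

        from : Σ[ e ∈ ℚ ] 0ℚ < e × 8ℚ * e ≤ ε → Eventually (λ n → ∣ sign-error (∥ U ∥ x n) (gap V U x n) ∣ ≤ ε)
        from (e , 0<e , 8e≤ε) = cases e 0<e 8e≤ε (dichotomy x x∉)

      -- ∣ V - U ∣ = (1 - 2U)(V - U) almost everywhere, and U is close to a step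
      -- function t, so ‖ V - U ‖₁ is controlled by integrals of V - U over boxes.
      soft-estimate : ∀ (t : Step 2) {p} → Upper (λ x n → ∥ U ∥ x n - total (χ x) t) p →
        ∀ {b e} → (∀ B → Integral≤ (λ x n → χ x B * gap V U x n) b e) → ∀ η → 0ℚ < η →
        Integral≤ (λ x n → ∣ gap V U x n ∣) (mass (signs t) * b) (mass (signs t) * e + ((2ℚ + 2ℚ) * p + η))
      soft-estimate t {p} T h η 0<η = finish η 0<η (step-integral h t′)
        where
        t′ : Step 2
        t′ = signs t

        total-t′ : ∀ x → total (χ x) t′ ≡ 1ℚ - 2ℚ * total (χ x) t
        total-t′ x = trans (cong₂ (λ a b → 1ℚ * a + b) (χ-whole x) (total-scale (χ x) (- 2ℚ) t))
          (ring (total (χ x) t))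
          where
          ring : ∀ a → 1ℚ * 1ℚ + (- 2ℚ) * a ≡ 1ℚ - 2ℚ * a
          ring = solve-∀ ringℚ

        -- Here (1 - 2t)g - ∣ g ∣ = 2(u - t)g + `sign-error u g`, and ∣ g ∣ ≤ 2 accounts for the
        -- factor 4.
        split : ∀ x n {r} → ∣ gap V U x n ∣ ≤ 2ℚ → ∣ sign-error (∥ U ∥ x n) (gap V U x n) ∣ ≤ r →
          ∣ total (χ x) t′ * gap V U x n - ∣ gap V U x n ∣ ∣ ≤ ∣ (2ℚ + 2ℚ) * (∥ U ∥ x n - total (χ x) t) ∣ + r
        split x n g≤2 r≥ = ≤-trans
          (≤-reflexive (cong ∣_∣ (trans (cong (λ z → z * gap V U x n - ∣ gap V U x n ∣) (total-t′ x))
            (ring (∥ U ∥ x n) (total (χ x) t) (gap V U x n) (∣ gap V U x n ∣)))))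
          (∣+∣≤ (≤-trans (∣*∣≤ (≤-reflexive (∣p*q∣≡∣p∣*∣q∣ 2ℚ (∥ U ∥ x n - total (χ x) t))) g≤2)
                  (≤-reflexive (trans (ring′ (∣ ∥ U ∥ x n - total (χ x) t ∣))
                    (sym (∣p*q∣≡∣p∣*∣q∣ (2ℚ + 2ℚ) (∥ U ∥ x n - total (χ x) t)))))) r≥)
          where
          ring : ∀ u s g a → (1ℚ - 2ℚ * s) * g - a ≡
            (2ℚ * (u - s)) * g + ((1ℚ - 2ℚ * u) * g - a)
          ring = solve-∀ ringℚ
          ring′ : ∀ a → (2ℚ * a) * 2ℚ ≡ (2ℚ + 2ℚ) * a
          ring′ = solve-∀ ringℚ

        difference-small : ∀ η → 0ℚ < η →
          Upper (λ x n → total (χ x) t′ * gap V U x n - ∣ gap V U x n ∣) ((2ℚ + 2ℚ) * p + η)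
        difference-small = upper-ae (8ℚ + 8ℚ) 0≤16 (upper-* (2ℚ + 2ℚ) T)
          (λ x x∉ ε 0<ε → ev-zip (λ {n} → split x n) (gap≤2 x) (sign-error-off x x∉ ε 0<ε))
          (λ x → ev-zip (λ {n} → split x n) (gap≤2 x) (sign-error-everywhere x))

        finish : ∀ {b e} η → 0ℚ < η →
          Integral≤ (λ x n → total (χ x) t′ * gap V U x n) (mass t′ * b) (mass t′ * e) →
          Integral≤ (λ x n → ∣ gap V U x n ∣) (mass t′ * b) (mass t′ * e + ((2ℚ + 2ℚ) * p + η))
        finish η 0<η (i , i≤ , A) = i , i≤ , approx-≈ (difference-small η 0<η) A

    module _ (𝒮 : StepEnumeration) (i j : ℕ) where
      open Matrices 𝒮
      open Refined i j

      private
        W V : Graphon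
        W = graphon i
        V = graphon j

        N : ℕ
        N = parts i

        c : ℕ → ℕ → ℚ
        c p q = 2ℚ * entry i p q - 1ℚ

        linear : Fun 2
        linear x n = grid M mixed x + grid N c x * gap V U x n

        record Point (x : Cube 2) : Set where
          field
            w v   : ℚ
            0≤w   : 0ℚ ≤ w
            w≤1   : w ≤ 1ℚ
            W≈w   : ∀ ε → 0ℚ < ε → Eventually (λ n → ∣ ∥ W ∥ x n - w ∣ ≤ ε)
            V≈v   : ∀ ε → 0ℚ < ε → Eventually (λ n → ∣ ∥ V ∥ x n - v ∣ ≤ ε)
            linear≡ : ∀ n → linear x n ≡ linear-distance w v (∥ V ∥ x n) (∥ U ∥ x n)

        point : ∀ x → Point x
        point x = at (cell-exists M x)
          where
          at : ∃[ a ] ∃[ b ] a ℕ.< M × b ℕ.< M × Cell M a b x → Point x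
          at (a , b , a<M , b<M , C) = record
            { w = entry₁ a b ; v = entry₂ a b
            ; 0≤w = proj₁ (entry-bounds i (coarse₁ a<M) (coarse₁ b<M))
            ; w≤1 = proj₂ (entry-bounds i (coarse₁ a<M) (coarse₁ b<M))
            ; W≈w = entry-value i x (coarse₁ a<M) (coarse₁ b<M) (refined-cell₁ x a<M b<M C)
            ; V≈v = entry-value j x (coarse₂ a<M) (coarse₂ b<M) (refined-cell₂ x a<M b<M C)
            ; linear≡ = λ n → cong₂ _+_ (grid-at M mixed x a<M b<M C)
                (cong₂ _*_ (grid-at N c x (coarse₁ a<M) (coarse₁ b<M) (refined-cell₁ x a<M b<M C)) (gap≡ V U x n))
            }
        open Point

        -- The summand `∣ 0ℚ ∣` fits the shape of `upper-ae` with the zero function as `f`.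
        rewrite-error : ∀ x n {r} →
          ∣ linear-distance (w (point x)) (v (point x)) (∥ V ∥ x n) (∥ U ∥ x n) - ∣ ∥ W ∥ x n - ∥ U ∥ x n ∣ ∣ ≤ r →
          ∣ linear x n - ∣ gap W U x n ∣ ∣ ≤ ∣ 0ℚ ∣ + r
        rewrite-error x n {r} h = ≤-trans (subst₂ (λ a b → ∣ a - ∣ b ∣ ∣ ≤ r)
          (sym (linear≡ (point x) n)) (sym (gap≡ W U x n)) h) (≤-reflexive (sym (+-identityˡ r)))

        error-everywhere : ∀ x → Eventually (λ n → ∣ linear x n - ∣ gap W U x n ∣ ∣ ≤ ∣ 0ℚ ∣ + (8ℚ + 8ℚ))
        error-everywhere x = ev-zip (λ {n} (W≤2 , u≤2) v≤2 → rewrite-error x n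
            (linear-distance-bounded {∥ W ∥ x n} {w (point x)} {∥ V ∥ x n} {v (point x)}
              (0≤w (point x)) (w≤1 (point x)) {∥ U ∥ x n} W≤2 u≤2 v≤2))
          (ev-zip _,_ (graphon≤2 W x) (graphon≤2 U x)) (V≈v (point x) 2ℚ (positive⁻¹ 2ℚ))

        error-off : ∀ x → ¬ (x ∈ Ex) → ∀ ε → 0ℚ < ε →
          Eventually (λ n → ∣ linear x n - ∣ gap W U x n ∣ ∣ ≤ ∣ 0ℚ ∣ + ε)
        error-off x x∉ ε 0<ε = from (small-factor 8ℚ ε 0≤8 0<ε)
          where
          cases : ∀ e → 0ℚ < e → 8ℚ * e ≤ ε →
            (∀ ε → 0ℚ < ε → Eventually (λ n → ∣ ∥ U ∥ x n ∣ ≤ ε)) ⊎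
            (∀ ε → 0ℚ < ε → Eventually (λ n → ∣ ∥ U ∥ x n - 1ℚ ∣ ≤ ε)) →
            Eventually (λ n → ∣ linear x n - ∣ gap W U x n ∣ ∣ ≤ ∣ 0ℚ ∣ + ε)
          cases e 0<e 8e≤ε (inj₁ u≈0) = ev-zip (λ {n} u≈ (W≈ , V≈) → rewrite-error x n (≤-trans
                  (linear-distance-near-0 {∥ W ∥ x n} {w (point x)} {∥ V ∥ x n} {v (point x)}
                    (0≤w (point x)) (w≤1 (point x)) {∥ U ∥ x n} {e} (<⇒≤ 0<e) W≈ V≈ u≈) 8e≤ε))
                (u≈0 e 0<e) (ev-zip _,_ (W≈w (point x) e 0<e) (V≈v (point x) e 0<e))
          cases e 0<e 8e≤ε (inj₂ u≈1) = ev-zip (λ {n} u≈ (W≈ , V≈) → rewrite-error x n (≤-trans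
                  (linear-distance-near-1 {∥ W ∥ x n} {w (point x)} {∥ V ∥ x n} {v (point x)} {∥ U ∥ x n} {e}
                    (0≤w (point x)) (w≤1 (point x)) (<⇒≤ 0<e) W≈ V≈ u≈) 8e≤ε))
                (u≈1 e 0<e) (ev-zip _,_ (W≈w (point x) e 0<e) (V≈v (point x) e 0<e))

          from : Σ[ e ∈ ℚ ] 0ℚ < e × 8ℚ * e ≤ ε → Eventually (λ n → ∣ linear x n - ∣ gap W U x n ∣ ∣ ≤ ∣ 0ℚ ∣ + ε)
          from (e , 0<e , 8e≤ε) = cases e 0<e 8e≤ε (dichotomy x x∉)

      -- ∣ W - U ∣ is almost everywhere linear in U, with coefficients constant on
      -- the cells of W; replacing U by V costs one box integral of V - U per cell.
      effective-estimate : ∀ {b e} → 0ℚ ≤ b → 0ℚ ≤ e →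
        (∀ B → Integral≤ (λ x n → χ x B * gap V U x n) b e) → ∀ η → 0ℚ < η →
        Σ[ r ∈ ℚ ] ∣ r - distance ∣ ≤ ι N * (ι N * b) ×
                   Approx (λ x n → ∣ gap W U x n ∣) r (ι N * (ι N * e) + η)
      effective-estimate {b} {e} 0≤b 0≤e h η 0<η =
        finish (weighted-integral N (gap≤1 V U) 0≤b 0≤e h c
          (λ p q p<N q<N → coefficient≤1 (proj₁ (entry-bounds i p<N q<N)) (proj₂ (entry-bounds i p<N q<N))))
        where
        linear≈ : Upper (λ x n → linear x n - ∣ gap W U x n ∣) (0ℚ + η)
        linear≈ = upper-ae {f = λ _ _ → 0ℚ} (8ℚ + 8ℚ) 0≤16
          (upper-0 λ x ε 0<ε → always λ _ → <⇒≤ 0<ε) error-off error-everywhere η 0<η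

        ring : ∀ e η → (0ℚ + e) + (0ℚ + η) ≡ e + η
        ring = solve-∀ ringℚ
        ring′ : ∀ d j → j ≡ (d + j) - d
        ring′ = solve-∀ ringℚ

        finish : Integral≤ (λ x n → grid N c x * gap V U x n) (ι N * (ι N * b)) (ι N * (ι N * e)) →
          Σ[ r ∈ ℚ ] ∣ r - distance ∣ ≤ ι N * (ι N * b) × Approx (λ x n → ∣ gap W U x n ∣) r (ι N * (ι N * e) + η)
        finish (r , r≤ , A) = distance + r ,
          ≤-trans (≤-reflexive (cong ∣_∣ (sym (ring′ distance r)))) r≤ ,
          approx-weaken (≤-reflexive (ring (ι N * (ι N * e)) η))
            (approx-≈ linear≈ (approx-+ (grid-integral M mixed) A))

      -- Stated up to propositional equality, because comparing rational expressions
      -- definitionally unfolds the arithmetic.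
      effective-estimate′ : ∀ {W′ V′ D n} → W ≡ W′ → V ≡ V′ → distance ≡ D → ι N ≡ n → ∀ b e → 0ℚ ≤ b → 0ℚ ≤ e →
        (∀ B → Integral≤ (λ x n → χ x B * gap V′ U x n) b e) → ∀ η → 0ℚ < η →
        Σ[ r ∈ ℚ ] ∣ r - D ∣ ≤ n * (n * b) × Approx (λ x n → ∣ gap W′ U x n ∣) r (n * (n * e) + η)
      effective-estimate′ refl refl refl refl b e = effective-estimate {b} {e}

  -- The search

  ι-∸ : ∀ {m n} → m ℕ.≤ n → ι (n ℕ.∸ m) ≡ ι n - ι m
  ι-∸ {m} {n} m≤n = trans (ring (ι (n ℕ.∸ m)) (ι m))
    (cong (_- ι m) (trans (sym (ι-+ (n ℕ.∸ m) m)) (cong ι_ (ℕₚ.m∸n+n≡m m≤n))))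
    where
    ring : ∀ a b → a ≡ (a + b) - b
    ring = solve-∀ ringℚ

  -- Zero exactly when P/(QM²) + 2^(-j) ≤ 2^(-n), for positive Q and M: both sides are multiplied by
  -- QM² · 2^j · 2^n.
  test : (P Q M j n : ℕ) → ℕ
  test P Q M j n = (P ℕ.* 2 ℕ.^ j ℕ.* 2 ℕ.^ n ℕ.+ Q ℕ.* (M ℕ.* M) ℕ.* 2 ℕ.^ n) ℕ.∸ Q ℕ.* (M ℕ.* M) ℕ.* 2 ℕ.^ j

  module _ (P Q M j n : ℕ) {{_ : NonZero Q}} {{_ : NonZero M}} {S e : ℚ} (S≡ : S * ι Q ≡ ι P) (e≡ : e * ι M ≡ 1ℚ) where

    private
      A B : ℕ
      A = P ℕ.* 2 ℕ.^ j ℕ.* 2 ℕ.^ n ℕ.+ Q ℕ.* (M ℕ.* M) ℕ.* 2 ℕ.^ n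
      B = Q ℕ.* (M ℕ.* M) ℕ.* 2 ℕ.^ j

      p q m J N a b : ℚ
      p = ι P
      q = ι Q
      m = ι M
      J = ι (2 ℕ.^ j)
      N = ι (2 ℕ.^ n)
      a = 2⁻^ j
      b = 2⁻^ n

      X : ℚ
      X = (q * (m * m)) * (J * N)

      X-positive : 0ℚ < X
      X-positive = *-positive (*-positive (ι-positive Q) (*-positive (ι-positive M) (ι-positive M)))
        (*-positive (ι-positive (2 ℕ.^ j) {{ℕₚ.m^n≢0 2 j}}) (ι-positive (2 ℕ.^ n) {{ℕₚ.m^n≢0 2 n}}))

      left : X * (S * (e * e) + a) ≡ ι A
      left = trans (ring S e a q m J N) (trans (cong₂ (λ s t → s * J * N + (q * (m * m)) * N * t)
          (trans (cong₂ (λ s t → s * (t * t)) S≡ e≡) (one p)) (2⁻-2^ j))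
        (trans (cong (p * J * N +_) (*-identityʳ ((q * (m * m)) * N)))
        (sym (trans (ι-+ (P ℕ.* 2 ℕ.^ j ℕ.* 2 ℕ.^ n) (Q ℕ.* (M ℕ.* M) ℕ.* 2 ℕ.^ n)) (cong₂ _+_
          (trans (ι-* (P ℕ.* 2 ℕ.^ j) (2 ℕ.^ n)) (cong (_* N) (ι-* P (2 ℕ.^ j))))
          (trans (ι-* (Q ℕ.* (M ℕ.* M)) (2 ℕ.^ n)) (cong (_* N) (trans (ι-* Q (M ℕ.* M)) (cong (q *_) (ι-* M M))))))))))
        where
        ring : ∀ S e a q m J N → ((q * (m * m)) * (J * N)) * (S * (e * e) + a) ≡
          ((S * q) * ((e * m) * (e * m))) * J * N + (q * (m * m)) * N * (a * J)
        ring = solve-∀ ringℚ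
        one : ∀ p → p * (1ℚ * 1ℚ) ≡ p
        one = solve-∀ ringℚ

      right : X * b ≡ ι B
      right = trans (ring b q m J N) (trans (cong (λ t → (q * (m * m)) * J * t) (2⁻-2^ n))
        (trans (*-identityʳ ((q * (m * m)) * J))
        (sym (trans (ι-* (Q ℕ.* (M ℕ.* M)) (2 ℕ.^ j)) (cong (_* J) (trans (ι-* Q (M ℕ.* M)) (cong (q *_) (ι-* M M))))))))
        where
        ring : ∀ b q m J N → ((q * (m * m)) * (J * N)) * b ≡ (q * (m * m)) * J * (b * N)
        ring = solve-∀ ringℚ

    test-sound : test P Q M j n ≡ 0 → S * (e * e) + 2⁻^ j ≤ 2⁻^ n
    test-sound h = *-cancel X-positive (≤-trans (≤-reflexive left)
      (≤-trans (ι-mono {A} {B} (ℕₚ.m∸n≡0⇒m≤n h)) (≤-reflexive (sym right))))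

    test-complete : S * (e * e) + 2⁻^ j ≤ 2⁻^ n → test P Q M j n ≡ 0
    test-complete h = ℕₚ.m≤n⇒m∸n≡0 {A} {B} (ι-cancel (≤-trans (≤-reflexive (sym left))
      (≤-trans (*-mono (<⇒≤ X-positive) h) (≤-reflexive right))))

  module Search (𝒮 : StepEnumeration) (k : ℕ → ℕ) where
    open Matrices 𝒮

    -- l j is so large that (N j)² · 2^(- l j) ≤ 2^(- j).
    N l i L M : ℕ → ℕ
    N j = parts (k j)
    l j = j ℕ.+ (N j ℕ.+ N j)
    i j = k (l j)
    L j = parts (i j)
    M j = N j ℕ.* L j

    M≢0 : ∀ j → NonZero (M j)
    M≢0 j = ℕₚ.m*n≢0 (N j) (L j)

    -- Arguments arrive as column, row, j, since each of the nested sums prepends its own counter.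
    w-cell v-cell : Vec ℕ 3 → Vec ℕ 3
    w-cell xs = let j = lookup xs 2F in k j ∷ lookup xs 1F ℕ./ L j ∷ lookup xs 0F ℕ./ L j ∷ []
    v-cell xs = let j = lookup xs 2F in i j ∷ lookup xs 1F ℕ./ N j ∷ lookup xs 0F ℕ./ N j ∷ []

    nw dw nv dv x y : Vec ℕ 3 → ℕ
    nw xs = num (w-cell xs)
    dw xs = ℕ.suc (den-1 (w-cell xs))
    nv xs = num (v-cell xs)
    dv xs = ℕ.suc (den-1 (v-cell xs))
    -- w + v - 2wv = w(1 - v) + v(1 - w), so that only nonnegative differences occur.
    x xs = nw xs ℕ.* (dv xs ℕ.∸ nv xs) ℕ.+ nv xs ℕ.* (dw xs ℕ.∸ nw xs)
    y xs = dw xs ℕ.* dv xs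

    x₂ y₂ : Vec ℕ 2 → ℕ
    x₂ xs = numerator x y (M (lookup xs 1F)) xs
    y₂ xs = denominator x y (M (lookup xs 1F)) xs

    P Q : ℕ → ℕ
    P j = numerator x₂ y₂ (M j) (j ∷ [])
    Q j = denominator x₂ y₂ (M j) (j ∷ [])

    y≢0 : ∀ zs → NonZero (y zs)
    y≢0 zs = ℕₚ.m*n≢0 (dw zs) (dv zs)

    y₂≢0 : ∀ zs → NonZero (y₂ zs)
    y₂≢0 zs = denominator≢0 x y y≢0 (M (lookup zs 1F)) zs

    Q≢0 : ∀ j → NonZero (Q j)
    Q≢0 j = denominator≢0 x₂ y₂ y₂≢0 (M j) (j ∷ [])

    private
      fraction : ∀ {w v : ℚ} {a b c d : ℕ} → w * ι b ≡ ι a → v * ι d ≡ ι c → a ℕ.≤ b → c ℕ.≤ d →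
        (w + v - 2ℚ * w * v) * ι (b ℕ.* d) ≡ ι (a ℕ.* (d ℕ.∸ c) ℕ.+ c ℕ.* (b ℕ.∸ a))
      fraction {w} {v} {a} {b} {c} {d} w≡ v≡ a≤b c≤d = trans (cong ((w + v - 2ℚ * w * v) *_) (ι-* b d))
        (trans (ring w v (ι b) (ι d)) (trans
          (cong₂ (λ s t → s * (ι d - t) + t * (ι b - s)) w≡ v≡)
          (sym (trans (ι-+ (a ℕ.* (d ℕ.∸ c)) (c ℕ.* (b ℕ.∸ a))) (cong₂ _+_
            (trans (ι-* a (d ℕ.∸ c)) (cong (ι a *_) (ι-∸ c≤d)))
            (trans (ι-* c (b ℕ.∸ a)) (cong (ι c *_) (ι-∸ a≤b))))))))
        where
        ring : ∀ w v b d → (w + v - 2ℚ * w * v) * (b * d) ≡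
          (w * b) * (d - v * d) + (v * d) * (b - w * b)
        ring = solve-∀ ringℚ

      -- Entries are at most 1, hence the truncated subtractions in `x` are exact.
      ≤denominator : ∀ {w : ℚ} {a b : ℕ} → w * ι b ≡ ι a → w ≤ 1ℚ → a ℕ.≤ b
      ≤denominator {w} {a} {b} w≡ w≤1 = ι-cancel (≤-trans (≤-reflexive (trans (sym w≡) (*-comm w (ι b))))
        (≤-trans (*-mono (0≤ι b) w≤1) (≤-reflexive (*-identityʳ (ι b)))))

    module _ (j : ℕ) where
      open Refined (k j) (i j) renaming (M to M′; M≢0 to M′≢0)

      mixed-fraction : ∀ a b → a ℕ.< M j → b ℕ.< M j → mixed a b * ι (y (b ∷ a ∷ j ∷ [])) ≡ ι (x (b ∷ a ∷ j ∷ []))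
      mixed-fraction a b a<M b<M = fraction {entry₁ a b} {entry₂ a b} w≡ v≡
        (≤denominator w≡ (proj₂ (entry-bounds (k j) (coarse₁ a<M) (coarse₁ b<M))))
        (≤denominator v≡ (proj₂ (entry-bounds (i j) (coarse₂ a<M) (coarse₂ b<M))))
        where
        w≡ : entry₁ a b * ι (dw (b ∷ a ∷ j ∷ [])) ≡ ι (nw (b ∷ a ∷ j ∷ []))
        w≡ = entry-ι (k j) (a ℕ./ L j) (b ℕ./ L j)
        v≡ : entry₂ a b * ι (dv (b ∷ a ∷ j ∷ [])) ≡ ι (nv (b ∷ a ∷ j ∷ []))
        v≡ = entry-ι (i j) (a ℕ./ N j) (b ℕ./ N j)

      sum-fraction : ∑ (M j) (λ a → ∑ (M j) (λ b → mixed a b)) * ι (Q j) ≡ ι (P j)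
      sum-fraction = numerator-spec x₂ y₂ (λ a → ∑ (M j) (λ b → mixed a b)) (M j) (j ∷ []) λ a a<M →
        numerator-spec x y (λ b → mixed a b) (M j) (a ∷ j ∷ []) λ b b<M → mixed-fraction a b a<M b<M

      D : ℚ
      D = distance

      -- For a named random-free U, `D` is within 2^(-j) of ‖ sⱼ - U ‖₁, so this inequality
      -- certifies that distance to be at most 2^(-n).
      record Accurate (n : ℕ) : Set where
        constructor accurate
        field
          bound : D + 2⁻^ j ≤ 2⁻^ n

      side-inverse : (ℤ.+ 1 / M′) * ι (M j) ≡ 1ℚ
      side-inverse = trans (/-ι 1 (M j) {{M≢0 j}}) ι-1

      search-sound : ∀ n → test (P j) (Q j) (M j) j n ≡ 0 → Accurate n
      search-sound n h = accurate (test-sound (P j) (Q j) (M j) j n {{Q≢0 j}} {{M≢0 j}}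
        {∑ (M j) (λ a → ∑ (M j) (λ b → mixed a b))} {ℤ.+ 1 / M′} sum-fraction side-inverse h)

      search-complete : ∀ n → Accurate n → test (P j) (Q j) (M j) j n ≡ 0
      search-complete n (accurate h) = test-complete (P j) (Q j) (M j) j n {{Q≢0 j}} {{M≢0 j}}
        {∑ (M j) (λ a → ∑ (M j) (λ b → mixed a b))} {ℤ.+ 1 / M′} sum-fraction side-inverse h

    module _ (K : ComputableSeq k) where

      module _ {n} {f : Vec ℕ n → ℕ} (F : Computable f) where

        computable-N : Computable (λ xs → N (f xs))
        computable-N = compose₁ (compose₁ F K) computable-parts

        computable-i : Computable (λ xs → i (f xs))
        computable-i = compose₁ (computable-+ F (computable-+ computable-N computable-N)) K

        computable-L : Computable (λ xs → L (f xs))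
        computable-L = compose₁ computable-i computable-parts

        computable-M : Computable (λ xs → M (f xs))
        computable-M = computable-* computable-N computable-L

      private
        J : Computable {3} (λ xs → lookup xs 2F)
        J = computable-lookup 2F

        /L : ∀ {f : Vec ℕ 3 → ℕ} → Computable f → Computable (λ xs → f xs ℕ./ L (lookup xs 2F))
        /L F = computable-/ F (computable-L J)

        /N : ∀ {f : Vec ℕ 3 → ℕ} → Computable f → Computable (λ xs → f xs ℕ./ N (lookup xs 2F))
        /N F = computable-/ F (computable-N J)

        NW : Computable nw
        NW = compose₃ (compose₁ J K) (/L (computable-lookup 1F)) (/L (computable-lookup 0F)) computable-num

        DW : Computable dw
        DW = computable-suc (compose₃ (compose₁ J K) (/L (computable-lookup 1F)) (/L (computable-lookup 0F)) computable-den-1)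

        NV : Computable nv
        NV = compose₃ (computable-i J) (/N (computable-lookup 1F)) (/N (computable-lookup 0F)) computable-num

        DV : Computable dv
        DV = computable-suc (compose₃ (computable-i J) (/N (computable-lookup 1F)) (/N (computable-lookup 0F)) computable-den-1)

        X : Computable x
        X = computable-+ (computable-* NW (computable-∸ DV NV)) (computable-* NV (computable-∸ DW NW))

        Y : Computable y
        Y = computable-* DW DV

        X₂ : Computable x₂
        X₂ = substitute (computable-numerator x y X Y) (computable-M (computable-lookup 1F))

        Y₂ : Computable y₂
        Y₂ = substitute (computable-denominator x y X Y) (computable-M (computable-lookup 1F))

        P′ : Computable {1} (λ xs → numerator x₂ y₂ (M (lookup xs 0F)) xs)
        P′ = substitute (computable-numerator x₂ y₂ X₂ Y₂) (computable-M (computable-lookup 0F))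

        Q′ : Computable {1} (λ xs → denominator x₂ y₂ (M (lookup xs 0F)) xs)
        Q′ = substitute (computable-denominator x₂ y₂ X₂ Y₂) (computable-M (computable-lookup 0F))

      computable-test : Computable {2} (λ xs → test (P (lookup xs 0F)) (Q (lookup xs 0F)) (M (lookup xs 0F)) (lookup xs 0F) (2 ℕ.+ lookup xs 1F))
      computable-test = computable-∸
        (computable-+ (computable-* (computable-* (compose₁ j P′) (computable-2^ j)) (computable-2^ n))
                      (computable-* QMM (computable-2^ n)))
        (computable-* QMM (computable-2^ j))
        where
        j : Computable {2} (λ xs → lookup xs 0F)
        j = computable-lookup 0F
        n : Computable {2} (λ xs → 2 ℕ.+ lookup xs 1F)
        n = computable-suc (computable-suc (computable-lookup 1F))
        QMM : Computable {2} (λ xs → Q (lookup xs 0F) ℕ.* (M (lookup xs 0F) ℕ.* M (lookup xs 0F)))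
        QMM = computable-* (compose₁ j Q′) (computable-* (computable-M j) (computable-M j))

      module _ (exists : ∀ n → ∃[ j ] test (P j) (Q j) (M j) j (2 ℕ.+ n) ≡ 0) where

        opaque
          -- The least solution is taken because it is the one that μ-recursion computes. The shift
          -- by 2 leaves room for a triangle inequality through U.
          found : ∀ n → Σ[ j ∈ ℕ ] test (P j) (Q j) (M j) j (2 ℕ.+ n) ≡ 0 ×
                        (∀ i → i ℕ.< j → test (P i) (Q i) (M i) i (2 ℕ.+ n) ≢ 0)
          found n = least-zero (λ j → test (P j) (Q j) (M j) j (2 ℕ.+ n)) (proj₁ (exists n)) (proj₂ (exists n))

          index : ℕ → ℕ
          index n = proj₁ (found n)

          index-sound : ∀ n → Accurate (index n) (2 ℕ.+ n)
          index-sound n = search-sound (index n) (2 ℕ.+ n) (proj₁ (proj₂ (found n)))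

          computable-index : ComputableSeq (λ n → k (index n))
          computable-index = compose₁ (computable-μ computable-test
            (λ { (n ∷ []) → proj₁ (proj₂ (found n)) }) (λ { (n ∷ []) → proj₂ (proj₂ (found n)) })) K

  -- Off the exceptional set only a double negation of the alternative is known; excluded middle
  -- removes it.
  RandomFree⇒null : ∀ {U} → RandomFree U → Σ[ Ex ∈ Pred (Cube 2) 0ℓ ] Null Ex ×
    (∀ x → ¬ (x ∈ Ex) → (∀ ε → 0ℚ < ε → Eventually (λ n → ∣ ∥ U ∥ x n ∣ ≤ ε)) ⊎
                        (∀ ε → 0ℚ < ε → Eventually (λ n → ∣ ∥ U ∥ x n - 1ℚ ∣ ≤ ε)))
  RandomFree⇒null {U} RF = _ , RF , λ { (x ∷ y ∷ []) x∉ → classify x y (by-contradiction x∉) }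
    where
    classify : ∀ x y → value U x y ≃ᵣ fromℚ 0ℚ ⊎ value U x y ≃ᵣ fromℚ 1ℚ →
      (∀ ε → 0ℚ < ε → Eventually (λ n → ∣ seq (value U x y) n ∣ ≤ ε)) ⊎
      (∀ ε → 0ℚ < ε → Eventually (λ n → ∣ seq (value U x y) n - 1ℚ ∣ ≤ ε))
    classify x y (inj₁ U≃0) = inj₁ λ ε 0<ε → ev-map
      (λ {n} → subst (λ z → ∣ z ∣ ≤ ε) (+-identityʳ (seq (value U x y) n))) (U≃0 ε 0<ε)
    classify x y (inj₂ U≃1) = inj₂ U≃1

  -- Convergence and correctness of the search

  quarters : ∀ ε → let q = ½ * (½ * ε) in q + q + q + q ≡ ε
  quarters = solve-∀ ringℚ

  0≤4 : 0ℚ ≤ 2ℚ + 2ℚ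
  0≤4 = nonNegative⁻¹ (2ℚ + 2ℚ)

  gap-triangle : ∀ a b u g g₁ g₂ → g ≡ a - b → g₁ ≡ a - u → g₂ ≡ b - u → ∣ g ∣ ≤ ∣ g₁ ∣ + ∣ g₂ ∣
  gap-triangle a b u _ _ _ refl refl refl = ≤-trans (≤-reflexive (cong ∣_∣ (ring a b u))) (∣p-q∣≤∣p∣+∣q∣ (a - u) (b - u))
    where
    ring : ∀ a b u → a - b ≡ (a - u) - (b - u)
    ring = solve-∀ ringℚ

  quarters≤ : ∀ j l → j ℕ.< l → 2⁻^ (2 ℕ.+ j) + 2⁻^ (2 ℕ.+ l) ≤ 2⁻^ j
  quarters≤ j l j<l = lin (2⁻-antitone (ℕₚ.+-monoʳ-≤ 2 (ℕₚ.<⇒≤ j<l)) ⊕ 4c≤ ⊕ 0≤c ⊕ 0≤c)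
    (ring (2⁻^ j) (2⁻^ (2 ℕ.+ j)) (2⁻^ (2 ℕ.+ l)))
    where
    0≤c : 0ℚ ≤ 2⁻^ (2 ℕ.+ j)
    0≤c = <⇒≤ (2⁻-positive (2 ℕ.+ j))
    4c≤ : 2⁻^ (2 ℕ.+ j) + 2⁻^ (2 ℕ.+ j) + 2⁻^ (2 ℕ.+ j) + 2⁻^ (2 ℕ.+ j) ≤ 2⁻^ j
    4c≤ = ≤-reflexive (quarters (2⁻^ j))
    ring : ∀ m c b → m - (c + b) ≡ (c + m + c + c) - (b + (c + c + c + c) + 0ℚ + 0ℚ)
    ring = solve-∀ ringℚ

  module Convergence (𝒮 : StepEnumeration) (U : Graphon) (RF : RandomFree U)
                     (k : ℕ → ℕ) (name : IsName 𝒮 d□≤ U k) where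
    open Matrices 𝒮 using (graphon; parts; entry; entry-value; step-distance′; step-integrable; module Refined)
    open Search 𝒮 k using (N; l; i; D; Accurate; accurate)

    s : ℕ → Graphon
    s j = graphon (k j)

    -- d is abstract so that its instances are never unfolded and compared.
    named : ∀ {ℓ} (d : Distance≤ ℓ) → IsName 𝒮 d U k →
      (∀ j l → j ℕ.< l → d (s j) (s l) (2⁻^ j)) × (∀ ε → 0ℚ < ε → ∃[ J ] (∀ j → J ℕ.≤ j → d (s j) U ε))
    named d h = h

    Ex : Pred (Cube 2) 0ℓ
    Ex = proj₁ (RandomFree⇒null {U} RF)

    ExNull : Null Ex
    ExNull = proj₁ (proj₂ (RandomFree⇒null {U} RF))

    dichotomy : ∀ x → ¬ (x ∈ Ex) → (∀ ε → 0ℚ < ε → Eventually (λ n → ∣ ∥ U ∥ x n ∣ ≤ ε)) ⊎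
                                   (∀ ε → 0ℚ < ε → Eventually (λ n → ∣ ∥ U ∥ x n - 1ℚ ∣ ≤ ε))
    dichotomy = proj₂ (proj₂ (RandomFree⇒null {U} RF))

    BoxIntegrals : ℕ → ℚ → ℚ → Set
    BoxIntegrals j b e = ∀ B → Integral≤ (λ x n → χ x B * gap (s j) U x n) b e

    box-limit : ∀ e → 0ℚ < e → ∃[ J ] (∀ j → J ℕ.≤ j → BoxIntegrals j (e + e) e)
    box-limit e 0<e = from (proj₂ (named d□≤ name) e 0<e)
      where
      from : ∃[ J ] (∀ j → J ℕ.≤ j → d□≤ (s j) U e) → ∃[ J ] (∀ j → J ℕ.≤ j → BoxIntegrals j (e + e) e)
      from (J , h) = J , λ j J≤j B → gap-box-integral (s j) U e (h j J≤j) B e 0<e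

    -- The name gives a rate only between its own terms. Passing through a term sₘ with m > j that
    -- is close enough to U transfers the rate to U at arbitrarily small loss.
    box-rate : ∀ j e → 0ℚ < e → BoxIntegrals j (2⁻^ j + e) e
    box-rate j e 0<e = from (small-factor (2ℚ + 2ℚ) e 0≤4 0<e)
      where
      combine : ∀ q → 0ℚ < q → (2ℚ + 2ℚ) * q ≤ e → ∀ J → (∀ j → J ℕ.≤ j → BoxIntegrals j (q + q) q) →
                BoxIntegrals j (2⁻^ j + e) e
      combine q 0<q 4q≤e J h B = gap-box-+ (s j) (s m) U B (2⁻^ j + q) (q + q) q q (2⁻^ j + e) e
          (lin (4q≤e ⊕ <⇒≤ 0<q) (ring (2⁻^ j) q e)) (lin (4q≤e ⊕ <⇒≤ 0<q ⊕ <⇒≤ 0<q) (ring′ q e))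
          (gap-box-integral (s j) (s m) (2⁻^ j) (proj₁ (named d□≤ name) j m (ℕₚ.m≤m⊔n (ℕ.suc j) J)) B q 0<q)
          (h m (ℕₚ.m≤n⊔m (ℕ.suc j) J) B)
        where
        m : ℕ
        m = ℕ.suc j ℕ.⊔ J
        ring : ∀ a q e → (a + e) - ((a + q) + (q + q)) ≡ (e + q) - ((2ℚ + 2ℚ) * q + 0ℚ)
        ring = solve-∀ ringℚ
        ring′ : ∀ q e → e - (q + q) ≡ (e + q + q) - ((2ℚ + 2ℚ) * q + 0ℚ + 0ℚ)
        ring′ = solve-∀ ringℚ
      from : Σ[ q ∈ ℚ ] 0ℚ < q × (2ℚ + 2ℚ) * q ≤ e → BoxIntegrals j (2⁻^ j + e) e
      from (q , 0<q , 4q≤e) = combine q 0<q 4q≤e (proj₁ (box-limit q 0<q)) (proj₂ (box-limit q 0<q))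

    step-approximation : ∀ p → 0ℚ < p → Σ[ t ∈ Step 2 ] Upper (λ x n → ∥ U ∥ x n - total (χ x) t) p
    step-approximation p 0<p = from (box-limit p 0<p)
      where
      from : ∃[ J ] (∀ j → J ℕ.≤ j → BoxIntegrals j (p + p) p) →
             Σ[ t ∈ Step 2 ] Upper (λ x n → ∥ U ∥ x n - total (χ x) t) p
      from (J , h) = subtract (s J) U p (step-integrable (k J) {s J} refl) (h J ℕₚ.≤-refl whole)

    -- The order of choices matters: the step function `t` near U is fixed first, and only then the
    -- tolerance `e` for box integrals, small relative to the mass of 1 - 2t. Since `t` does not
    -- depend on j, `box-limit` then yields J.
    soft-convergence : ∀ ε → 0ℚ < ε → ∃[ J ] (∀ j → J ℕ.≤ j →
      Integral≤ (λ x n → ∣ gap (s j) U x n ∣) ε ε)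
    soft-convergence ε 0<ε = from (small-factor (2ℚ + 2ℚ) q 0≤4 0<q)
      where
      q : ℚ
      q = ½ * (½ * ε)
      0<q : 0ℚ < q
      0<q = ½-positive (½-positive 0<ε)
      4q≤ε : q + q + q + q ≤ ε
      4q≤ε = ≤-reflexive (quarters ε)

      Goal : Set
      Goal = ∃[ J ] (∀ j → J ℕ.≤ j → Integral≤ (λ x n → ∣ gap (s j) U x n ∣) ε ε)

      Estimate : ℚ → ℚ → ℕ → Set
      Estimate p C j = ∀ {b e} → BoxIntegrals j b e → ∀ η → 0ℚ < η →
        Integral≤ (λ x n → ∣ gap (s j) U x n ∣) (C * b) (C * e + ((2ℚ + 2ℚ) * p + η))

      conclude : ∀ p C → (2ℚ + 2ℚ) * p ≤ q → (∀ j → Estimate p C j) →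
                 Σ[ e ∈ ℚ ] 0ℚ < e × C * e ≤ q → Goal
      conclude p C 4p≤q estimate (e , 0<e , Ce≤q) = finish (box-limit e 0<e)
        where
        finish : ∃[ J ] (∀ j → J ℕ.≤ j → BoxIntegrals j (e + e) e) → Goal
        finish (J , h) = J , λ j J≤j → bound (estimate j (h j J≤j) q 0<q)
          where
          bound : ∀ {j} → Integral≤ (λ x n → ∣ gap (s j) U x n ∣) (C * (e + e)) (C * e + ((2ℚ + 2ℚ) * p + q)) →
                  Integral≤ (λ x n → ∣ gap (s j) U x n ∣) ε ε
          bound (r , r≤ , A) = r ,
            ≤-trans r≤ (lin (Ce≤q ⊕ Ce≤q ⊕ 4q≤ε ⊕ <⇒≤ 0<q ⊕ <⇒≤ 0<q) (ring C e q ε)) ,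
            approx-weaken (lin (Ce≤q ⊕ 4p≤q ⊕ 4q≤ε ⊕ <⇒≤ 0<q) (ring′ (C * e) ((2ℚ + 2ℚ) * p) q ε)) A
            where
            ring : ∀ C e q ε → ε - C * (e + e) ≡ (q + q + ε + q + q) - (C * e + C * e + (q + q + q + q) + 0ℚ + 0ℚ)
            ring = solve-∀ ringℚ
            ring′ : ∀ a b q ε → ε - (a + (b + q)) ≡ (q + q + ε + q) - (a + b + (q + q + q + q) + 0ℚ)
            ring′ = solve-∀ ringℚ

      from : Σ[ p ∈ ℚ ] 0ℚ < p × (2ℚ + 2ℚ) * p ≤ q → Goal
      from (p , 0<p , 4p≤q) = with-step (step-approximation p 0<p)
        where
        with-step : Σ[ t ∈ Step 2 ] Upper (λ x n → ∥ U ∥ x n - total (χ x) t) p → Goal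
        with-step (t , T) = conclude p (mass (signs t)) 4p≤q (λ j → soft-estimate U Ex ExNull dichotomy (s j) t T)
          (small-factor (mass (signs t)) q (mass-nonneg (signs t)) 0<q)

    effective-rate : ∀ j η → 0ℚ < η →
      Σ[ r ∈ ℚ ] ∣ r - D j ∣ ≤ 2⁻^ j + η × Approx (λ x n → ∣ gap (s j) U x n ∣) r η
    effective-rate j η 0<η = from (small-factor (n * n) (½ * η) (*-nonneg (0≤ι (N j)) (0≤ι (N j))) (½-positive 0<η))
      where
      n : ℚ
      n = ι (N j)
      from : Σ[ e ∈ ℚ ] 0ℚ < e × (n * n) * e ≤ ½ * η →
             Σ[ r ∈ ℚ ] ∣ r - D j ∣ ≤ 2⁻^ j + η × Approx (λ x n → ∣ gap (s j) U x n ∣) r η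
      from (e , 0<e , n²e≤) = finish (effective-estimate′ U Ex ExNull dichotomy 𝒮 (k j) (i j)
          {s j} {s (l j)} {D j} {n} refl refl refl refl (2⁻^ (l j) + e) e (+-nonneg (<⇒≤ (2⁻-positive (l j))) (<⇒≤ 0<e)) (<⇒≤ 0<e) (box-rate (l j) e 0<e) (½ * η) (½-positive 0<η))
        where
        -- By the choice of `l j`, the left side is 2^(-j) times the square of n · 2^(-N), which is
        -- at most 1.
        n²2⁻l : n * (n * 2⁻^ (l j)) ≤ 2⁻^ j
        n²2⁻l = ≤-trans (≤-reflexive (trans
            (cong (λ z → n * (n * z)) (trans (2⁻-+ j (N j ℕ.+ N j)) (cong (2⁻^ j *_) (2⁻-+ (N j) (N j)))))
            (ring n (2⁻^ j) (2⁻^ (N j)))))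
          (≤-trans (*-mono (<⇒≤ (2⁻-positive j)) (≤-trans
              (*-mono (*-nonneg (0≤ι (N j)) (<⇒≤ (2⁻-positive (N j)))) (ι*2⁻≤1 (N j)))
              (≤-trans (≤-reflexive (*-identityʳ (n * 2⁻^ (N j)))) (ι*2⁻≤1 (N j)))))
            (≤-reflexive (*-identityʳ (2⁻^ j))))
          where
          ring : ∀ n j m → n * (n * (j * (m * m))) ≡ j * ((n * m) * (n * m))
          ring = solve-∀ ringℚ
        finish : Σ[ r ∈ ℚ ] ∣ r - D j ∣ ≤ n * (n * (2⁻^ (l j) + e)) ×
                            Approx (λ x n → ∣ gap (s j) U x n ∣) r (n * (n * e) + ½ * η) →
                 Σ[ r ∈ ℚ ] ∣ r - D j ∣ ≤ 2⁻^ j + η × Approx (λ x n → ∣ gap (s j) U x n ∣) r η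
        finish (r , r≤ , A) = r ,
          ≤-trans r≤ (lin (n²2⁻l ⊕ n²e≤ ⊕ ½ ⊛ <⇒≤ 0<η) (ring n (2⁻^ (l j)) e (2⁻^ j) η)) ,
          approx-weaken (lin n²e≤ (ring′ n e η)) A
          where
          ring : ∀ n a e b η → (b + η) - n * (n * (a + e)) ≡ (b + ½ * η + ½ * η) - (n * (n * a) + (n * n) * e + ½ * 0ℚ)
          ring = solve-∀ ringℚ
          ring′ : ∀ n e η → η - (n * (n * e) + ½ * η) ≡ ½ * η - (n * n) * e
          ring′ = solve-∀ ringℚ

    search-terminates : ∀ n → ∃[ j ] Accurate j n
    search-terminates n = from (soft-convergence ε 0<ε)
      where
      ε : ℚ
      -- An eighth of 2^(-n): the L¹ approximation, the uniqueness of integrals, the rate and the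
      -- term 2^(-j) of the criterion together cost at most 6ε.
      ε = 2⁻^ (3 ℕ.+ n)
      0<ε : 0ℚ < ε
      0<ε = 2⁻-positive (3 ℕ.+ n)
      8ε≤ : (ε + ε + ε + ε) + (ε + ε + ε + ε) ≤ 2⁻^ n
      8ε≤ = ≤-reflexive (eighths (2⁻^ n))
        where
        eighths : ∀ m → let e = ½ * (½ * (½ * m)) in (e + e + e + e) + (e + e + e + e) ≡ m
        eighths = solve-∀ ringℚ
      from : ∃[ J ] (∀ j → J ℕ.≤ j → Integral≤ (λ x n → ∣ gap (s j) U x n ∣) ε ε) →
             ∃[ j ] Accurate j n
      from (J , h) = j , accurate (compare (h j (ℕₚ.m≤m⊔n J (3 ℕ.+ n))) (effective-rate j ε 0<ε))
        where
        j : ℕ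
        j = J ℕ.⊔ (3 ℕ.+ n)
        2⁻j≤ε : 2⁻^ j ≤ ε
        2⁻j≤ε = 2⁻-antitone (ℕₚ.m≤n⊔m J (3 ℕ.+ n))
        compare : Integral≤ (λ x n → ∣ gap (s j) U x n ∣) ε ε →
                  Σ[ r ∈ ℚ ] ∣ r - D j ∣ ≤ 2⁻^ j + ε × Approx (λ x n → ∣ gap (s j) U x n ∣) r ε →
                  D j + 2⁻^ j ≤ 2⁻^ n
        compare (a , a≤ , A) (b , b≤ , B) = lin
          (proj₁ (∣∣-≤⇒ a≤) ⊕ proj₂ (∣∣-≤⇒ b≤) ⊕ proj₂ (∣∣-≤⇒ (approx-unique A B)) ⊕ 2⁻j≤ε ⊕ 2⁻j≤ε ⊕
            8ε≤ ⊕ <⇒≤ 0<ε ⊕ <⇒≤ 0<ε)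
          (ring a b (D j) (2⁻^ j) ε (2⁻^ n))
          where
          ring : ∀ a b d p e m → m - (d + p) ≡
            (e + (p + e) + (e + e) + e + e + m + e + e) -
            (a + - (b - d) + - (a - b) + p + p + ((e + e + e + e) + (e + e + e + e)) + 0ℚ + 0ℚ)
          ring = solve-∀ ringℚ

    CloseTo : ℕ → ℚ → Set
    CloseTo j q = ∀ η → 0ℚ < η → Σ[ r ∈ ℚ ] r ≤ q + η × Approx (λ x n → ∣ gap (s j) U x n ∣) r η

    accurate⇒close : ∀ j n → Accurate j n → CloseTo j (2⁻^ n)
    accurate⇒close j n (accurate h) η 0<η = from (effective-rate j η 0<η)
      where
      from : Σ[ r ∈ ℚ ] ∣ r - D j ∣ ≤ 2⁻^ j + η × Approx (λ x n → ∣ gap (s j) U x n ∣) r η →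
             Σ[ r ∈ ℚ ] r ≤ 2⁻^ n + η × Approx (λ x n → ∣ gap (s j) U x n ∣) r η
      from (r , r≤ , A) = r , lin (proj₁ (∣∣-≤⇒ r≤) ⊕ h) (ring r (D j) (2⁻^ j) η (2⁻^ n)) , A
        where
        ring : ∀ r d p η q → (q + η) - r ≡ ((p + η) + q) - ((r - d) + (d + p))
        ring = solve-∀ ringℚ

    -- The exact integral r between two step graphons is a fixed rational, so monotonicity of
    -- approximate integrals bounds it by p + q up to every ε, hence by p + q.
    close-pair : ∀ a b p q t → p + q ≤ t → CloseTo a p → CloseTo b q → d₁≤ (s a) (s b) t
    close-pair a b p q t p+q≤t A B = gap-distance (s a) (s b) t (bound (step-distance′ (k a) (k b) {s a} {s b} refl refl))
      where
      triangle : (λ x n → ∣ gap (s a) (s b) x n ∣) ≲ (λ x n → ∣ gap (s a) U x n ∣ + ∣ gap (s b) U x n ∣)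
      triangle = ≲-refl-≤ λ x n → gap-triangle (∥ s a ∥ x n) (∥ s b ∥ x n) (∥ U ∥ x n)
        (gap (s a) (s b) x n) (gap (s a) U x n) (gap (s b) U x n)
        (gap≡ (s a) (s b) x n) (gap≡ (s a) U x n) (gap≡ (s b) U x n)

      bound : Σ[ r ∈ ℚ ] Approx (λ x n → ∣ gap (s a) (s b) x n ∣) r 0ℚ → ∀ η → 0ℚ < η →
              Σ[ r ∈ ℚ ] r ≤ t + η × Approx (λ x n → ∣ gap (s a) (s b) x n ∣) r η
      bound (r , C) η 0<η = r , ≤-trans (≤-closure λ ε 0<ε → small ε (A (½ * (½ * ε)) (½-positive (½-positive 0<ε)))
                                                                 (B (½ * (½ * ε)) (½-positive (½-positive 0<ε))))
          (lin (p+q≤t ⊕ <⇒≤ 0<η) (ring₀ (p + q) t η)) , approx-weaken (<⇒≤ 0<η) C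
        where
        ring₀ : ∀ s t η → (t + η) - s ≡ (t + η) - (s + 0ℚ)
        ring₀ = solve-∀ ringℚ
        small : ∀ ε →
          Σ[ u ∈ ℚ ] u ≤ p + ½ * (½ * ε) × Approx (λ x n → ∣ gap (s a) U x n ∣) u (½ * (½ * ε)) →
          Σ[ u ∈ ℚ ] u ≤ q + ½ * (½ * ε) × Approx (λ x n → ∣ gap (s b) U x n ∣) u (½ * (½ * ε)) → r ≤ (p + q) + ε
        small ε (u , u≤ , T) (v , v≤ , T′) = lin (approx-mono triangle C (approx-+ T T′) ⊕ u≤ ⊕ v≤) (ring r u v p q ε)
          where
          ring : ∀ r t t′ p q ε → ((p + q) + ε) - r ≡
            (((t + t′) + (0ℚ + (½ * (½ * ε) + ½ * (½ * ε)))) + (p + ½ * (½ * ε)) + (q + ½ * (½ * ε))) - (r + t + t′)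
          ring = solve-∀ ringℚ

    d₁-close : ∀ a p q → CloseTo a p → p ≤ q → d₁≤ (s a) U q
    d₁-close a p q A p≤q = gap-distance (s a) U q λ η 0<η → from η (A η 0<η)
      where
      from : ∀ η → Σ[ r ∈ ℚ ] r ≤ p + η × Approx (λ x n → ∣ gap (s a) U x n ∣) r η →
             Σ[ r ∈ ℚ ] r ≤ q + η × Approx (λ x n → ∣ gap (s a) U x n ∣) r η
      from η (r , r≤ , T) = r , ≤-trans r≤ (p≤q ⊕ ≤-refl {η}) , T

    module _ (index : ℕ → ℕ) (sound : ∀ n → Accurate (index n) (2 ℕ.+ n)) where

      index-close : ∀ n → CloseTo (index n) (2⁻^ (2 ℕ.+ n))
      index-close n = accurate⇒close (index n) (2 ℕ.+ n) (sound n)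

      cauchy-name : ∀ j l → j ℕ.< l → d₁≤ (s (index j)) (s (index l)) (2⁻^ j)
      cauchy-name j l j<l = close-pair (index j) (index l) (2⁻^ (2 ℕ.+ j)) (2⁻^ (2 ℕ.+ l)) (2⁻^ j)
        (quarters≤ j l j<l) (index-close j) (index-close l)

      limit-name : ∀ ε → 0ℚ < ε → ∃[ J ] (∀ j → J ℕ.≤ j → d₁≤ (s (index j)) U ε)
      limit-name ε 0<ε = from (archimedean ε 0<ε)
        where
        from : ∃[ J ] 2⁻^ J ≤ ε → ∃[ J ] (∀ j → J ℕ.≤ j → d₁≤ (s (index j)) U ε)
        from (J , small) = J , λ j J≤j → d₁-close (index j) (2⁻^ (2 ℕ.+ j)) ε (index-close j)
          (≤-trans (2⁻-antitone (ℕₚ.m≤n⇒m≤1+n (ℕₚ.m≤n⇒m≤1+n J≤j))) small)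

      naming : ∀ {ℓ} (d : Distance≤ ℓ) →
        (∀ j l → j ℕ.< l → d (s (index j)) (s (index l)) (2⁻^ j)) ×
        (∀ ε → 0ℚ < ε → ∃[ J ] (∀ j → J ℕ.≤ j → d (s (index j)) U ε)) → IsName 𝒮 d U (λ n → k (index n))
      naming d h = h

      d₁-name : IsName 𝒮 d₁≤ U (λ n → k (index n))
      d₁-name = naming d₁≤ (cauchy-name , limit-name)

  computable-d₁ : (𝒮 : StepEnumeration) (U : Graphon) → RandomFree U →
    ComputableIn 𝒮 d□≤ U → ComputableIn 𝒮 d₁≤ U
  computable-d₁ 𝒮 U RF (k , K , name) = _ , Search.computable-index 𝒮 k K exists ,
    Convergence.d₁-name 𝒮 U RF k name (Search.index 𝒮 k K exists) (Search.index-sound 𝒮 k K exists)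
    where
    open Search 𝒮 k

    exists : ∀ n → ∃[ j ] test (P j) (Q j) (M j) j (2 ℕ.+ n) ≡ 0
    exists n = decide (Convergence.search-terminates 𝒮 U RF k name (2 ℕ.+ n))
      where
      decide : ∃[ j ] Accurate j (2 ℕ.+ n) → ∃[ j ] test (P j) (Q j) (M j) j (2 ℕ.+ n) ≡ 0
      decide (j , h) = j , search-complete j (2 ℕ.+ n) h

theorem4p6 : (em : ExcludedMiddle 0ℓ) (𝒮 : StepEnumeration) (U : Graphon) →
    RandomFree U →
    ComputableIn 𝒮 (Integration.d□≤ em) U →
    ComputableIn 𝒮 (Integration.d₁≤ em) U
theorem4p6 = computable-d₁
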